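{- For every natural number $N \neq 56$ one has $t(N) \geq \lfloor 2N/7 \rfloor$. Moreover this can be achieved by rearranging only the prime factors $2,3,5,7$: for every natural number $N\neq 56$ one has $t_{2,3,5,7}(N) \geq \lfloor 2N/7\rfloor$.
   Context: For a natural number $N$, $t(N)$ denotes the largest $t$ for which there exist natural numbers $a_1,\dots,a_N$ with $a_i \geq t$ for all $i$ and $a_1\cdots a_N = N!$. Call a natural number $7$-smooth if all its prime factors are at most $7$, and $7$-rough if it has no prime factor $\leq 7$. Each $n \in \{1,\dots,N\}$ factors uniquely as $n = d_n m_n$ with $d_n$ $7$-smooth and $m_n$ $7$-rough. Define $t_{2,3,5,7}(N)$ to be the largest $t$ for which there exist $7$-smooth natural numbers $\ell_1,\dots,\ell_N$ such that $\ell_1\cdots\ell_N$ divides $d_1\cdots d_N$ and $\ell_n m_n \geq t$ for all $1 \leq n \leq N$ (i.e., a $t$-admissible (sub)factorization of $N!$ obtained from the standard factorization $\{1,\dots,N\}$ by rearranging only powers of $2,3,5,7$). Clearly $t(N) \geq t_{2,3,5,7}(N)$. -}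

module Defs where

open import Data.Nat using (ℕ; zero; suc; _*_; _≤_; _<_; _!)
open import Relation.Binary.PropositionalEquality using (_≡_)
open import Data.Nat.Divisibility using (_∣_)
open import Data.Nat.Primality using (Prime)
open import Data.Fin using (Fin; toℕ)
import Data.Fin as F
open import Data.Product using (Σ; _×_)

prodFin : (N : ℕ) → (Fin N → ℕ) → ℕ
prodFin zero    a = 1
prodFin (suc N) a = a F.zero * prodFin N (λ i → a (F.suc i))

-- 7-smooth: every prime factor is at most 7 (note: 0 is not 7-smooth)
Smooth7 : ℕ → Set
Smooth7 n = ∀ p → Prime p → p ∣ n → p ≤ 7

-- 7-rough: no prime factor ≤ 7 (note: 0 is not 7-rough)
Rough7 : ℕ → Set
Rough7 n = ∀ p → Prime p → p ∣ n → 7 < p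

-- t is admissible for N, i.e. t(N) ≥ t: there are natural numbers
-- a₁,…,a_N with product N! and all aᵢ ≥ t
Admissible : ℕ → ℕ → Set
Admissible N t = Σ (Fin N → ℕ) λ a → (prodFin N a ≡ (N !)) × (∀ i → t ≤ a i)

idx : {N : ℕ} → Fin N → ℕ
idx i = suc (toℕ i)

-- t is admissible for N using only rearrangement of 2,3,5,7, i.e.
-- t_{2,3,5,7}(N) ≥ t, where d n, m n are the 7-smooth / 7-rough parts of n
Admissible2357 : (N : ℕ) → (d m : ℕ → ℕ) → ℕ → Set
Admissible2357 N d m t =
  Σ (Fin N → ℕ) λ ℓ →
    (∀ i → Smooth7 (ℓ i)) ×
    (prodFin N ℓ ∣ prodFin N (λ i → d (idx i))) ×
    (∀ i → t ≤ ℓ i * m (idx i))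

module Submission where

-- Write n = g m, where g is the part of n made of 2, 3, 5, 7 with exponents up to certain caps, and
-- replace g by a smooth number that depends only on m and is at least t / m.  The exponents spent are
-- then combinations of the counts #{n ≤ N : m ≤ Y}, and these are alternating sums of minima
-- ⌊N / a⌋ ⊓ ⌊Y / b⌋.  For large N good replacements leave a positive proportion of each of the four
-- primes unspent.  Hence a replacement made for one (N , t) also serves slightly larger N and t, and
-- about 1500 of them cover 400 < t < 4.8 * 10 ^ 7.  As a count grows linearly up to a bounded error, a
-- replacement with a margin at t = 10 ^ 18 serves all t ≥ 4.1 * 10 ^ 7.  For t ≤ 401 there is too little
-- slack, and the smooth number is chosen for each n separately.

open import Defs
open import Data.Bool using (Bool; true; false; if_then_else_; _∧_)
open import Data.Bool.Properties using (T-≡)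
open import Data.Fin using (Fin)
import Data.Fin as F
open import Data.Fin.Properties using (toℕ<n)
open import Data.List using (List; []; _∷_; map; length)
open import Data.List.Properties using (map-cong)
open import Data.List.Relation.Unary.All using (All; []; _∷_)
open import Data.Nat
open import Data.Nat.Coprimality using (Coprime; coprime-divisor; gcd≡1⇒coprime)
open import Data.Nat.DivMod using (m*n/n≡m; m/n*n≤m; m≡m%n+[m/n]*n; m%n<n)
open import Data.Nat.Divisibility
open import Data.Nat.GCD using (gcd)
open import Data.Nat.ListAction using (product)
open import Data.Nat.Primality using (Prime; prime?; euclidsLemma)
open import Data.Nat.Primality.Factorisation using (factorise)
open import Data.Nat.Properties
open import Data.Nat.Solver using (module +-*-Solver)
open import Data.Product using (∃; _×_; _,_; proj₁; proj₂)
open import Data.Sum using (inj₁; inj₂)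
open import Data.Unit using (⊤; tt)
open import Function.Bundles using (Equivalence)
open import Relation.Binary.PropositionalEquality
open import Relation.Nullary using (¬_; yes; no; does; contradiction)
open import Relation.Nullary.Decidable using (toWitness; toWitnessFalse; dec-true; dec-false)

-- The new product only has to divide the old one, since a surplus can be put into a single factor.
-- Hence the primes decouple, and everything comes down to four inequalities: exponent spent at most
-- exponent available. The obstacle is that these are tested by evaluation, for N up to about 1.7 *
-- 10 ^ 8, so that no test may run through all n ≤ N. That is why the replacement is a step function
-- of m alone, and why exponents are capped: with the caps 4, 2, 1, 1 a count is a signed sum of 405
-- minima, however large N is. The same number controls the rounding error when a count is rescaled
-- to another threshold, and so decides where the asymptotic argument can take over. In between, the
-- unspent primes let one certificate serve a range in which t grows by a factor of about 1 + 1 / q,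
-- so that the number of certificates is only logarithmic in the length of the range. The
-- exceptional N = 56, with threshold 16, is stepped over in `start`.

-- Finite sums and products over 1, ..., N.

sumTo : ℕ → (ℕ → ℕ) → ℕ
sumTo zero    f = 0
sumTo (suc N) f = sumTo N f + f (suc N)

prodTo : ℕ → (ℕ → ℕ) → ℕ
prodTo zero    f = 1
prodTo (suc N) f = prodTo N f * f (suc N)

sumTo-cong : ∀ N {f g : ℕ → ℕ} → (∀ n → 1 ≤ n → n ≤ N → f n ≡ g n) → sumTo N f ≡ sumTo N g
sumTo-cong zero    h = refl
sumTo-cong (suc N) h = cong₂ _+_ (sumTo-cong N λ n 1≤n n≤N → h n 1≤n (m≤n⇒m≤1+n n≤N)) (h (suc N) (s≤s z≤n) ≤-refl)

sumTo-mono : ∀ N {f g : ℕ → ℕ} → (∀ n → f n ≤ g n) → sumTo N f ≤ sumTo N g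
sumTo-mono zero    h = z≤n
sumTo-mono (suc N) h = +-mono-≤ (sumTo-mono N h) (h (suc N))

sumTo-+ : ∀ N (f g : ℕ → ℕ) → sumTo N (λ n → f n + g n) ≡ sumTo N f + sumTo N g
sumTo-+ zero    f g = refl
sumTo-+ (suc N) f g rewrite sumTo-+ N f g =
  solve 4 (λ a b c d → (a :+ b) :+ (c :+ d) := (a :+ c) :+ (b :+ d)) refl (sumTo N f) (sumTo N g) (f (suc N)) (g (suc N))
  where open +-*-Solver

sumTo-*ˡ : ∀ N c (f : ℕ → ℕ) → sumTo N (λ n → c * f n) ≡ c * sumTo N f
sumTo-*ˡ zero    c f = sym (*-zeroʳ c)
sumTo-*ˡ (suc N) c f rewrite sumTo-*ˡ N c f = sym (*-distribˡ-+ c (sumTo N f) (f (suc N)))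

sumTo-zero : ∀ N → sumTo N (λ _ → 0) ≡ 0
sumTo-zero zero    = refl
sumTo-zero (suc N) = trans (+-identityʳ _) (sumTo-zero N)

sumTo-one : ∀ N → sumTo N (λ _ → 1) ≡ N
sumTo-one zero    = refl
sumTo-one (suc N) = trans (+-comm _ 1) (cong suc (sumTo-one N))

prodTo-cong : ∀ N {f g : ℕ → ℕ} → (∀ n → 1 ≤ n → n ≤ N → f n ≡ g n) → prodTo N f ≡ prodTo N g
prodTo-cong zero    h = refl
prodTo-cong (suc N) h = cong₂ _*_ (prodTo-cong N λ n 1≤n n≤N → h n 1≤n (m≤n⇒m≤1+n n≤N)) (h (suc N) (s≤s z≤n) ≤-refl)

prodTo-* : ∀ N (f g : ℕ → ℕ) → prodTo N (λ n → f n * g n) ≡ prodTo N f * prodTo N g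
prodTo-* zero    f g = refl
prodTo-* (suc N) f g rewrite prodTo-* N f g = [m*n]*[o*p]≡[m*o]*[n*p] (prodTo N f) (prodTo N g) (f (suc N)) (g (suc N))

prodTo-^ : ∀ N p (f : ℕ → ℕ) → prodTo N (λ n → p ^ f n) ≡ p ^ sumTo N f
prodTo-^ zero    p f = refl
prodTo-^ (suc N) p f rewrite prodTo-^ N p f = sym (^-distribˡ-+-* p (sumTo N f) (f (suc N)))

prodTo-id : ∀ N → prodTo N (λ n → n) ≡ N !
prodTo-id zero    = refl
prodTo-id (suc N) rewrite prodTo-id N = *-comm (N !) (suc N)

-- `prodFin` splits off the first factor, `prodTo` the last; this translates between the two.
prodTo-shift : ∀ N (f : ℕ → ℕ) → f 1 * prodTo N (λ n → f (suc n)) ≡ prodTo (suc N) f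
prodTo-shift zero    f = trans (*-identityʳ _) (sym (*-identityˡ _))
prodTo-shift (suc N) f = trans (sym (*-assoc (f 1) _ _)) (cong (_* f (suc (suc N))) (prodTo-shift N f))

prodFin≡prodTo : ∀ N (f : ℕ → ℕ) → prodFin N (λ i → f (idx i)) ≡ prodTo N f
prodFin≡prodTo zero    f = refl
prodFin≡prodTo (suc N) f = trans (cong (f 1 *_) (prodFin≡prodTo N (λ n → f (suc n)))) (prodTo-shift N f)

-- Smooth and rough numbers.

Smooth7-* : ∀ {a b} → Smooth7 a → Smooth7 b → Smooth7 (a * b)
Smooth7-* {a} {b} sa sb p pp p∣ab with euclidsLemma a b pp p∣ab
... | inj₁ p∣a = sa p pp p∣a
... | inj₂ p∣b = sb p pp p∣b

Smooth7-∣ : ∀ {a b} → a ∣ b → Smooth7 b → Smooth7 a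
Smooth7-∣ a∣b sb p pp p∣a = sb p pp (∣-trans p∣a a∣b)

≤7⇒Smooth7 : ∀ {a} → 1 ≤ a → a ≤ 7 → Smooth7 a
≤7⇒Smooth7 {suc a} _ a≤7 p pp p∣a = ≤-trans (∣⇒≤ p∣a) a≤7

Smooth7-^ : ∀ {a} e → Smooth7 a → Smooth7 (a ^ e)
Smooth7-^ zero    sa = ≤7⇒Smooth7 ≤-refl (s≤s z≤n)
Smooth7-^ (suc e) sa = Smooth7-* sa (Smooth7-^ e sa)

prime-divisor : ∀ n → 2 ≤ n → ∃ λ p → Prime p × p ∣ n
prime-divisor (suc n) 2≤n with factorise (suc n)
... | record { factors = [] ; isFactorisation = eq } = contradiction 2≤n (<⇒≱ (s≤s (≤-reflexive eq)))
... | record { factors = p ∷ ps ; isFactorisation = eq ; factorsPrime = pp ∷ _ } =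
  p , pp , subst (p ∣_) (sym eq) (m∣m*n (product ps))

-- Every prime divides 0, in particular 11, which is greater than 7.
Smooth7⇒NonZero : ∀ {a} → Smooth7 a → NonZero a
Smooth7⇒NonZero sa = ≢-nonZero λ a≡0 →
  toWitnessFalse {a? = 11 ≤? 7} _ (sa 11 (toWitness {a? = prime? 11} _) (subst (11 ∣_) (sym a≡0) (11 ∣0)))

-- A prime factor of a common divisor would be both at most 7 and greater than 7.
smooth-rough-coprime : ∀ {a m} → Smooth7 a → Rough7 m → Coprime a m
smooth-rough-coprime {a} sa rm {zero} (0∣a , _) = contradiction (0∣⇒≡0 0∣a) (≢-nonZero⁻¹ a ⦃ Smooth7⇒NonZero sa ⦄)
smooth-rough-coprime sa rm {suc zero} _ = refl
smooth-rough-coprime sa rm {i@(suc (suc _))} (i∣a , i∣m) with prime-divisor i (s≤s (s≤s z≤n))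
... | p , pp , p∣i = contradiction (sa p pp (∣-trans p∣i i∣a)) (<⇒≱ (rm p pp (∣-trans p∣i i∣m)))

-- From exchanges to admissible factorizations.

-- Each n ≤ N trades its smooth divisor b n for the smooth number a n.
record Exchange (N t : ℕ) : Set where
  field
    a b      : ℕ → ℕ
    a-smooth : ∀ n → Smooth7 (a n)
    b-smooth : ∀ n → Smooth7 (b n)
    b∣n      : ∀ n → b n ∣ n
    large    : ∀ n → 1 ≤ n → n ≤ N → t * b n ≤ a n * n
    balanced : prodTo N a ∣ prodTo N b

module _ {N t : ℕ} (E : Exchange N t) where
  open Exchange E

  private
    -- The factor `b n` cancels from the size condition. Both conclusions below rest on this: once x
    -- is the rough part and c the rest of the smooth part, once x = 1.
    large-cofactor : ∀ n c x → 1 ≤ n → n ≤ N → n ≡ x * c * b n → t ≤ a n * c * x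
    large-cofactor n c x 1≤n n≤N n≡ = *-cancelʳ-≤ t (a n * c * x) (b n) ⦃ Smooth7⇒NonZero (b-smooth n) ⦄
      (≤-trans (large n 1≤n n≤N) (≤-reflexive (trans (cong (a n *_) n≡)
        (solve 4 (λ a c x b → a :* (x :* c :* b) := a :* c :* x :* b) refl (a n) c x (b n)))))
      where open +-*-Solver

  -- `b n` divides n = d n * m n and is coprime to the rough m n, hence divides d n. So ℓ n can be d
  -- n with its factor `b n` replaced by `a n`.
  exchange-2357 : (d m : ℕ → ℕ) →
    (∀ n → 1 ≤ n → n ≤ N → (n ≡ d n * m n) × Smooth7 (d n) × Rough7 (m n)) → Admissible2357 N d m t
  exchange-2357 d m dm = (λ i → ℓ (idx i)) , smooth , divides-d , (λ i → ℓ-large (idx i) (s≤s z≤n) (toℕ<n i))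
    where
    r : ℕ → ℕ
    r n with b n ∣? d n
    ... | yes b∣d = quotient b∣d
    -- A default value: nothing is assumed about d outside 1, ..., N. Inside that range `d≡`
    -- excludes this case.
    ... | no  _   = 1

    d≡ : ∀ n → 1 ≤ n → n ≤ N → d n ≡ r n * b n
    d≡ n 1≤n n≤N with b n ∣? d n
    ... | yes b∣d = m∣n⇒n≡quotient*m b∣d
    ... | no  b∤d with dm n 1≤n n≤N
    ...   | n≡ , sd , rm = contradiction
            (coprime-divisor (smooth-rough-coprime (b-smooth n) rm)
              (subst (b n ∣_) (trans n≡ (*-comm (d n) (m n))) (b∣n n))) b∤d

    ℓ : ℕ → ℕ
    ℓ n = a n * r n

    smooth : ∀ i → Smooth7 (ℓ (idx i))
    smooth i = Smooth7-* (a-smooth n) (Smooth7-∣ (subst (r n ∣_) (sym (d≡ n 1≤n n≤N)) (m∣m*n (b n)))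
                                                 (proj₁ (proj₂ (dm n 1≤n n≤N))))
      where
      n = idx i
      1≤n : 1 ≤ n
      1≤n = s≤s z≤n
      n≤N = toℕ<n i

    ℓ-large : ∀ n → 1 ≤ n → n ≤ N → t ≤ ℓ n * m n
    ℓ-large n 1≤n n≤N = large-cofactor n (r n) (m n) 1≤n n≤N
      (trans (proj₁ (dm n 1≤n n≤N)) (trans (cong (_* m n) (d≡ n 1≤n n≤N))
        (solve 3 (λ r b m → r :* b :* m := m :* r :* b) refl (r n) (b n) (m n))))
      where open +-*-Solver

    divides-d : prodFin N (λ i → ℓ (idx i)) ∣ prodFin N (λ i → d (idx i))
    divides-d rewrite prodFin≡prodTo N ℓ | prodFin≡prodTo N d | prodTo-cong N {d} {λ n → r n * b n} d≡
                    | prodTo-* N a r | prodTo-* N r b | *-comm (prodTo N r) (prodTo N b)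
      = *-monoˡ-∣ (prodTo N r) balanced

  exchange-admissible : Admissible N t
  exchange-admissible = enlarge N (λ n → a n * c n) prod∣ λ n 1≤n n≤N →
      ≤-trans (large-cofactor n (c n) 1 1≤n n≤N (trans (m∣n⇒n≡quotient*m (b∣n n)) (cong (_* b n) (sym (*-identityˡ (c n))))))
              (≤-reflexive (*-identityʳ _))
    where
    c : ℕ → ℕ
    c n = quotient (b∣n n)

    prod∣ : prodTo N (λ n → a n * c n) ∣ N !
    prod∣ rewrite sym (prodTo-id N)
                | prodTo-cong N {λ n → n} {λ n → b n * c n} (λ n _ _ → m∣n⇒n≡m*quotient (b∣n n))
                | prodTo-* N a c | prodTo-* N b c = *-monoˡ-∣ (prodTo N c) balanced

    enlarge : ∀ N (f : ℕ → ℕ) → prodTo N f ∣ N ! → (∀ n → 1 ≤ n → n ≤ N → t ≤ f n) → Admissible N t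
    enlarge zero    f _ _ = (λ ()) , refl , λ ()
    enlarge (suc N) f (divides q eq) h = g , prod , g-large
      where
      g : Fin (suc N) → ℕ
      -- The first factor absorbs the quotient q, which turns a divisor of the factorial into the
      -- factorial itself. As q is nonzero, the factor stays large.
      g F.zero    = q * f 1
      g (F.suc i) = f (suc (idx i))

      prod : prodFin (suc N) g ≡ suc N !
      prod = begin
        q * f 1 * prodFin N (λ i → f (suc (idx i))) ≡⟨ cong (q * f 1 *_) (prodFin≡prodTo N (λ n → f (suc n))) ⟩
        q * f 1 * prodTo N (λ n → f (suc n))        ≡⟨ *-assoc q (f 1) _ ⟩
        q * (f 1 * prodTo N (λ n → f (suc n)))      ≡⟨ cong (q *_) (prodTo-shift N f) ⟩
        q * prodTo (suc N) f                        ≡⟨ sym eq ⟩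
        suc N !                                     ∎
        where open ≡-Reasoning

      q≢0 : NonZero q
      q≢0 = ≢-nonZero λ q≡0 → contradiction (trans eq (cong (_* prodTo (suc N) f) q≡0)) (≢-nonZero⁻¹ (suc N !) ⦃ (suc N) !≢0 ⦄)

      g-large : ∀ i → t ≤ g i
      g-large F.zero    = ≤-trans (h 1 ≤-refl (s≤s z≤n)) (m≤n*m (f 1) q ⦃ q≢0 ⦄)
      g-large (F.suc i) = h (suc (idx i)) (s≤s z≤n) (s≤s (toℕ<n i))

-- The additional numbers n > N are left alone: they exceed N ≥ t, so they are already large enough.
-- This is how one certificate serves a whole range.
exchange-mono : ∀ {N N′ t t′} → N ≤ N′ → t′ ≤ t → t ≤ N → Exchange N t → Exchange N′ t′
exchange-mono {N} {N′} {t} {t′} N≤N′ t′≤t t≤N E = record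
  { a = pad a ; b = pad b ; a-smooth = pad-smooth a a-smooth ; b-smooth = pad-smooth b b-smooth
  ; b∣n = pad-∣ ; large = pad-large ; balanced = pad-balanced N′ N≤N′ }
  where
  open Exchange E
  pad : (ℕ → ℕ) → ℕ → ℕ
  pad f n with n ≤? N
  ... | yes _ = f n
  ... | no  _ = 1

  pad-smooth : ∀ f → (∀ n → Smooth7 (f n)) → ∀ n → Smooth7 (pad f n)
  pad-smooth f sf n with n ≤? N
  ... | yes _ = sf n
  ... | no  _ = ≤7⇒Smooth7 ≤-refl (s≤s z≤n)

  pad-∣ : ∀ n → pad b n ∣ n
  pad-∣ n with n ≤? N
  ... | yes _ = b∣n n
  ... | no  _ = 1∣ n

  pad-large : ∀ n → 1 ≤ n → n ≤ N′ → t′ * pad b n ≤ pad a n * n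
  pad-large n 1≤n n≤N′ with n ≤? N
  ... | yes n≤N = ≤-trans (*-monoˡ-≤ (b n) t′≤t) (large n 1≤n n≤N)
  ... | no  n≰N rewrite *-identityʳ t′ | *-identityˡ n = ≤-trans t′≤t (≤-trans t≤N (<⇒≤ (≰⇒> n≰N)))

  pad-inside : ∀ f n → 1 ≤ n → n ≤ N → pad f n ≡ f n
  pad-inside f n _ n≤N with n ≤? N
  ... | yes _   = refl
  ... | no  n≰N = contradiction n≤N n≰N

  pad-outside : ∀ f {n} → N < n → pad f n ≡ 1
  pad-outside f {n} N<n with n ≤? N
  ... | yes n≤N = contradiction N<n (≤⇒≯ n≤N)
  ... | no  _   = refl

  pad-balanced : ∀ M → N ≤ M → prodTo M (pad a) ∣ prodTo M (pad b)
  pad-balanced M N≤M with m≤n⇒m<n∨m≡n N≤M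
  ... | inj₂ refl rewrite prodTo-cong N (pad-inside a) | prodTo-cong N (pad-inside b) = balanced
  pad-balanced (suc M) N≤M | inj₁ (s≤s N≤M′)
    rewrite pad-outside a (s≤s N≤M′) | pad-outside b (s≤s N≤M′) = *-monoˡ-∣ 1 (pad-balanced M N≤M′)

-- Floor division and capped prime exponents.

-- Division by 0 gives 0.
infixl 7 _div_
_div_ : ℕ → ℕ → ℕ
m div zero  = 0
m div suc n = m / suc n

*-div : ∀ p k → 1 ≤ p → (p * k) div p ≡ k
*-div (suc p) k _ = trans (cong (_/ suc p) (*-comm (suc p) k)) (m*n/n≡m k (suc p))

div-* : ∀ p n → 1 ≤ p → p * (n div p) ≤ n
div-* (suc p) n _ = ≤-trans (≤-reflexive (*-comm (suc p) (n / suc p))) (m/n*n≤m n (suc p))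

<-div-suc : ∀ p n → 1 ≤ p → n < p * suc (n div p)
<-div-suc (suc p) n _ = begin-strict
  n                                      ≡⟨ m≡m%n+[m/n]*n n (suc p) ⟩
  n % suc p + n / suc p * suc p          <⟨ +-monoˡ-< _ (m%n<n n (suc p)) ⟩
  suc p + n / suc p * suc p              ≡⟨ *-comm (suc (n / suc p)) (suc p) ⟩
  suc p * suc (n / suc p)                ∎
  where open ≤-Reasoning

≤-div⇒*-≤ : ∀ p {k n} → 1 ≤ p → k ≤ n div p → p * k ≤ n
≤-div⇒*-≤ p 1≤p k≤ = ≤-trans (*-monoʳ-≤ p k≤) (div-* p _ 1≤p)

*-≤⇒≤-div : ∀ p {k n} → 1 ≤ p → p * k ≤ n → k ≤ n div p
*-≤⇒≤-div (suc p) {k} {n} 1≤p pk≤n = ≤-pred (*-cancelˡ-< (suc p) k (suc (n div suc p)) (≤-<-trans pk≤n (<-div-suc (suc p) n 1≤p)))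

-- The floor of n / p rises by one at the multiples of p and nowhere else. This lemma and the next
-- are the two cases of the induction in `sumTo-split`.
div-suc-∣ : ∀ p n k → 1 ≤ p → suc n ≡ p * k → k ≡ suc (n div p)
div-suc-∣ p n zero 1≤p eq = contradiction (trans eq (*-zeroʳ p)) λ ()
div-suc-∣ p@(suc p-1) n (suc k) 1≤p eq = cong suc (≤-antisym
  (*-≤⇒≤-div p 1≤p (≤-pred (≤-trans (+-monoˡ-≤ (p * k) (s≤s (z≤n {p-1}))) (≤-reflexive (trans (sym (*-suc p k)) (sym eq))))))
  (≤-pred (*-cancelˡ-< p (n div p) (suc k) (≤-<-trans (div-* p n 1≤p) (≤-reflexive eq)))))

div-suc-∤ : ∀ p n → 1 ≤ p → ¬ p ∣ suc n → suc n div p ≡ n div p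
div-suc-∤ p n 1≤p p∤ = ≤-antisym
  (*-≤⇒≤-div p 1≤p (≤-pred (≤∧≢⇒< (div-* p (suc n) 1≤p) λ eq → p∤ (divides (suc n div p) (trans (sym eq) (*-comm p (suc n div p)))))))
  (*-≤⇒≤-div p 1≤p (m≤n⇒m≤1+n (div-* p n 1≤p)))

-- The cap is also the recursion depth. This keeps the recursion structural, even at n = 0, from
-- which p could be divided out for ever.
mult : ℕ → ℕ → ℕ → ℕ
mult p zero    n = 0
mult p (suc e) n = if does (p ∣? n) then suc (mult p e (n div p)) else 0

cofactor : ℕ → ℕ → ℕ → ℕ
cofactor p zero    n = n
cofactor p (suc e) n = if does (p ∣? n) then cofactor p e (n div p) else n

mult-* : ∀ p e k → 1 ≤ p → mult p (suc e) (p * k) ≡ suc (mult p e k)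
mult-* p e k 1≤p rewrite dec-true (p ∣? p * k) (m∣m*n k) | *-div p k 1≤p = refl

mult-∤ : ∀ p e n → ¬ p ∣ n → mult p e n ≡ 0
mult-∤ p zero    n p∤n = refl
mult-∤ p (suc e) n p∤n rewrite dec-false (p ∣? n) p∤n = refl

cofactor-* : ∀ p e k → 1 ≤ p → cofactor p (suc e) (p * k) ≡ cofactor p e k
cofactor-* p e k 1≤p rewrite dec-true (p ∣? p * k) (m∣m*n k) | *-div p k 1≤p = refl

cofactor-∤ : ∀ p e n → ¬ p ∣ n → cofactor p e n ≡ n
cofactor-∤ p zero    n p∤n = refl
cofactor-∤ p (suc e) n p∤n rewrite dec-false (p ∣? n) p∤n = refl

mult-cofactor : ∀ p e n → 1 ≤ p → p ^ mult p e n * cofactor p e n ≡ n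
mult-cofactor p zero    n 1≤p = *-identityˡ n
mult-cofactor p (suc e) n 1≤p with p ∣? n
... | no  _            = *-identityˡ n
... | yes (divides q refl) rewrite *-comm q p | *-div p q 1≤p =
  trans (*-assoc p (p ^ mult p e q) _) (cong (p *_) (mult-cofactor p e q 1≤p))

-- By Gauss's lemma q divides p * n only if it divides n; so neither the exponent of q nor, in the
-- next lemma, the process of removing q is affected by the factor p.
mult-coprime : ∀ q p e n → 1 ≤ p → 1 ≤ q → Coprime q p → mult q e (p * n) ≡ mult q e n
mult-coprime q p zero    n 1≤p 1≤q c = refl
mult-coprime q p (suc e) n 1≤p 1≤q c with q ∣? n
... | no  q∤n rewrite dec-false (q ∣? p * n) (λ q∣pn → q∤n (coprime-divisor c q∣pn)) = refl
... | yes (divides k refl) rewrite dec-true (q ∣? p * (k * q)) (∣n⇒∣m*n p (n∣m*n k))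
      | sym (*-assoc p k q) | *-comm (p * k) q | *-comm k q | *-div q (p * k) 1≤q | *-div q k 1≤q
      = cong suc (mult-coprime q p e k 1≤p 1≤q c)

cofactor-coprime : ∀ q p e n → 1 ≤ p → 1 ≤ q → Coprime q p → cofactor q e (p * n) ≡ p * cofactor q e n
cofactor-coprime q p zero    n 1≤p 1≤q c = refl
cofactor-coprime q p (suc e) n 1≤p 1≤q c with q ∣? n
... | no  q∤n rewrite dec-false (q ∣? p * n) (λ q∣pn → q∤n (coprime-divisor c q∣pn)) = refl
... | yes (divides k refl) rewrite dec-true (q ∣? p * (k * q)) (∣n⇒∣m*n p (n∣m*n k))
      | sym (*-assoc p k q) | *-comm (p * k) q | *-comm k q | *-div q (p * k) 1≤q | *-div q k 1≤q
      = cofactor-coprime q p e k 1≤p 1≤q c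

-- Splitting n into its capped smooth part and its cofactor.

-- A list of caps (p , e): the smooth parts considered are the products of p ^ i with i ≤ e.
Caps : Set
Caps = List (ℕ × ℕ)

data Good : Caps → Set where
  []  : Good []
  _∷_ : ∀ {p e ps} → 2 ≤ p × All (λ q → Coprime (proj₁ q) p) ps → Good ps → Good ((p , e) ∷ ps)

smoothPart : Caps → ℕ → ℕ
smoothPart []             n = 1
smoothPart ((p , e) ∷ ps) n = p ^ mult p e n * smoothPart ps n

strip : Caps → ℕ → ℕ
strip []             n = n
strip ((p , e) ∷ ps) n = strip ps (cofactor p e n)

smoothPart-coprime : ∀ {ps} p n → 1 ≤ p → Good ps → All (λ q → Coprime (proj₁ q) p) ps → smoothPart ps (p * n) ≡ smoothPart ps n
smoothPart-coprime p n 1≤p []                []       = refl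
smoothPart-coprime {(q , e) ∷ ps} p n 1≤p ((2≤q , _) ∷ g) (c ∷ cs) =
  cong₂ (λ i x → q ^ i * x) (mult-coprime q p e n 1≤p (<⇒≤ 2≤q) c) (smoothPart-coprime p n 1≤p g cs)

strip-coprime : ∀ {ps} p n → 1 ≤ p → Good ps → All (λ q → Coprime (proj₁ q) p) ps → strip ps (p * n) ≡ p * strip ps n
strip-coprime p n 1≤p []                []       = refl
strip-coprime {(q , e) ∷ ps} p n 1≤p ((2≤q , _) ∷ g) (c ∷ cs) =
  trans (cong (strip ps) (cofactor-coprime q p e n 1≤p (<⇒≤ 2≤q) c)) (strip-coprime p _ 1≤p g cs)

-- `smoothPart` reads all exponents off the original n, whereas `strip` divides out one prime after
-- the other. The two views agree because removing p does not change the exponents of bases coprime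
-- to p.
smoothPart-cofactor : ∀ {ps} p e n → 1 ≤ p → Good ps → All (λ q → Coprime (proj₁ q) p) ps → smoothPart ps (cofactor p e n) ≡ smoothPart ps n
smoothPart-cofactor p zero    n 1≤p g cs = refl
smoothPart-cofactor {ps} p (suc e) n 1≤p g cs with p ∣? n
... | no  _ = refl
... | yes (divides k refl) rewrite *-comm k p | *-div p k 1≤p =
  trans (smoothPart-cofactor p e k 1≤p g cs) (sym (smoothPart-coprime p k 1≤p g cs))

smoothPart*strip : ∀ {ps} n → Good ps → smoothPart ps n * strip ps n ≡ n
smoothPart*strip n [] = *-identityˡ n
smoothPart*strip {(p , e) ∷ ps} n ((2≤p , cs) ∷ g) = begin
  p ^ mult p e n * smoothPart ps n * strip ps c   ≡⟨ *-assoc (p ^ mult p e n) _ _ ⟩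
  p ^ mult p e n * (smoothPart ps n * strip ps c) ≡⟨ cong (λ x → p ^ mult p e n * (x * strip ps c)) (sym (smoothPart-cofactor p e n (<⇒≤ 2≤p) g cs)) ⟩
  p ^ mult p e n * (smoothPart ps c * strip ps c) ≡⟨ cong (p ^ mult p e n *_) (smoothPart*strip c g) ⟩
  p ^ mult p e n * c                              ≡⟨ mult-cofactor p e n (<⇒≤ 2≤p) ⟩
  n                                               ∎
  where
  open ≡-Reasoning
  c = cofactor p e n

-- Supply of each prime, and the number of n with a small cofactor.

off : ℕ → (ℕ → ℕ) → ℕ → ℕ
off p f n = if does (p ∣? n) then 0 else f n

-- The multiples of p up to N are the p * k with k ≤ N div p.
sumTo-split : ∀ N p (f : ℕ → ℕ) → 1 ≤ p → sumTo N f ≡ sumTo N (off p f) + sumTo (N div p) (λ k → f (p * k))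
sumTo-split zero p@(suc _) f 1≤p = refl
sumTo-split (suc N) p f 1≤p with p ∣? suc N
... | no p∤ rewrite div-suc-∤ p N 1≤p p∤ | sumTo-split N p f 1≤p =
  solve 3 (λ a b c → (a :+ b) :+ c := (a :+ c) :+ b) refl (sumTo N (off p f)) (sumTo (N div p) (λ k → f (p * k))) (f (suc N))
  where open +-*-Solver
... | yes (divides k eq) = begin
  sumTo N f + f (suc N)                            ≡⟨ cong₂ _+_ (sumTo-split N p f 1≤p) (cong f eq′) ⟩
  sumTo N (off p f) + rest + f (p * suc (N div p)) ≡⟨ solve 3 (λ a b c → (a :+ b) :+ c := (a :+ con 0) :+ (b :+ c)) refl (sumTo N (off p f)) rest (f (p * suc (N div p))) ⟩
  sumTo N (off p f) + 0 + sumTo (suc (N div p)) (λ k → f (p * k)) ≡⟨ cong (λ M → sumTo N (off p f) + 0 + sumTo M (λ k → f (p * k))) div≡ ⟩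
  sumTo N (off p f) + 0 + sumTo (suc N div p) (λ k → f (p * k))   ∎
  where
  open ≡-Reasoning
  open +-*-Solver using (solve; _:+_; _:=_; con)
  rest = sumTo (N div p) (λ k → f (p * k))
  eq′ : suc N ≡ p * suc (N div p)
  eq′ = trans eq (trans (*-comm k p) (cong (p *_) (div-suc-∣ p N k 1≤p (trans eq (*-comm k p)))))
  div≡ : suc (N div p) ≡ suc N div p
  div≡ = sym (trans (cong (_div p) eq′) (*-div p _ 1≤p))

sumTo-off-cong : ∀ N p {f g : ℕ → ℕ} → (∀ n → ¬ p ∣ n → f n ≡ g n) → sumTo N (off p f) ≡ sumTo N (off p g)
sumTo-off-cong N p {f} {g} h = sumTo-cong N λ n _ _ → pointwise n
  where
  pointwise : ∀ n → off p f n ≡ off p g n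
  pointwise n with p ∣? n
  ... | yes _ = refl
  ... | no  p∤n = h n p∤n

sumTo-off-zero : ∀ N p {f : ℕ → ℕ} → (∀ n → ¬ p ∣ n → f n ≡ 0) → sumTo N (off p f) ≡ 0
sumTo-off-zero N p {f} h = trans (sumTo-cong N λ n _ _ → pointwise n) (sumTo-zero N)
  where
  pointwise : ∀ n → off p f n ≡ 0
  pointwise n with p ∣? n
  ... | yes _ = refl
  ... | no  p∤n = h n p∤n

-- Legendre's formula cut off after e terms: the sum of the floors of N / p, N / p ^ 2, ..., N / p ^
-- e, that is, the exponent of p in the product of the capped smooth parts.
supply : ℕ → ℕ → ℕ → ℕ
supply p zero    N = 0
supply p (suc e) N = N div p + supply p e (N div p)

sumTo-mult : ∀ p e N → 1 ≤ p → sumTo N (mult p e) ≡ supply p e N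
sumTo-mult p zero    N 1≤p = sumTo-zero N
sumTo-mult p (suc e) N 1≤p = begin
  sumTo N (mult p (suc e))                                          ≡⟨ sumTo-split N p (mult p (suc e)) 1≤p ⟩
  sumTo N (off p (mult p (suc e))) + sumTo M (λ k → mult p (suc e) (p * k)) ≡⟨ cong₂ _+_ (sumTo-off-zero N p (mult-∤ p (suc e))) (sumTo-cong M λ k _ _ → mult-* p e k 1≤p) ⟩
  sumTo M (λ k → 1 + mult p e k)                                    ≡⟨ sumTo-+ M (λ _ → 1) (mult p e) ⟩
  sumTo M (λ _ → 1) + sumTo M (mult p e)                            ≡⟨ cong₂ _+_ (sumTo-one M) (sumTo-mult p e M 1≤p) ⟩
  M + supply p e M                                                  ∎
  where
  open ≡-Reasoning
  M = N div p

[_≤_]? : ℕ → ℕ → ℕ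
[ m ≤ n ]? = if m ≤ᵇ n then 1 else 0

≤ᵇ-true : ∀ {m n} → m ≤ n → (m ≤ᵇ n) ≡ true
≤ᵇ-true {m} {n} m≤n = dec-true (m ≤? n) m≤n

≤ᵇ-false : ∀ {m n} → ¬ m ≤ n → (m ≤ᵇ n) ≡ false
≤ᵇ-false {m} {n} m≰n = dec-false (m ≤? n) m≰n

count : Caps → ℕ → ℕ → ℕ
count ps N Y = sumTo N (λ n → [ strip ps n ≤ Y ]?)

count-[] : ∀ N Y → count [] N Y ≡ N ⊓ Y
count-[] zero    Y = refl
count-[] (suc N) Y with suc N ≤? Y
... | yes N<Y rewrite count-[] N Y | ≤ᵇ-true N<Y | m≤n⇒m⊓n≡m N<Y | m≤n⇒m⊓n≡m (<⇒≤ N<Y) = +-comm N 1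
... | no  N≮Y rewrite count-[] N Y | ≤ᵇ-false N≮Y | m≥n⇒m⊓n≡n (≤-pred (≰⇒> N≮Y)) | m≥n⇒m⊓n≡n (<⇒≤ (≰⇒> N≮Y)) = +-identityʳ Y

-- Among non-multiples of p, both `(p , suc e) ∷ ps` and `ps` count the same n. For n = p * k the
-- former strips p and leaves k with cap e, while `strip ps` keeps the factor p, so that its value
-- is at most Y exactly when `strip ps k` is at most Y div p. The identity is written as a sum on
-- both sides to avoid subtraction.
count-peel : ∀ p e ps N Y → Good ((p , suc e) ∷ ps) →
  count ((p , suc e) ∷ ps) N Y + count ps (N div p) (Y div p) ≡ count ps N Y + count ((p , e) ∷ ps) (N div p) Y
count-peel p e ps N Y ((2≤p , cs) ∷ g) = begin
  count ((p , suc e) ∷ ps) N Y + C           ≡⟨ cong (_+ C) (sumTo-split N p _ 1≤p) ⟩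
  sumTo N (off p _) + sumTo M _ + C          ≡⟨ cong₂ (λ x y → x + y + C) (sumTo-off-cong N p λ n p∤n → cong (λ k → [ strip ps k ≤ Y ]?) (cofactor-∤ p (suc e) n p∤n))
                                                    (sumTo-cong M λ k _ _ → cong (λ k → [ strip ps k ≤ Y ]?) (cofactor-* p e k 1≤p)) ⟩
  sumTo N (off p (λ n → [ strip ps n ≤ Y ]?)) + D + C ≡⟨ solve 3 (λ a b c → a :+ b :+ c := a :+ c :+ b) refl (sumTo N (off p (λ n → [ strip ps n ≤ Y ]?))) D C ⟩
  sumTo N (off p (λ n → [ strip ps n ≤ Y ]?)) + C + D ≡⟨ cong (λ x → sumTo N (off p (λ n → [ strip ps n ≤ Y ]?)) + x + D) (sumTo-cong M λ k _ _ → shift k) ⟩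
  sumTo N (off p (λ n → [ strip ps n ≤ Y ]?)) + sumTo M (λ k → [ strip ps (p * k) ≤ Y ]?) + D ≡⟨ cong (_+ D) (sym (sumTo-split N p (λ n → [ strip ps n ≤ Y ]?) 1≤p)) ⟩
  count ps N Y + D                           ∎
  where
  open ≡-Reasoning
  open +-*-Solver using (solve; _:+_; _:=_)
  1≤p = <⇒≤ 2≤p
  M = N div p
  C = count ps M (Y div p)
  D = count ((p , e) ∷ ps) M Y
  shift : ∀ k → [ strip ps k ≤ Y div p ]? ≡ [ strip ps (p * k) ≤ Y ]?
  shift k rewrite strip-coprime p k 1≤p g cs with strip ps k ≤? Y div p
  ... | yes k≤ rewrite ≤ᵇ-true k≤ | ≤ᵇ-true (≤-div⇒*-≤ p 1≤p k≤) = refl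
  ... | no  k≰ rewrite ≤ᵇ-false k≰ | ≤ᵇ-false (λ pk≤ → k≰ (*-≤⇒≤-div p 1≤p pk≤)) = refl

-- Exchanges given by exponent vectors.

at : ℕ → List ℕ → ℕ
at k       []       = 0
at zero    (e ∷ _)  = e
at (suc k) (_ ∷ es) = at k es

-- k is the position in `es` at which the exponents for `ps` begin: the vector stays fixed while the
-- caps are consumed. Missing exponents are 0.
pow : ℕ → Caps → List ℕ → ℕ
pow k []             es = 1
pow k ((p , _) ∷ ps) es = p ^ at k es * pow (suc k) ps es

Dominated : ℕ → Caps → ℕ → (ℕ → List ℕ) → Set
Dominated k []             N α = ⊤
Dominated k ((p , e) ∷ ps) N α = sumTo N (λ n → at k (α n)) ≤ supply p e N × Dominated (suc k) ps N α

^-monoʳ-∣ : ∀ p {i j} → i ≤ j → p ^ i ∣ p ^ j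
^-monoʳ-∣ p {i} {j} i≤j = divides (p ^ (j ∸ i)) (trans (cong (p ^_) (sym (m∸n+n≡m i≤j))) (^-distribˡ-+-* p (j ∸ i) i))

-- For each p the powers collect into one power with the sum of the exponents, so divisibility of
-- the products follows from one inequality of exponent sums per prime.
dominated-∣ : ∀ {ps} k N α → Good ps → Dominated k ps N α → prodTo N (λ n → pow k ps (α n)) ∣ prodTo N (smoothPart ps)
dominated-∣ {[]} k N α [] _ = ∣-refl
dominated-∣ {(p , e) ∷ ps} k N α ((2≤p , _) ∷ g) (d , ds)
  rewrite prodTo-* N (λ n → p ^ at k (α n)) (λ n → pow (suc k) ps (α n))
        | prodTo-* N (λ n → p ^ mult p e n) (smoothPart ps)
        | prodTo-^ N p (λ n → at k (α n)) | prodTo-^ N p (mult p e) | sumTo-mult p e N (<⇒≤ 2≤p)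
  = *-pres-∣ (^-monoʳ-∣ p d) (dominated-∣ (suc k) N α g ds)

SmoothCaps : Caps → Set
SmoothCaps = All (λ c → Smooth7 (proj₁ c))

pow-smooth : ∀ {ps} k es → SmoothCaps ps → Smooth7 (pow k ps es)
pow-smooth k es []       = ≤7⇒Smooth7 ≤-refl (s≤s z≤n)
pow-smooth k es (s ∷ ss) = Smooth7-* (Smooth7-^ (at k es) s) (pow-smooth (suc k) es ss)

smoothPart-smooth : ∀ {ps} n → SmoothCaps ps → Smooth7 (smoothPart ps n)
smoothPart-smooth n []       = ≤7⇒Smooth7 ≤-refl (s≤s z≤n)
smoothPart-smooth {(p , e) ∷ ps} n (s ∷ ss) = Smooth7-* (Smooth7-^ (mult p e n) s) (smoothPart-smooth n ss)

-- Here n gives up its entire capped smooth part, so what remains of it is `strip ps n`, and the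
-- size condition involves only the new number and this cofactor.
dominated-exchange : ∀ {ps N t} (α : ℕ → List ℕ) → Good ps → SmoothCaps ps →
  (∀ n → 1 ≤ n → n ≤ N → t ≤ pow 0 ps (α n) * strip ps n) → Dominated 0 ps N α → Exchange N t
dominated-exchange {ps} {N} {t} α g sc large dom = record
  { a = λ n → pow 0 ps (α n)
  ; b = smoothPart ps
  ; a-smooth = λ n → pow-smooth 0 (α n) sc
  ; b-smooth = λ n → smoothPart-smooth n sc
  ; b∣n = λ n → subst (smoothPart ps n ∣_) (smoothPart*strip n g) (m∣m*n (strip ps n))
  ; large = λ n 1≤n n≤N → ≤-trans (*-monoˡ-≤ (smoothPart ps n) (large n 1≤n n≤N)) (≤-reflexive (rearrange n))
  ; balanced = dominated-∣ 0 N α g dom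
  }
  where
  rearrange : ∀ n → pow 0 ps (α n) * strip ps n * smoothPart ps n ≡ pow 0 ps (α n) * n
  rearrange n = trans (*-assoc (pow 0 ps (α n)) _ _)
    (cong (pow 0 ps (α n) *_) (trans (*-comm (strip ps n) _) (smoothPart*strip n g)))

-- Counts as signed sums of minima, and their fast evaluation.

sumOver : List ℕ → (ℕ → ℕ) → ℕ
sumOver []       f = 0
sumOver (N ∷ Ns) f = f N + sumOver Ns f

sumOver-cong : ∀ Ns {f g : ℕ → ℕ} → (∀ N → f N ≡ g N) → sumOver Ns f ≡ sumOver Ns g
sumOver-cong []       h = refl
sumOver-cong (N ∷ Ns) h = cong₂ _+_ (h N) (sumOver-cong Ns h)

sumOver-+ : ∀ Ns (f g : ℕ → ℕ) → sumOver Ns (λ N → f N + g N) ≡ sumOver Ns f + sumOver Ns g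
sumOver-+ []       f g = refl
sumOver-+ (N ∷ Ns) f g rewrite sumOver-+ Ns f g =
  solve 4 (λ a b c d → (a :+ b) :+ (c :+ d) := (a :+ c) :+ (b :+ d)) refl (f N) (g N) (sumOver Ns f) (sumOver Ns g)
  where open +-*-Solver

sumOver-zero : ∀ Ns → sumOver Ns (λ _ → 0) ≡ 0
sumOver-zero []       = refl
sumOver-zero (N ∷ Ns) = sumOver-zero Ns

sumOver-map : ∀ Ns (h f : ℕ → ℕ) → sumOver (map h Ns) f ≡ sumOver Ns (λ N → f (h N))
sumOver-map []       h f = refl
sumOver-map (N ∷ Ns) h f = cong (f (h N) +_) (sumOver-map Ns h f)

merge : List ℕ → List ℕ → List ℕ
merge []       Ns       = Ns
merge (M ∷ Ms) []       = M ∷ Ms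
merge (M ∷ Ms) (N ∷ Ns) = if M <ᵇ N then M ∷ merge Ms (N ∷ Ns) else N ∷ merge (M ∷ Ms) Ns

sumOver-merge : ∀ Ms Ns f → sumOver (merge Ms Ns) f ≡ sumOver Ms f + sumOver Ns f
sumOver-merge []       Ns       f = refl
sumOver-merge (M ∷ Ms) []       f = sym (+-identityʳ _)
sumOver-merge (M ∷ Ms) (N ∷ Ns) f = either (M <ᵇ N)
  (trans (cong (f M +_) (sumOver-merge Ms (N ∷ Ns) f)) (sym (+-assoc (f M) _ _)))
  (trans (cong (f N +_) (sumOver-merge (M ∷ Ms) Ns f))
    (solve 3 (λ a b c → a :+ (b :+ c) := b :+ (a :+ c)) refl (f N) (f M + sumOver Ms f) (sumOver Ns f)))
  where
  open +-*-Solver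
  either : ∀ b {Ks Ls v} → sumOver Ks f ≡ v → sumOver Ls f ≡ v → sumOver (if b then Ks else Ls) f ≡ v
  either true  p q = p
  either false p q = q

powers : ℕ → ℕ → ℕ → List ℕ
powers p zero    N = N ∷ []
powers p (suc e) N = N ∷ powers p e (N div p)

powers⁺ : ℕ → ℕ → ℕ → List ℕ
powers⁺ p zero    N = []
powers⁺ p (suc e) N = powers p e (N div p)

powers-∷ : ∀ p e N → powers p e N ≡ N ∷ powers⁺ p e N
powers-∷ p zero    N = refl
powers-∷ p (suc e) N = refl

-- Iterating `count-peel` along N, N div p, ... lowers the cap of p to 0. Solved for the count with
-- p, this removes p from the caps, at the price of e + 1 counts with bound Y minus e counts with
-- bound Y div p.
count-powers : ∀ p e ps N Y → Good ((p , e) ∷ ps) →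
  sumOver (powers p e N) (λ M → count ps M Y) ≡
  count ((p , e) ∷ ps) N Y + sumOver (powers⁺ p e N) (λ M → count ps M (Y div p))
count-powers p zero    ps N Y g = refl
count-powers p (suc e) ps N Y (c ∷ g) = begin
  count ps N Y + sumOver (powers p e M) (λ M → count ps M Y) ≡⟨ cong (count ps N Y +_) (count-powers p e ps M Y (c ∷ g)) ⟩
  count ps N Y + (count ((p , e) ∷ ps) M Y + rest)           ≡⟨ sym (+-assoc (count ps N Y) _ _) ⟩
  count ps N Y + count ((p , e) ∷ ps) M Y + rest             ≡⟨ cong (_+ rest) (sym (count-peel p e ps N Y (c ∷ g))) ⟩
  count ((p , suc e) ∷ ps) N Y + count ps M (Y div p) + rest ≡⟨ +-assoc (count ((p , suc e) ∷ ps) N Y) _ _ ⟩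
  count ((p , suc e) ∷ ps) N Y + sumOver (M ∷ powers⁺ p e M) (λ M → count ps M (Y div p)) ≡⟨ cong (λ Ms → count ((p , suc e) ∷ ps) N Y + sumOver Ms (λ M → count ps M (Y div p))) (sym (powers-∷ p e M)) ⟩
  count ((p , suc e) ∷ ps) N Y + sumOver (powers p e M) (λ M → count ps M (Y div p)) ∎
  where
  open ≡-Reasoning
  M = N div p
  rest = sumOver (powers⁺ p e M) (λ M → count ps M (Y div p))

-- The lists `powers p e N` and `powers⁺ p e N` for all N in `Ns` at once. Dividing a whole level by
-- p preserves ascending order, so merging the levels keeps the result ascending for `rank`.
levels levels⁺ : ℕ → ℕ → List ℕ → List ℕ
levels p zero    Ns = Ns
levels p (suc e) Ns = merge (levels p e (map (_div p) Ns)) Ns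
levels⁺ p zero    Ns = []
levels⁺ p (suc e) Ns = levels p e (map (_div p) Ns)

sumOver-levels : ∀ p e Ns f → sumOver (levels p e Ns) f ≡ sumOver Ns (λ N → sumOver (powers p e N) f)
sumOver-levels p zero    Ns f = sumOver-cong Ns λ N → sym (+-identityʳ (f N))
sumOver-levels p (suc e) Ns f = begin
  sumOver (merge (levels p e (map (_div p) Ns)) Ns) f                       ≡⟨ sumOver-merge (levels p e (map (_div p) Ns)) Ns f ⟩
  sumOver (levels p e (map (_div p) Ns)) f + sumOver Ns f                   ≡⟨ cong (_+ sumOver Ns f) (trans (sumOver-levels p e (map (_div p) Ns) f) (sumOver-map Ns (_div p) _)) ⟩
  sumOver Ns (λ N → sumOver (powers p e (N div p)) f) + sumOver Ns f        ≡⟨ +-comm _ (sumOver Ns f) ⟩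
  sumOver Ns f + sumOver Ns (λ N → sumOver (powers p e (N div p)) f)        ≡⟨ sym (sumOver-+ Ns f _) ⟩
  sumOver Ns (λ N → f N + sumOver (powers p e (N div p)) f)                 ∎
  where open ≡-Reasoning

sumOver-levels⁺ : ∀ p e Ns f → sumOver (levels⁺ p e Ns) f ≡ sumOver Ns (λ N → sumOver (powers⁺ p e N) f)
sumOver-levels⁺ p zero    Ns f = sym (sumOver-zero Ns)
sumOver-levels⁺ p (suc e) Ns f = trans (sumOver-levels p e (map (_div p) Ns) f) (sumOver-map Ns (_div p) _)

-- As _⊓_, but with the primitive comparison.
min : ℕ → ℕ → ℕ
min m n = if m ≤ᵇ n then m else n

min≡⊓ : ∀ m n → min m n ≡ m ⊓ n
min≡⊓ m n with m ≤? n
... | yes m≤n rewrite ≤ᵇ-true m≤n = sym (m≤n⇒m⊓n≡m m≤n)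
... | no  m≰n rewrite ≤ᵇ-false m≰n = sym (m≥n⇒m⊓n≡n (<⇒≤ (≰⇒> m≰n)))

-- Every node carries the length and the minimum of the list starting there, so that a sum of minima
-- with Y can stop as soon as all remaining entries are at least Y; merge keeps the lists ascending.
data Ranked : Set where
  []   : Ranked
  node : (size least N : ℕ) → Ranked → Ranked

rank : List ℕ → Ranked
rank-∷ : ℕ → Ranked → Ranked
rank []       = []
rank (N ∷ Ns) = rank-∷ N (rank Ns)
rank-∷ N []                  = node 1 N N []
rank-∷ N r@(node s l _ _) = node (suc s) (min N l) N r

sumMin : Ranked → ℕ → ℕ
sumMin []             Y = 0
sumMin (node s l N r) Y = if Y ≤ᵇ l then s * Y else min N Y + sumMin r Y

-- The stored minimum bounds all entries from below by Y, so each term is Y. This is what allows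
-- `sumMin` to stop early.
rank-all≥ : ∀ Ns Y {s l N r} → rank Ns ≡ node s l N r → Y ≤ l → sumOver Ns (λ M → min M Y) ≡ s * Y
rank-all≥ (N ∷ Ns) Y eq Y≤l with rank Ns in eqs
rank-all≥ (N ∷ [])     Y refl Y≤l | [] = cong (_+ 0) (trans (min≡⊓ N Y) (m≥n⇒m⊓n≡n Y≤l))
rank-all≥ (N ∷ M ∷ Ns) Y refl Y≤l | [] with rank Ns | eqs
... | []           | ()
... | node _ _ _ _ | ()
rank-all≥ (N ∷ Ns) Y refl Y≤l | node s l _ _ = cong₂ _+_
  (trans (min≡⊓ N Y) (m≥n⇒m⊓n≡n (≤-trans Y≤ (m⊓n≤m N l))))
  (rank-all≥ Ns Y eqs (≤-trans Y≤ (m⊓n≤n N l)))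
  where
  Y≤ : Y ≤ N ⊓ l
  Y≤ = ≤-trans Y≤l (≤-reflexive (min≡⊓ N l))

sumMin-rank : ∀ Ns Y → sumMin (rank Ns) Y ≡ sumOver Ns (λ N → min N Y)
sumMin-rank []       Y = refl
sumMin-rank (N ∷ Ns) Y with rank Ns in eqs
... | [] with Y ≤? N
...   | yes Y≤N rewrite ≤ᵇ-true Y≤N = sym (rank-all≥ (N ∷ Ns) Y (cong (rank-∷ N) eqs) Y≤N)
...   | no  Y≰N rewrite ≤ᵇ-false Y≰N = cong (min N Y +_) (trans (cong (λ r → sumMin r Y) (sym eqs)) (sumMin-rank Ns Y))
sumMin-rank (N ∷ Ns) Y | r@(node s l _ _) with Y ≤? min N l
...   | yes Y≤ rewrite ≤ᵇ-true Y≤ = sym (rank-all≥ (N ∷ Ns) Y (cong (rank-∷ N) eqs) Y≤)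
...   | no  Y≰ rewrite ≤ᵇ-false Y≰ = cong (min N Y +_) (trans (cong (λ r → sumMin r Y) (sym eqs)) (sumMin-rank Ns Y))

-- Unfolding count-powers over all caps expresses a count as an alternating sum of minima; the tree
-- keeps the first arguments of these minima, which do not depend on Y, so that they are computed once.
data Tree : Set where
  leaf : Ranked → Tree
  node : ℕ → Tree → Tree → Tree

build : Caps → List ℕ → Tree
build []             Ns = leaf (rank Ns)
build ((p , e) ∷ ps) Ns = node p (build ps (levels p e Ns)) (build ps (levels⁺ p e Ns))

eval : Tree → ℕ → ℕ
eval (leaf r)     Y = sumMin r Y
eval (node p A B) Y = eval A Y ∸ eval B (Y div p)

-- The truncated subtraction in `eval` is exact: by `count-powers` the minuend is the wanted sum
-- plus the subtrahend.
eval-build : ∀ {ps} Ns Y → Good ps → eval (build ps Ns) Y ≡ sumOver Ns (λ N → count ps N Y)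
eval-build Ns Y [] = trans (sumMin-rank Ns Y) (sumOver-cong Ns λ N → trans (min≡⊓ N Y) (sym (count-[] N Y)))
eval-build {(p , e) ∷ ps} Ns Y (c ∷ g) = begin
  eval (build ps (levels p e Ns)) Y ∸ eval (build ps (levels⁺ p e Ns)) (Y div p)
    ≡⟨ cong₂ _∸_ (trans (eval-build _ Y g) (sumOver-levels p e Ns _)) (trans (eval-build _ (Y div p) g) (sumOver-levels⁺ p e Ns _)) ⟩
  sumOver Ns (λ N → sumOver (powers p e N) (λ M → count ps M Y)) ∸ below
    ≡⟨ cong (_∸ below) (trans (sumOver-cong Ns λ N → count-powers p e ps N Y (c ∷ g)) (sumOver-+ Ns _ _)) ⟩
  sumOver Ns (λ N → count ((p , e) ∷ ps) N Y) + below ∸ below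
    ≡⟨ m+n∸n≡m _ below ⟩
  sumOver Ns (λ N → count ((p , e) ∷ ps) N Y) ∎
  where
  open ≡-Reasoning
  below = sumOver Ns (λ N → sumOver (powers⁺ p e N) (λ M → count ps M (Y div p)))

-- Replacements given by cells, and the exponents they spend.

-- A cell (s , es) offers the number with exponents es, which is at least s; a cofactor m takes the
-- first cell with t ≤ s * m.
Cells : Set
Cells = List (ℕ × List ℕ)

pick : ℕ → Cells → ℕ → List ℕ
pick t []              m = []
pick t ((s , es) ∷ cs) m = if t ≤ᵇ s * m then es else pick t cs m

-- For t ≥ 1 and s ≥ 1 this is the greatest m with s * m < t: the cofactors up to it pass the cell
-- with threshold s.
bound : ℕ → ℕ → ℕ
bound t s = (t ∸ 1) div s

≤-bound : ∀ t s m → 1 ≤ t → 1 ≤ s → s * m < t → m ≤ bound t s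
≤-bound (suc t) s m _ 1≤s sm<t = *-≤⇒≤-div s 1≤s (≤-pred sm<t)

bound-< : ∀ t s m → 1 ≤ t → 1 ≤ s → m ≤ bound t s → s * m < t
bound-< (suc t) s m _ 1≤s m≤ = s≤s (≤-div⇒*-≤ s 1≤s m≤)

bound-anti : ∀ t {r s} → 1 ≤ r → r ≤ s → bound t s ≤ bound t r
bound-anti t {r} {s} 1≤r r≤s = *-≤⇒≤-div r 1≤r (≤-trans (*-monoˡ-≤ _ r≤s) (div-* s (t ∸ 1) (≤-trans 1≤r r≤s)))

-- c is the number of n that arrive at a cell and d the number that pass it, so c ∸ d of them spend
-- the exponents `es`.
demand : ℕ → ℕ → List ℕ → Cells → ℕ
demand k c (d ∷ ds) ((_ , es) ∷ cs) = at k es * (c ∸ d) + demand k d ds cs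
demand k c _        _               = 0

-- The index is the previous threshold. As thresholds do not decrease, the cofactors that pass the
-- cells form initial segments, each contained in the one before.
data Sound (ps : Caps) : ℕ → Cells → Set where
  []  : ∀ {r} → Sound ps r []
  _∷_ : ∀ {r s es cs} → r ≤ s × s ≤ pow 0 ps es → Sound ps s cs → Sound ps r ((s , es) ∷ cs)

tally : Caps → ℕ → ℕ → Cells → List ℕ
tally ps N t = map (λ c → count ps N (bound t (proj₁ c)))

-- A threshold s ≥ t satisfies t ≤ s * m for every m ≥ 1, so `pick` never falls through to its
-- default.
data Reaches (t : ℕ) : Cells → Set where
  here  : ∀ {s es cs} → t ≤ s → Reaches t ((s , es) ∷ cs)
  there : ∀ {c cs} → Reaches t cs → Reaches t (c ∷ cs)

Affordable : ℕ → Caps → ℕ → List ℕ → Cells → Set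
Affordable k []             N ds cs = ⊤
Affordable k ((p , e) ∷ ps) N ds cs = demand k N ds cs ≤ supply p e N × Affordable (suc k) ps N ds cs

module _ (ps : Caps) (N t : ℕ) (1≤t : 1 ≤ t) where

  -- At a cell with threshold s, the cofactors m ≤ Y above `bound t s` take `es` and the others go
  -- on. Splitting the indicator of m ≤ Y accordingly reproduces the recursion of `demand`.
  sumTo-pick : ∀ k Y r cs → 1 ≤ r → bound t r ≤ Y → Sound ps r cs →
    sumTo N (λ n → [ strip ps n ≤ Y ]? * at k (pick t cs (strip ps n))) ≡ demand k (count ps N Y) (tally ps N t cs) cs
  sumTo-pick k Y r [] 1≤r r≤Y [] = trans (sumTo-cong N λ n _ _ → *-zeroʳ [ strip ps n ≤ Y ]?) (sumTo-zero N)
  sumTo-pick k Y r ((s , es) ∷ cs) 1≤r r≤Y ((r≤s , _) ∷ sd) = begin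
    sumTo N (λ n → [ strip ps n ≤ Y ]? * at k (pick t ((s , es) ∷ cs) (strip ps n)))
      ≡⟨ sumTo-cong N (λ n _ _ → pointwise (strip ps n)) ⟩
    sumTo N (λ n → at k es * diff (strip ps n) + [ strip ps n ≤ Z ]? * at k (pick t cs (strip ps n)))
      ≡⟨ sumTo-+ N _ _ ⟩
    sumTo N (λ n → at k es * diff (strip ps n)) + sumTo N (λ n → [ strip ps n ≤ Z ]? * at k (pick t cs (strip ps n)))
      ≡⟨ cong₂ _+_ (trans (sumTo-*ˡ N (at k es) _) (cong (at k es *_) sumTo-diff)) (sumTo-pick k Z s cs 1≤s ≤-refl sd) ⟩
    at k es * (count ps N Y ∸ count ps N Z) + demand k (count ps N Z) (tally ps N t cs) cs ∎
    where
    open ≡-Reasoning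
    1≤s = ≤-trans 1≤r r≤s
    Z = bound t s
    Z≤Y : Z ≤ Y
    Z≤Y = ≤-trans (bound-anti t 1≤r r≤s) r≤Y
    diff : ℕ → ℕ
    diff m = [ m ≤ Y ]? ∸ [ m ≤ Z ]?
    pointwise : ∀ m → [ m ≤ Y ]? * at k (pick t ((s , es) ∷ cs) m) ≡ at k es * diff m + [ m ≤ Z ]? * at k (pick t cs m)
    pointwise m with m ≤? Z
    ... | yes m≤Z rewrite ≤ᵇ-true m≤Z | ≤ᵇ-true (≤-trans m≤Z Z≤Y) | ≤ᵇ-false (<⇒≱ (bound-< t s m 1≤t 1≤s m≤Z)) | *-zeroʳ (at k es) = refl
    ... | no  m≰Z rewrite ≤ᵇ-false m≰Z | ≤ᵇ-true (≮⇒≥ λ sm<t → m≰Z (≤-bound t s m 1≤t 1≤s sm<t)) =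
      trans (*-comm [ m ≤ Y ]? (at k es)) (sym (+-identityʳ _))
    sumTo-diff : sumTo N (λ n → diff (strip ps n)) ≡ count ps N Y ∸ count ps N Z
    sumTo-diff = trans (sym (m+n∸n≡m _ (count ps N Z))) (cong (_∸ count ps N Z)
      (trans (sym (sumTo-+ N _ _)) (sumTo-cong N λ n _ _ → m∸n+n≡m (indicator-mono (strip ps n)))))
      where
      indicator-mono : ∀ m → [ m ≤ Z ]? ≤ [ m ≤ Y ]?
      indicator-mono m with m ≤? Z
      ... | yes m≤Z rewrite ≤ᵇ-true m≤Z | ≤ᵇ-true (≤-trans m≤Z Z≤Y) = ≤-refl
      ... | no  m≰Z rewrite ≤ᵇ-false m≰Z = z≤n

  pick-large : ∀ {r cs} m → 1 ≤ m → Sound ps r cs → Reaches t cs → t ≤ pow 0 ps (pick t cs m) * m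
  pick-large {cs = (s , es) ∷ cs} m 1≤m ((_ , s≤) ∷ sd) reach with t ≤? s * m
  ... | yes t≤sm rewrite ≤ᵇ-true t≤sm = ≤-trans t≤sm (*-monoˡ-≤ m s≤)
  ... | no  t≰sm rewrite ≤ᵇ-false t≰sm with reach
  ...   | here t≤s  = contradiction (≤-trans t≤s (m≤m*n s m ⦃ >-nonZero 1≤m ⦄)) t≰sm
  ...   | there rch = pick-large m 1≤m sd rch

  affordable-exchange : ∀ {cs} → t ≤ N → Good ps → SmoothCaps ps → Sound ps 1 cs → Reaches t cs → Affordable 0 ps N (tally ps N t cs) cs → Exchange N t
  affordable-exchange {cs} t≤N g sc sd reach aff =
    dominated-exchange α g sc (λ n 1≤n _ → pick-large (strip ps n) (1≤strip n 1≤n) sd reach) (dominated 0 aff)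
    where
    α : ℕ → List ℕ
    α n = pick t cs (strip ps n)

    1≤strip : ∀ n → 1 ≤ n → 1 ≤ strip ps n
    1≤strip n 1≤n = n≢0⇒n>0 λ eq → <⇒≢ 1≤n (trans (sym (*-zeroʳ (smoothPart ps n)))
      (trans (cong (smoothPart ps n *_) (sym eq)) (smoothPart*strip n g)))

    strip≤N : ∀ n → 1 ≤ n → n ≤ N → strip ps n ≤ N
    strip≤N n 1≤n n≤N = ≤-trans (≤-trans (m≤n*m (strip ps n) (smoothPart ps n) ⦃ Smooth7⇒NonZero (smoothPart-smooth n sc) ⦄)
      (≤-reflexive (smoothPart*strip n g))) n≤N

    count-full : count ps N N ≡ N
    count-full = trans (sumTo-cong N λ n 1≤n n≤N → cong (if_then 1 else 0) (≤ᵇ-true (strip≤N n 1≤n n≤N))) (sumTo-one N)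

    -- With Y = N the indicator in `sumTo-pick` is always 1, because no cofactor exceeds N. The
    -- previous threshold is taken to be 1, and `bound t 1` is at most N because t is.
    sumTo-α : ∀ k → sumTo N (λ n → at k (α n)) ≡ demand k N (tally ps N t cs) cs
    sumTo-α k = begin
      sumTo N (λ n → at k (α n))
        ≡⟨ sumTo-cong N (λ n 1≤n n≤N → sym (trans (cong (λ b → (if b then 1 else 0) * at k (α n)) (≤ᵇ-true (strip≤N n 1≤n n≤N))) (+-identityʳ _))) ⟩
      sumTo N (λ n → [ strip ps n ≤ N ]? * at k (α n))
        ≡⟨ sumTo-pick k N 1 cs ≤-refl (≤-trans (≤-trans (≤-reflexive (sym (*-identityˡ _))) (div-* 1 (t ∸ 1) ≤-refl)) (≤-trans (m∸n≤m t 1) t≤N)) sd ⟩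
      demand k (count ps N N) (tally ps N t cs) cs
        ≡⟨ cong (λ c → demand k c (tally ps N t cs) cs) count-full ⟩
      demand k N (tally ps N t cs) cs ∎
      where open ≡-Reasoning

    dominated : ∀ {qs} k → Affordable k qs N (tally ps N t cs) cs → Dominated k qs N α
    dominated {[]}     k _        = tt
    dominated {_ ∷ qs} k (d , ds) = ≤-trans (≤-reflexive (sumTo-α k)) d , dominated (suc k) ds

evals : Tree → ℕ → Cells → List ℕ
evals T t = map (λ c → eval T (bound t (proj₁ c)))

evals≡tally : ∀ {ps} N t cs → Good ps → evals (build ps (N ∷ [])) t cs ≡ tally ps N t cs
evals≡tally N t cs g = map-cong (λ c → trans (eval-build (N ∷ []) (bound t (proj₁ c)) g) (+-identityʳ _)) cs

∧-elim : ∀ {x y} → x ∧ y ≡ true → x ≡ true × y ≡ true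
∧-elim {true} {true} _ = refl , refl

≤ᵇ-elim : ∀ {m n} → (m ≤ᵇ n) ≡ true → m ≤ n
≤ᵇ-elim {m} {n} eq = ≤ᵇ⇒≤ m n (Equivalence.from T-≡ eq)

-- Rescaling counts from one threshold to another.

-- The least N with t ≤ 2 N / 7.
ceil7/2 : ℕ → ℕ
ceil7/2 t = (7 * t + 1) div 2

t≤ceil7/2 : ∀ t → t ≤ ceil7/2 t
t≤ceil7/2 t = *-≤⇒≤-div 2 (s≤s z≤n) (≤-trans (*-monoˡ-≤ t (s≤s (s≤s (z≤n {5})))) (m≤m+n (7 * t) 1))

-- The number of minima in the expansion of a count: by `count-powers` each prime replaces one count
-- by e + 1 positive and e negative ones.
leaves : Caps → ℕ
leaves []             = 1
leaves ((p , e) ∷ ps) = suc (2 * e) * leaves ps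

-- x and y are quantities attached to the thresholds t and u; they are close if x / t and y / u are.
module Scaling (t u : ℕ) where

  Below : ℕ → ℕ → ℕ → ℕ → ℕ → Set
  Below a b ε x y = a * x ≤ b * y + ε * (t + u)

  -- After division by t * u: x / t and y / u differ by at most ε (1 / t + 1 / u). The unit t + u is
  -- symmetric and is at least the cost of one rounding in either direction.
  Close : ℕ → ℕ → ℕ → Set
  Close ε x y = Below u t ε x y × Below t u ε y x

  private
    below-+ : ∀ {a b ε δ x y z w} → Below a b ε x y → Below a b δ z w → Below a b (ε + δ) (x + z) (y + w)
    below-+ {a} {b} {ε} {δ} {x} {y} {z} {w} p q = begin
      a * (x + z)                                     ≡⟨ *-distribˡ-+ a x z ⟩
      a * x + a * z                                   ≤⟨ +-mono-≤ p q ⟩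
      b * y + ε * K + (b * w + δ * K)                 ≡⟨ solve 6 (λ b y ε K w δ → b :* y :+ ε :* K :+ (b :* w :+ δ :* K) := b :* (y :+ w) :+ (ε :+ δ) :* K) refl b y ε K w δ ⟩
      b * (y + w) + (ε + δ) * K                       ∎
      where open ≤-Reasoning
            open +-*-Solver using (solve; _:+_; _:*_; _:=_)
            K = t + u

    below-* : ∀ {a b ε x y} c → Below a b ε x y → Below a b (c * ε) (c * x) (c * y)
    below-* {a} {b} {ε} {x} {y} c p = begin
      a * (c * x)             ≡⟨ solve 3 (λ a c x → a :* (c :* x) := c :* (a :* x)) refl a c x ⟩
      c * (a * x)             ≤⟨ *-monoʳ-≤ c p ⟩
      c * (b * y + ε * K)     ≡⟨ solve 5 (λ b y ε K c → c :* (b :* y :+ ε :* K) := b :* (c :* y) :+ c :* ε :* K) refl b y ε K c ⟩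
      b * (c * y) + c * ε * K ∎
      where open ≤-Reasoning
            open +-*-Solver using (solve; _:+_; _:*_; _:=_)
            K = t + u

    -- Subtraction needs the opposite estimate for the subtrahends, which is why `Close` is
    -- two-sided.
    below-cancel : ∀ {a b ε δ x y z w} → Below a b ε (x + z) (y + w) → Below b a δ w z → Below a b (ε + δ) x y
    below-cancel {a} {b} {ε} {δ} {x} {y} {z} {w} p q = +-cancelʳ-≤ (a * z) _ _ (begin
      a * x + a * z                         ≡⟨ sym (*-distribˡ-+ a x z) ⟩
      a * (x + z)                           ≤⟨ p ⟩
      b * (y + w) + ε * K                   ≡⟨ solve 5 (λ b y w ε K → b :* (y :+ w) :+ ε :* K := b :* y :+ ε :* K :+ b :* w) refl b y w ε K ⟩
      b * y + ε * K + b * w                 ≤⟨ +-monoʳ-≤ (b * y + ε * K) q ⟩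
      b * y + ε * K + (a * z + δ * K)       ≡⟨ solve 7 (λ b y ε K a z δ → b :* y :+ ε :* K :+ (a :* z :+ δ :* K) := b :* y :+ (ε :+ δ) :* K :+ a :* z) refl b y ε K a z δ ⟩
      b * y + (ε + δ) * K + a * z           ∎)
      where open ≤-Reasoning
            open +-*-Solver using (solve; _:+_; _:*_; _:=_)
            K = t + u

    below-⊓ : ∀ {a b ε x y z w} → Below a b ε x y → Below a b ε z w → Below a b ε (x ⊓ z) (y ⊓ w)
    below-⊓ {a} {b} {ε} {x} {y} {z} {w} p q with ≤-total y w
    ... | inj₁ y≤w rewrite m≤n⇒m⊓n≡m y≤w = ≤-trans (*-monoʳ-≤ a (m⊓n≤m x z)) p
    ... | inj₂ w≤y rewrite m≥n⇒m⊓n≡n w≤y = ≤-trans (*-monoʳ-≤ a (m⊓n≤n x z)) q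

    -- Division by p turns the error 2 into 2 / p, and rounding adds at most (p - 1) / p. The total
    -- is again at most 2, so errors do not pile up under repeated division.
    below-div : ∀ {a b x y} p → b ≤ t + u → 1 ≤ p → Below a b 2 x y → Below a b 2 (x div p) (y div p)
    below-div {a} {b} {x} {y} p@(suc r) b≤K 1≤p h = *-cancelˡ-≤ p (begin
      p * (a * (x div p))               ≡⟨ solve 3 (λ p a x → p :* (a :* x) := a :* (p :* x)) refl p a (x div p) ⟩
      a * (p * (x div p))               ≤⟨ *-monoʳ-≤ a (div-* p x 1≤p) ⟩
      a * x                             ≤⟨ h ⟩
      b * y + 2 * K                     ≤⟨ +-monoˡ-≤ (2 * K) (*-monoʳ-≤ b (≤-pred (≤-trans (<-div-suc p y 1≤p) (≤-reflexive (*-suc p (y div p)))))) ⟩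
      b * (r + p * (y div p)) + 2 * K   ≡⟨ solve 5 (λ b r p q K → b :* (r :+ p :* q) :+ con 2 :* K := p :* (b :* q) :+ (r :* b :+ con 2 :* K)) refl b r p (y div p) K ⟩
      p * (b * (y div p)) + (r * b + 2 * K) ≤⟨ +-monoʳ-≤ (p * (b * (y div p))) (+-monoˡ-≤ (2 * K) (≤-trans (*-monoʳ-≤ r b≤K) (m≤n*m (r * K) 2))) ⟩
      p * (b * (y div p)) + (2 * (r * K) + 2 * K) ≡⟨ solve 4 (λ p c r K → p :* c :+ (con 2 :* (r :* K) :+ con 2 :* K) := p :* c :+ (con 1 :+ r) :* (con 2 :* K)) refl p (b * (y div p)) r K ⟩
      p * (b * (y div p)) + p * (2 * K) ≡⟨ sym (*-distribˡ-+ p (b * (y div p)) (2 * K)) ⟩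
      p * (b * (y div p) + 2 * K)       ∎)
      where open ≤-Reasoning
            open +-*-Solver using (solve; _:+_; _:*_; _:=_; con)
            K = t + u

  close-+ : ∀ {ε δ x y z w} → Close ε x y → Close δ z w → Close (ε + δ) (x + z) (y + w)
  close-+ {ε} {δ} (p , p′) (q , q′) = below-+ {u} {t} {ε} {δ} p q , below-+ {t} {u} {ε} {δ} p′ q′

  close-* : ∀ {ε x y} c → Close ε x y → Close (c * ε) (c * x) (c * y)
  close-* {ε} c (p , p′) = below-* {u} {t} {ε} c p , below-* {t} {u} {ε} c p′

  close-cancel : ∀ {ε δ x y z w} → Close ε (x + z) (y + w) → Close δ z w → Close (ε + δ) x y
  close-cancel {ε} {δ} {x} {y} {z} {w} (p , p′) (q , q′) =
    below-cancel {u} {t} {ε} {δ} {x} {y} {z} {w} p q′ , below-cancel {t} {u} {ε} {δ} {y} {x} {w} {z} p′ q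

  close-⊓ : ∀ {ε x y z w} → Close ε x y → Close ε z w → Close ε (x ⊓ z) (y ⊓ w)
  close-⊓ {ε} (p , p′) (q , q′) = below-⊓ {u} {t} {ε} p q , below-⊓ {t} {u} {ε} p′ q′

  close-div : ∀ {x y} p → 1 ≤ p → Close 2 x y → Close 2 (x div p) (y div p)
  close-div p 1≤p (h , h′) = below-div {u} {t} p (m≤m+n t u) 1≤p h , below-div {t} {u} p (m≤n+m u t) 1≤p h′

  close-weaken : ∀ {ε δ x y} → ε ≤ δ → Close ε x y → Close δ x y
  close-weaken ε≤δ (p , p′) = ≤-trans p (+-monoʳ-≤ _ (*-monoˡ-≤ (t + u) ε≤δ)) , ≤-trans p′ (+-monoʳ-≤ _ (*-monoˡ-≤ (t + u) ε≤δ))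

  -- Each of the `leaves ps` minima has error 2, and errors add whatever the signs. In the induction
  -- every unit of e contributes two further counts for the remaining caps, through `count-peel`.
  close-count : ∀ {ps N M Y Z} → Good ps → Close 2 N M → Close 2 Y Z → Close (leaves ps * 2) (count ps N Y) (count ps M Z)
  close-count {[]} {N} {M} {Y} {Z} [] n y rewrite count-[] N Y | count-[] M Z = close-⊓ {2} n y
  close-count {(p , zero) ∷ ps} (c ∷ g) n y = close-weaken (≤-reflexive (cong (_* 2) (sym (*-identityˡ (leaves ps))))) (close-count g n y)
  close-count {(p , suc e) ∷ ps} {N} {M} {Y} {Z} ((2≤p , cs) ∷ g) n y =
    close-weaken (≤-reflexive (solve 2 (λ e L → L :* con 2 :+ (con 1 :+ con 2 :* e) :* L :* con 2 :+ L :* con 2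
                                       := (con 1 :+ con 2 :* (con 1 :+ e)) :* L :* con 2) refl e (leaves ps)))
      (close-cancel {leaves ps * 2 + suc (2 * e) * leaves ps * 2} {leaves ps * 2}
        (subst₂ (Close (leaves ps * 2 + suc (2 * e) * leaves ps * 2))
          (sym (count-peel p e ps N Y ((2≤p , cs) ∷ g))) (sym (count-peel p e ps M Z ((2≤p , cs) ∷ g)))
          (close-+ {leaves ps * 2} {suc (2 * e) * leaves ps * 2} (close-count g n y)
            (close-count {(p , e) ∷ ps} ((2≤p , cs) ∷ g) (close-div p 1≤p n) y)))
        (close-count g (close-div p 1≤p n) (close-div p 1≤p y)))
    where
    1≤p = <⇒≤ 2≤p
    open +-*-Solver using (solve; _:+_; _:*_; _:=_; con)

  close-supply : ∀ {N M} p e → 1 ≤ p → Close 2 N M → Close (e * 2) (supply p e N) (supply p e M)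
  close-supply p zero    1≤p n = ≤-trans (≤-reflexive (*-zeroʳ u)) z≤n , ≤-trans (≤-reflexive (*-zeroʳ t)) z≤n
  close-supply p (suc e) 1≤p n = close-+ {2} {e * 2} (close-div p 1≤p n) (close-supply p e 1≤p (close-div p 1≤p n))

  close-pred : 1 ≤ t → 1 ≤ u → Close 2 (t ∸ 1) (u ∸ 1)
  close-pred (s≤s {n = t′} _) (s≤s {n = u′} _) = lemma t′ u′ , ≤-trans (lemma u′ t′) (≤-reflexive (cong (λ k → suc u′ * t′ + 2 * k) (+-comm (suc u′) (suc t′))))
    where
    lemma : ∀ a b → suc b * a ≤ suc a * b + 2 * (suc a + suc b)
    lemma a b = ≤-trans (m≤m+n (suc b * a) (3 * b + a + 4)) (≤-reflexive
      (solve 2 (λ a b → (con 1 :+ b) :* a :+ (con 3 :* b :+ a :+ con 4) := (con 1 :+ a) :* b :+ con 2 :* ((con 1 :+ a) :+ (con 1 :+ b))) refl a b))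
      where open +-*-Solver using (solve; _:+_; _:*_; _:=_; con)

  close-bound : ∀ s → 1 ≤ t → 1 ≤ u → 1 ≤ s → Close 2 (bound t s) (bound u s)
  close-bound s 1≤t 1≤u 1≤s = close-div s 1≤s (close-pred 1≤t 1≤u)

  close-ceil7/2 : Close 2 (ceil7/2 t) (ceil7/2 u)
  close-ceil7/2 = close-div 2 (s≤s z≤n)
    ( ≤-trans (m≤m+n _ (3 * t + u)) (≤-reflexive (solve 2 (λ t u → u :* (con 7 :* t :+ con 1) :+ (con 3 :* t :+ u) := t :* (con 7 :* u :+ con 1) :+ con 2 :* (t :+ u)) refl t u))
    , ≤-trans (m≤m+n _ (3 * u + t)) (≤-reflexive (solve 2 (λ t u → t :* (con 7 :* u :+ con 1) :+ (con 3 :* u :+ t) := u :* (con 7 :* t :+ con 1) :+ con 2 :* (t :+ u)) refl t u)))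
    where open +-*-Solver using (solve; _:+_; _:*_; _:=_; con)

-- Continuing a list of cells by doubling, and what this costs.

classes : Caps → ℕ
classes []             = 1
classes ((p , e) ∷ ps) = suc e * classes ps

count-mono : ∀ ps N {Y Z} → Y ≤ Z → count ps N Y ≤ count ps N Z
count-mono ps N {Y} {Z} Y≤Z = sumTo-mono N λ n → indicator (strip ps n)
  where
  indicator : ∀ m → [ m ≤ Y ]? ≤ [ m ≤ Z ]?
  indicator m with m ≤? Y
  ... | yes m≤Y rewrite ≤ᵇ-true m≤Y | ≤ᵇ-true (≤-trans m≤Y Y≤Z) = ≤-refl
  ... | no  m≰Y rewrite ≤ᵇ-false m≰Y = z≤n

-- A number is determined by its capped smooth part, for which there are `classes ps` possibilities,
-- and its cofactor, which is at most Y. The induction obtains this bound by dropping a term of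
-- `count-peel`.
count≤classes : ∀ {ps} N Y → Good ps → count ps N Y ≤ classes ps * Y
count≤classes N Y [] rewrite count-[] N Y = ≤-trans (m⊓n≤n N Y) (≤-reflexive (sym (*-identityˡ Y)))
count≤classes {(p , zero) ∷ ps} N Y (c ∷ g) = ≤-trans (count≤classes N Y g) (≤-reflexive (cong (_* Y) (sym (*-identityˡ (classes ps)))))
count≤classes {(p , suc e) ∷ ps} N Y (c ∷ g) = begin
  count ((p , suc e) ∷ ps) N Y                                           ≤⟨ m≤m+n _ _ ⟩
  count ((p , suc e) ∷ ps) N Y + count ps (N div p) (Y div p)            ≡⟨ count-peel p e ps N Y (c ∷ g) ⟩
  count ps N Y + count ((p , e) ∷ ps) (N div p) Y                        ≤⟨ +-mono-≤ (count≤classes N Y g) (count≤classes {(p , e) ∷ ps} (N div p) Y (c ∷ g)) ⟩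
  classes ps * Y + suc e * classes ps * Y                                ≡⟨ sym (*-distribʳ-+ Y (classes ps) (suc e * classes ps)) ⟩
  classes ((p , suc e) ∷ ps) * Y                                         ∎
  where open ≤-Reasoning

-- Doubles the offered number when the first base of the caps is 2.
bump : List ℕ → List ℕ
bump []       = 1 ∷ []
bump (e ∷ es) = suc e ∷ es

at-bump : ∀ k es → at k (bump es) ≤ suc (at k es)
at-bump zero    []       = ≤-refl
at-bump (suc k) []       = z≤n
at-bump zero    (e ∷ es) = ≤-refl
at-bump (suc k) (e ∷ es) = n≤1+n _

pow-bump : ∀ {e ps} es → pow 0 ((2 , e) ∷ ps) (bump es) ≡ 2 * pow 0 ((2 , e) ∷ ps) es
pow-bump {e} {ps} es = trans (cong₂ (λ i x → 2 ^ i * x) (head es) (tail 0 ps)) (*-assoc 2 (2 ^ at 0 es) _)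
  where
  head : ∀ es → at 0 (bump es) ≡ suc (at 0 es)
  head []       = refl
  head (e ∷ es) = refl
  at-tail : ∀ k es → at (suc k) (bump es) ≡ at (suc k) es
  at-tail k []       = refl
  at-tail k (e ∷ es) = refl
  tail : ∀ k ps → pow (suc k) ps (bump es) ≡ pow (suc k) ps es
  tail k []       = refl
  tail k (p ∷ ps) = cong₂ (λ i x → proj₁ p ^ i * x) (at-tail k es) (tail (suc k) ps)

pow-[] : ∀ k ps → pow k ps [] ≡ 1
pow-[] k []       = refl
pow-[] k (p ∷ ps) = trans (*-identityˡ _) (pow-[] (suc k) ps)

doubles : ℕ → ℕ → List ℕ → Cells
doubles zero    s es = []
doubles (suc i) s es = (2 * s , bump es) ∷ doubles i (2 * s) (bump es)

-- Past its last threshold a fixed list of cells goes on by doubling, so that it can serve every t.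
extend : ℕ → ℕ → List ℕ → Cells → Cells
extend i r es []               = doubles i r es
extend i r es ((s , es′) ∷ cs) = (s , es′) ∷ extend i s es′ cs

sound-doubles : ∀ {e ps} i s es → s ≤ pow 0 ((2 , e) ∷ ps) es → Sound ((2 , e) ∷ ps) s (doubles i s es)
sound-doubles zero    s es s≤ = []
sound-doubles {e} {ps} (suc i) s es s≤ = (m≤n*m s 2 , 2s≤) ∷ sound-doubles i (2 * s) (bump es) 2s≤
  where
  2s≤ : 2 * s ≤ pow 0 ((2 , e) ∷ ps) (bump es)
  2s≤ = ≤-trans (*-monoʳ-≤ 2 s≤) (≤-reflexive (sym (pow-bump {e} {ps} es)))

sound-extend : ∀ {e ps} i r es cs → r ≤ pow 0 ((2 , e) ∷ ps) es → Sound ((2 , e) ∷ ps) r cs → Sound ((2 , e) ∷ ps) r (extend i r es cs)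
sound-extend i r es []               r≤ []              = sound-doubles i r es r≤
sound-extend i r es ((s , es′) ∷ cs) r≤ ((r≤s , s≤) ∷ sd) = (r≤s , s≤) ∷ sound-extend i s es′ cs s≤ sd

reaches-doubles : ∀ {t} i s es → 1 ≤ i → t ≤ 2 ^ i * s → Reaches t (doubles i s es)
reaches-doubles (suc zero)    s es 1≤i t≤ = here t≤
reaches-doubles (suc (suc i)) s es 1≤i t≤ = there (reaches-doubles (suc i) (2 * s) (bump es) (s≤s z≤n)
  (≤-trans t≤ (≤-reflexive (trans (cong (_* s) (*-comm 2 (2 ^ suc i))) (*-assoc (2 ^ suc i) 2 s)))))

n≤2^n : ∀ n → n ≤ 2 ^ n
n≤2^n zero    = z≤n
n≤2^n (suc n) = ≤-trans (+-mono-≤ (≤-trans (s≤s z≤n) (m^n>0 2 n)) (n≤2^n n)) (≤-reflexive (cong (2 ^ n +_) (sym (+-identityʳ (2 ^ n)))))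

-- As t ≤ 2 ^ t, a number t of doublings is certainly enough. Such generosity is harmless, since
-- `demand-doubles` bounds the cost independently of the number of doublings.
reaches-extend : ∀ {ps t} r es cs → 1 ≤ t → 1 ≤ r → Sound ps r cs → Reaches t (extend t r es cs)
reaches-extend {t = t} r es []              1≤t 1≤r []             =
  reaches-doubles t r es 1≤t (≤-trans (n≤2^n t) (m≤m*n (2 ^ t) r ⦃ >-nonZero 1≤r ⦄))
reaches-extend r es ((s , es′) ∷ cs) 1≤t 1≤r ((r≤s , _) ∷ sd) = there (reaches-extend s es′ cs 1≤t (≤-trans 1≤r r≤s) sd)

-- Abel summation turns the demand into a signed sum of counts; up and down are its positive and
-- negative parts, rise and fall the sums of the respective coefficients.
up down : ℕ → ℕ → ℕ → List ℕ → Cells → ℕ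
up   k e c (d ∷ ds) ((_ , es) ∷ cs) = (at k es ∸ e) * c + up k (at k es) d ds cs
up   k e c _        _               = 0
down k e c (d ∷ ds) ((_ , es) ∷ cs) = (e ∸ at k es) * c + down k (at k es) d ds cs
down k e c _        _               = 0

rise fall : ℕ → ℕ → Cells → ℕ
rise k e []              = 0
rise k e ((_ , es) ∷ cs) = (at k es ∸ e) + rise k (at k es) cs
fall k e []              = 0
fall k e ((_ , es) ∷ cs) = (e ∸ at k es) + fall k (at k es) cs

lastThreshold : ℕ → Cells → ℕ
lastThreshold r []             = r
lastThreshold r ((s , _) ∷ cs) = lastThreshold s cs

-- Both sides are the maximum of m and n. A change of exponent can thus be split into a rising and a
-- falling part within ℕ.
m+[n∸m]≡n+[m∸n] : ∀ m n → m + (n ∸ m) ≡ n + (m ∸ n)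
m+[n∸m]≡n+[m∸n] m n with ≤-total m n
... | inj₁ m≤n = trans (m+[n∸m]≡n m≤n) (sym (trans (cong (n +_) (m≤n⇒m∸n≡0 m≤n)) (+-identityʳ n)))
... | inj₂ n≤m = trans (trans (cong (m +_) (m≤n⇒m∸n≡0 n≤m)) (+-identityʳ m)) (sym (m+[n∸m]≡n n≤m))

module _ {ps : Caps} (g : Good ps) (N t : ℕ) (1≤t : 1 ≤ t) where

  private
    C : ℕ → ℕ
    C s = count ps N (bound t s)

    2*bound-double : ∀ s → 1 ≤ s → 2 * bound t (2 * s) ≤ bound t s
    2*bound-double s 1≤s = *-≤⇒≤-div s 1≤s (≤-trans (≤-reflexive eq) (div-* (2 * s) (t ∸ 1) (≤-trans 1≤s (m≤n*m s 2))))
      where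
      open +-*-Solver using (solve; _:*_; _:=_; con)
      eq : s * (2 * bound t (2 * s)) ≡ 2 * s * bound t (2 * s)
      eq = solve 2 (λ s b → s :* (con 2 :* b) := con 2 :* s :* b) refl s (bound t (2 * s))

  -- Each doubling raises an exponent by at most 1, which costs at most one further count. These
  -- counts are at most `classes ps` times bounds that halve at every step, so the geometric series
  -- gives twice the first.
  demand-doubles : ∀ k i s es → 1 ≤ s →
    demand k (C s) (tally ps N t (doubles i s es)) (doubles i s es) ≤ at k es * C s + 2 * (classes ps * bound t s)
  demand-doubles k zero    s es 1≤s = z≤n
  demand-doubles k (suc i) s es 1≤s = begin
    e′ * (C s ∸ C (2 * s)) + demand k (C (2 * s)) (tally ps N t (doubles i (2 * s) (bump es))) (doubles i (2 * s) (bump es)) ≤⟨ +-monoʳ-≤ (e′ * (C s ∸ C (2 * s))) (demand-doubles k i (2 * s) (bump es) (≤-trans 1≤s (m≤n*m s 2))) ⟩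
    e′ * (C s ∸ C (2 * s)) + (e′ * C (2 * s) + 2 * (K * B′))                      ≡⟨ sym (+-assoc (e′ * (C s ∸ C (2 * s))) _ _) ⟩
    e′ * (C s ∸ C (2 * s)) + e′ * C (2 * s) + 2 * (K * B′)                        ≡⟨ cong (_+ 2 * (K * B′)) (sym (*-distribˡ-+ e′ (C s ∸ C (2 * s)) _)) ⟩
    e′ * (C s ∸ C (2 * s) + C (2 * s)) + 2 * (K * B′)                             ≡⟨ cong (λ x → e′ * x + 2 * (K * B′)) (m∸n+n≡m (count-mono ps N (bound-anti t 1≤s (m≤n*m s 2)))) ⟩
    e′ * C s + 2 * (K * B′)                                                       ≤⟨ +-mono-≤ (*-monoˡ-≤ (C s) (at-bump k es)) (≤-reflexive (solve 2 (λ k b → con 2 :* (k :* b) := k :* (con 2 :* b)) refl K B′)) ⟩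
    suc (at k es) * C s + K * (2 * B′)                                            ≤⟨ +-mono-≤ (+-monoˡ-≤ (at k es * C s) (count≤classes N (bound t s) g)) (*-monoʳ-≤ K (2*bound-double s 1≤s)) ⟩
    K * bound t s + at k es * C s + K * bound t s                                 ≡⟨ solve 2 (λ x y → x :+ y :+ x := y :+ con 2 :* x) refl (K * bound t s) (at k es * C s) ⟩
    at k es * C s + 2 * (K * bound t s)                                           ∎
    where
    open ≤-Reasoning
    open +-*-Solver using (solve; _:+_; _:*_; _:=_; con)
    e′ = at k (bump es)
    K = classes ps
    B′ = bound t (2 * s)

  -- Abel summation: the demand is the sum of exponent jump times count. The falling jumps stand on
  -- the left to stay within ℕ, and the last summand is the geometric tail of the doublings.
  demand-extend : ∀ k i r es cs → 1 ≤ r → Sound ps r cs →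
    demand k (C r) (tally ps N t (extend i r es cs)) (extend i r es cs) + down k (at k es) (C r) (tally ps N t cs) cs ≤
    at k es * C r + (up k (at k es) (C r) (tally ps N t cs) cs + 2 * (classes ps * bound t (lastThreshold r cs)))
  demand-extend k i r es [] 1≤r [] = ≤-trans (≤-reflexive (+-identityʳ _)) (demand-doubles k i r es 1≤r)
  demand-extend k i r es ((s , es′) ∷ cs) 1≤r ((r≤s , _) ∷ sd) = begin
    e′ * (C r ∸ C s) + D + ((e ∸ e′) * C r + down′)           ≡⟨ solve 4 (λ a b c d → a :+ b :+ (c :+ d) := a :+ c :+ (b :+ d)) refl (e′ * (C r ∸ C s)) D ((e ∸ e′) * C r) down′ ⟩
    e′ * (C r ∸ C s) + (e ∸ e′) * C r + (D + down′)           ≤⟨ +-monoʳ-≤ (e′ * (C r ∸ C s) + (e ∸ e′) * C r) (demand-extend k i s es′ cs (≤-trans 1≤r r≤s) sd) ⟩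
    e′ * (C r ∸ C s) + (e ∸ e′) * C r + (e′ * C s + (up′ + tl)) ≡⟨ solve 5 (λ a b c d f → a :+ b :+ (c :+ (d :+ f)) := (a :+ c) :+ b :+ (d :+ f)) refl (e′ * (C r ∸ C s)) ((e ∸ e′) * C r) (e′ * C s) up′ tl ⟩
    e′ * (C r ∸ C s) + e′ * C s + (e ∸ e′) * C r + (up′ + tl) ≡⟨ cong (λ x → x + (e ∸ e′) * C r + (up′ + tl)) (trans (sym (*-distribˡ-+ e′ _ _)) (cong (e′ *_) (m∸n+n≡m (count-mono ps N (bound-anti t 1≤r r≤s))))) ⟩
    e′ * C r + (e ∸ e′) * C r + (up′ + tl)                    ≡⟨ cong (_+ (up′ + tl)) (trans (sym (*-distribʳ-+ (C r) e′ (e ∸ e′))) (trans (cong (_* C r) (m+[n∸m]≡n+[m∸n] e′ e)) (*-distribʳ-+ (C r) e (e′ ∸ e)))) ⟩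
    e * C r + (e′ ∸ e) * C r + (up′ + tl)                     ≡⟨ solve 4 (λ a b c d → a :+ b :+ (c :+ d) := a :+ (b :+ c :+ d)) refl (e * C r) ((e′ ∸ e) * C r) up′ tl ⟩
    e * C r + ((e′ ∸ e) * C r + up′ + tl)                     ∎
    where
    open ≤-Reasoning
    open +-*-Solver using (solve; _:+_; _:=_)
    e = at k es
    e′ = at k es′
    D = demand k (C s) (tally ps N t (extend i s es′ cs)) (extend i s es′ cs)
    down′ = down k e′ (C s) (tally ps N t cs) cs
    up′ = up k e′ (C s) (tally ps N t cs) cs
    tl = 2 * (classes ps * bound t (lastThreshold s cs))

-- One certificate for all large thresholds.

module Limit {e₂ : ℕ} {qs : Caps} (g : Good ((2 , e₂) ∷ qs)) (sc : SmoothCaps ((2 , e₂) ∷ qs))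
             (cs : Cells) (sd : Sound ((2 , e₂) ∷ qs) 1 cs) (u : ℕ) (1≤u : 1 ≤ u) where

  private
    ps : Caps
    ps = (2 , e₂) ∷ qs

    C : ℕ → ℕ → ℕ
    C t s = count ps (ceil7/2 t) (bound t s)

    ts : ℕ → Cells → List ℕ
    ts t = tally ps (ceil7/2 t) t

    load relief : ℕ → ℕ → ℕ
    load   k t = up k 0 (C t 1) (ts t cs) cs + 2 * (classes ps * bound t (lastThreshold 1 cs))
    relief k t = down k 0 (C t 1) (ts t cs) cs

  -- The errors of `close-load` and `close-relief` together: every count costs `leaves ps * 2` per
  -- unit of its coefficient. The total does not depend on t, whereas the unspent exponent grows in
  -- proportion to t.
  error : ℕ → ℕ → ℕ
  error k e = rise k 0 cs * (leaves ps * 2) + 2 * (classes ps * 2) + (fall k 0 cs * (leaves ps * 2) + e * 2)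

  -- u is the reference threshold; the margin left there absorbs the errors of scaling it to any t ≥ t₀.
  Margin : ℕ → ℕ → Caps → Set
  Margin t₀ k []             = ⊤
  Margin t₀ k ((p , e) ∷ rs) = error k e * u ≤ t₀ * ((relief k u + supply p e (ceil7/2 u)) ∸ (load k u + error k e)) × Margin t₀ (suc k) rs

  margin? : ℕ → ℕ → List ℕ → ℕ → Caps → Bool
  margin? t₀ c ds k []             = true
  margin? t₀ c ds k ((p , e) ∷ rs) =
    (error k e * u ≤ᵇ t₀ * ((down k 0 c ds cs + supply p e (ceil7/2 u)) ∸ (up k 0 c ds cs + 2 * (classes ps * bound u (lastThreshold 1 cs)) + error k e)))
    ∧ margin? t₀ c ds (suc k) rs

  margin : ∀ t₀ k rs → margin? t₀ (C u 1) (ts u cs) k rs ≡ true → Margin t₀ k rs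
  margin t₀ k []             _  = tt
  margin t₀ k ((p , e) ∷ rs) eq with ∧-elim {error k e * u ≤ᵇ _} eq
  ... | h , eq′ = ≤ᵇ-elim h , margin t₀ (suc k) rs eq′

  reference : Tree
  reference = build ps (ceil7/2 u ∷ [])

  module _ (t : ℕ) (1≤t : 1 ≤ t) where
    open Scaling t u

    close-C : ∀ s → 1 ≤ s → Close (leaves ps * 2) (C t s) (C u s)
    close-C s 1≤s = close-count g close-ceil7/2 (close-bound s 1≤t 1≤u 1≤s)

    close-up : ∀ k e r xs → 1 ≤ r → Sound ps r xs → Close (rise k e xs * (leaves ps * 2)) (up k e (C t r) (ts t xs) xs) (up k e (C u r) (ts u xs) xs)
    close-up k e r [] 1≤r _ = ≤-trans (≤-reflexive (*-zeroʳ u)) z≤n , ≤-trans (≤-reflexive (*-zeroʳ t)) z≤n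
    close-up k e r ((s , es) ∷ xs) 1≤r ((r≤s , _) ∷ sd′) =
      close-weaken (≤-reflexive (sym (*-distribʳ-+ (leaves ps * 2) (at k es ∸ e) (rise k (at k es) xs))))
        (close-+ {(at k es ∸ e) * (leaves ps * 2)} (close-* {leaves ps * 2} (at k es ∸ e) (close-C r 1≤r)) (close-up k (at k es) s xs (≤-trans 1≤r r≤s) sd′))

    close-down : ∀ k e r xs → 1 ≤ r → Sound ps r xs → Close (fall k e xs * (leaves ps * 2)) (down k e (C t r) (ts t xs) xs) (down k e (C u r) (ts u xs) xs)
    close-down k e r [] 1≤r _ = ≤-trans (≤-reflexive (*-zeroʳ u)) z≤n , ≤-trans (≤-reflexive (*-zeroʳ t)) z≤n
    close-down k e r ((s , es) ∷ xs) 1≤r ((r≤s , _) ∷ sd′) =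
      close-weaken (≤-reflexive (sym (*-distribʳ-+ (leaves ps * 2) (e ∸ at k es) (fall k (at k es) xs))))
        (close-+ {(e ∸ at k es) * (leaves ps * 2)} (close-* {leaves ps * 2} (e ∸ at k es) (close-C r 1≤r)) (close-down k (at k es) s xs (≤-trans 1≤r r≤s) sd′))

    close-load : ∀ k → Close (rise k 0 cs * (leaves ps * 2) + 2 * (classes ps * 2)) (load k t) (load k u)
    close-load k = close-+ {rise k 0 cs * (leaves ps * 2)} (close-up k 0 1 cs ≤-refl sd)
      (close-* {classes ps * 2} 2 (close-* {2} (classes ps) (close-bound (lastThreshold 1 cs) 1≤t 1≤u (1≤lastThreshold ≤-refl sd))))
      where
      1≤lastThreshold : ∀ {r xs} → 1 ≤ r → Sound ps r xs → 1 ≤ lastThreshold r xs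
      1≤lastThreshold 1≤r []               = 1≤r
      1≤lastThreshold 1≤r ((r≤s , _) ∷ sd′) = 1≤lastThreshold (≤-trans 1≤r r≤s) sd′

    close-relief : ∀ k p e → 1 ≤ p → Close (fall k 0 cs * (leaves ps * 2) + e * 2)
      (relief k t + supply p e (ceil7/2 t)) (relief k u + supply p e (ceil7/2 u))
    close-relief k p e 1≤p = close-+ {fall k 0 cs * (leaves ps * 2)} (close-down k 0 1 cs ≤-refl sd) (close-supply p e 1≤p close-ceil7/2)

    -- Let A be the load and B the relief plus supply at u. Rescaling both to t costs ε (t + u) in
    -- all, so t A + ε (t + u) ≤ t B is enough. This says ε u ≤ t (B - A - ε), which only becomes
    -- easier as t grows.
    load≤relief+supply : ∀ {t₀} k p e → 1 ≤ p → t₀ ≤ t →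
      error k e * u ≤ t₀ * ((relief k u + supply p e (ceil7/2 u)) ∸ (load k u + error k e)) →
      load k t ≤ relief k t + supply p e (ceil7/2 t)
    load≤relief+supply {t₀} k p e 1≤p t₀≤t margin = *-cancelˡ-≤ u ⦃ >-nonZero 1≤u ⦄ (+-cancelʳ-≤ (ε₂ * (t + u)) _ _ (begin
      u * load k t + ε₂ * (t + u)                         ≤⟨ +-monoˡ-≤ (ε₂ * (t + u)) (proj₁ (close-load k)) ⟩
      t * A + ε₁ * (t + u) + ε₂ * (t + u)                 ≡⟨ solve 5 (λ t u A ε₁ ε₂ → t :* A :+ ε₁ :* (t :+ u) :+ ε₂ :* (t :+ u) := t :* (A :+ (ε₁ :+ ε₂)) :+ (ε₁ :+ ε₂) :* u) refl t u A ε₁ ε₂ ⟩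
      t * (A + ε) + ε * u                                 ≤⟨ +-monoʳ-≤ (t * (A + ε)) (≤-trans margin (*-monoˡ-≤ (B ∸ (A + ε)) t₀≤t)) ⟩
      t * (A + ε) + t * (B ∸ (A + ε))                     ≡⟨ sym (*-distribˡ-+ t (A + ε) _) ⟩
      t * (A + ε + (B ∸ (A + ε)))                         ≡⟨ cong (t *_) (m+[n∸m]≡n A+ε≤B) ⟩
      t * B                                               ≤⟨ proj₂ (close-relief k p e 1≤p) ⟩
      u * (relief k t + supply p e (ceil7/2 t)) + ε₂ * (t + u) ∎))
      where
      open ≤-Reasoning
      open +-*-Solver using (solve; _:+_; _:*_; _:=_)
      A = load k u
      B = relief k u + supply p e (ceil7/2 u)
      ε₁ = rise k 0 cs * (leaves ps * 2) + 2 * (classes ps * 2)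
      ε₂ = fall k 0 cs * (leaves ps * 2) + e * 2
      ε = error k e
      1≤classes : ∀ qs → 1 ≤ classes qs
      1≤classes []             = ≤-refl
      1≤classes ((p , e) ∷ qs) = ≤-trans (1≤classes qs) (m≤m+n (classes qs) (e * classes qs))
      1≤ε : 1 ≤ ε
      1≤ε = ≤-trans (≤-trans (≤-trans (1≤classes ps) (m≤m*n (classes ps) 2)) (m≤n*m (classes ps * 2) 2))
        (≤-trans (m≤n+m _ (rise k 0 cs * (leaves ps * 2))) (m≤m+n ε₁ ε₂))
      -- Otherwise the truncated difference in the margin is 0 and the margin says ε u ≤ 0, although
      -- ε and u are positive.
      A+ε≤B : A + ε ≤ B
      A+ε≤B = ≮⇒≥ λ B<A+ε → <⇒≱ (*-mono-≤ 1≤ε 1≤u)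
        (≤-trans margin (≤-reflexive (trans (cong (t₀ *_) (m≤n⇒m∸n≡0 (<⇒≤ B<A+ε))) (*-zeroʳ t₀))))

  limit-exchange : ∀ t₀ → Margin t₀ 0 ps → ∀ t → 1 ≤ t → t₀ ≤ t → Exchange (ceil7/2 t) t
  limit-exchange t₀ margin t 1≤t t₀≤t =
    -- The cell (1 , []) in front gives the number 1 to all cofactors m ≥ t. It spends nothing, so
    -- the demand effectively starts from the count `C t 1`.
    affordable-exchange ps (ceil7/2 t) t 1≤t (t≤ceil7/2 t) g sc ((≤-refl , ≤-reflexive (sym (pow-[] 0 ps))) ∷ sound-extend t 1 [] cs 1≤pow sd)
      (there (reaches-extend 1 [] cs 1≤t ≤-refl sd)) (affordable 0 ps g margin)
    where
    1≤pow : 1 ≤ pow 0 ps []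
    1≤pow = ≤-reflexive (sym (pow-[] 0 ps))

    affordable : ∀ k rs → Good rs → Margin t₀ k rs →
      Affordable k rs (ceil7/2 t) (ts t ((1 , []) ∷ extend t 1 [] cs)) ((1 , []) ∷ extend t 1 [] cs)
    affordable k []             _ _ = tt
    affordable k ((p , e) ∷ rs) ((2≤p , _) ∷ g′) (m , ms) =
      +-cancelʳ-≤ (relief k t) _ _ (≤-trans (demand-extend g (ceil7/2 t) t 1≤t k t 1 [] cs ≤-refl sd)
        (≤-trans (load≤relief+supply t 1≤t k p e (<⇒≤ 2≤p) t₀≤t m) (≤-reflexive (+-comm (relief k t) _))))
      , affordable (suc k) rs g′ ms

  -- The counts at u in the margin are replaced by values of a tree, which can be computed although
  -- u is astronomically large.
  scaled-exchange : ∀ t₀ → margin? t₀ (eval reference (bound u 1)) (evals reference u cs) 0 ps ≡ true →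
    ∀ t → 1 ≤ t → t₀ ≤ t → Exchange (ceil7/2 t) t
  scaled-exchange t₀ eq = limit-exchange t₀ (margin t₀ 0 ps (subst₂ (λ c ds → margin? t₀ c ds 0 ps ≡ true)
    (trans (eval-build (ceil7/2 u ∷ []) (bound u 1) g) (+-identityʳ _)) (evals≡tally (ceil7/2 u) u cs g) eq))

-- Decoding and testing certificates.

-- Thresholds with the exponents of at least one number on offer.  A seed selects one offer per
-- threshold, its digits in the mixed radix given by the numbers of offers.
Menu : Set
Menu = List (ℕ × List ℕ × List (List ℕ))

menu : Caps → List (ℕ × List ℕ) → Menu
menu ps []                   = []
menu ps ((s , []) ∷ xs)      = menu ps xs
menu ps ((s , l ∷ ls) ∷ xs)  = (s , exponents l , map exponents ls) ∷ menu ps xs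
  where
  exponents : ℕ → List ℕ
  -- The cap 60 cuts nothing off, as all numbers on offer are below 2 ^ 60.
  exponents n = map (λ c → mult (proj₁ c) 60 n) ps

choose : List ℕ → List (List ℕ) → ℕ → List ℕ
choose o []        d       = o
choose o (o′ ∷ os) zero    = o
choose o (o′ ∷ os) (suc d) = choose o′ os d

-- The list ends at the first threshold that is at least t, because no cofactor passes that cell.
decode : ℕ → Menu → ℕ → Cells
decode t []                 seed = []
decode t ((s , o , os) ∷ m) seed =
  (s , choose o os (seed % suc (length os))) ∷ (if t ≤ᵇ s then [] else decode t m (seed / suc (length os)))

sound? : Caps → ℕ → Cells → Bool
sound? ps r []              = true
sound? ps r ((s , es) ∷ cs) = ((r ≤ᵇ s) ∧ (s ≤ᵇ pow 0 ps es)) ∧ sound? ps s cs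

sound : ∀ ps r cs → sound? ps r cs ≡ true → Sound ps r cs
sound ps r []              _  = []
sound ps r ((s , es) ∷ cs) eq with ∧-elim eq
... | h , eq′ with ∧-elim {r ≤ᵇ s} h
...   | r≤s , s≤ = (≤ᵇ-elim r≤s , ≤ᵇ-elim {s} s≤) ∷ sound ps s cs eq′

reaches? : ℕ → Cells → Bool
reaches? t []             = false
reaches? t ((s , _) ∷ cs) = if t ≤ᵇ s then true else reaches? t cs

reaches : ∀ t cs → reaches? t cs ≡ true → Reaches t cs
reaches t ((s , _) ∷ cs) eq with t ≤ᵇ s in t≤s
... | true  = here (≤ᵇ-elim t≤s)
... | false = there (reaches t cs eq)

affordable? : ℕ → Caps → ℕ → List ℕ → Cells → Bool
affordable? k []             N ds cs = true
affordable? k ((p , e) ∷ ps) N ds cs = (demand k N ds cs ≤ᵇ supply p e N) ∧ affordable? (suc k) ps N ds cs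

affordable : ∀ k ps N ds cs → affordable? k ps N ds cs ≡ true → Affordable k ps N ds cs
affordable k []             N ds cs _  = tt
affordable k ((p , e) ∷ ps) N ds cs eq with ∧-elim {demand k N ds cs ≤ᵇ supply p e N} eq
... | h , eq′ = ≤ᵇ-elim h , affordable (suc k) ps N ds cs eq′

certified? : Caps → ℕ → ℕ → Cells → Bool
certified? ps N t cs = ((1 ≤ᵇ t) ∧ (t ≤ᵇ N)) ∧ (sound? ps 1 cs ∧ (reaches? t cs ∧ affordable? 0 ps N (evals (build ps (N ∷ [])) t cs) cs))

certified-exchange : ∀ {ps} N t cs → Good ps → SmoothCaps ps → certified? ps N t cs ≡ true → t ≤ N × Exchange N t
certified-exchange {ps} N t cs g sc eq with ∧-elim {(1 ≤ᵇ t) ∧ (t ≤ᵇ N)} eq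
... | range , eq₁ with ∧-elim {1 ≤ᵇ t} range | ∧-elim {sound? ps 1 cs} eq₁
...   | 1≤t , t≤N | sd , eq₂ with ∧-elim {reaches? t cs} eq₂
...     | rch , aff = ≤ᵇ-elim t≤N , affordable-exchange ps N t (≤ᵇ-elim 1≤t) (≤ᵇ-elim t≤N) g sc (sound ps 1 cs sd) (reaches t cs rch)
            (affordable 0 ps N _ cs (subst (λ ds → affordable? 0 ps N ds cs ≡ true) (evals≡tally N t cs g) aff))

-- Covering ranges of thresholds.

Covers : ℕ → ℕ → Set
Covers lo hi = ∀ N → N ≢ 56 → lo < 2 * N / 7 → 2 * N / 7 ≤ hi → Exchange N (2 * N / 7)

-- The least N ≢ 56 with lo < 2 N / 7.
start : ℕ → ℕ
start lo = if lo ≡ᵇ 15 then 57 else ceil7/2 (suc lo)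

7*[2N/7]≤2N : ∀ N → 7 * (2 * N / 7) ≤ 2 * N
7*[2N/7]≤2N N = ≤-trans (≤-reflexive (*-comm 7 (2 * N / 7))) (m/n*n≤m (2 * N) 7)

ceil7/2≤ : ∀ {t} N → t ≤ 2 * N / 7 → ceil7/2 t ≤ N
ceil7/2≤ {t} N t≤ = ≤-pred (*-cancelˡ-< 2 (ceil7/2 t) (suc N) (≤-<-trans (div-* 2 (7 * t + 1) (s≤s z≤n)) (begin-strict
  7 * t + 1   ≤⟨ +-monoˡ-≤ 1 (≤-trans (*-monoʳ-≤ 7 t≤) (7*[2N/7]≤2N N)) ⟩
  2 * N + 1   <⟨ +-monoʳ-< (2 * N) (s≤s (s≤s z≤n)) ⟩
  2 * N + 2   ≡⟨ trans (+-comm (2 * N) 2) (sym (*-suc 2 N)) ⟩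
  2 * suc N   ∎)))
  where open ≤-Reasoning

start≤ : ∀ lo N → N ≢ 56 → lo < 2 * N / 7 → start lo ≤ N
start≤ lo N N≢56 lo< with lo ≡ᵇ 15 in eq
... | false = ceil7/2≤ N lo<
... | true with ≡ᵇ⇒≡ lo 15 (Equivalence.from T-≡ eq)
...   | refl = ≤∧≢⇒< (ceil7/2≤ N lo<) λ 56≡N → N≢56 (sym 56≡N)

-- The least N of the range combined with its greatest threshold is the hardest case, and
-- `exchange-mono` yields all others. Slack is what allows hi to be larger than lo + 1.
covers-step : ∀ lo hi → hi ≤ start lo × Exchange (start lo) hi → Covers lo hi
covers-step lo hi (hi≤ , E) N N≢56 lo< ≤hi = exchange-mono (start≤ lo N N≢56 lo<) ≤hi hi≤ E

covers-trans : ∀ {lo mi hi} → Covers lo mi → Covers mi hi → Covers lo hi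
covers-trans {lo} {mi} C D N N≢56 lo< ≤hi with 2 * N / 7 ≤? mi
... | yes ≤mi = C N N≢56 lo< ≤mi
... | no  ≰mi = D N N≢56 (≰⇒> ≰mi) ≤hi

covers-weaken : ∀ {lo lo′ hi} → lo ≤ lo′ → Covers lo hi → Covers lo′ hi
covers-weaken lo≤lo′ C N N≢56 lo′< = C N N≢56 (≤-<-trans lo≤lo′ lo′<)

covers-refl : ∀ {lo} → Covers lo lo
covers-refl N _ lo< ≤lo = contradiction ≤lo (<⇒≱ lo<)

next : ℕ → ℕ → ℕ
next q lo = lo + lo div q

-- The primes 2, 3, 5, 7 and chains of certified steps.

caps : ℕ → ℕ → ℕ → ℕ → Caps
caps a b c d = (2 , a) ∷ (3 , b) ∷ (5 , c) ∷ (7 , d) ∷ []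

good-caps : ∀ a b c d → Good (caps a b c d)
good-caps a b c d = (≤ᵇ-elim {2} {2} refl , coprime 3 2 refl ∷ coprime 5 2 refl ∷ coprime 7 2 refl ∷ [])
                  ∷ (≤ᵇ-elim {2} {3} refl , coprime 5 3 refl ∷ coprime 7 3 refl ∷ [])
                  ∷ (≤ᵇ-elim {2} {5} refl , coprime 7 5 refl ∷ []) ∷ (≤ᵇ-elim {2} {7} refl , []) ∷ []
  where
  coprime : ∀ m n → gcd m n ≡ 1 → Coprime m n
  coprime m n = gcd≡1⇒coprime

smooth-caps : ∀ a b c d → SmoothCaps (caps a b c d)
smooth-caps a b c d = small 2 refl refl ∷ small 3 refl refl ∷ small 5 refl refl ∷ small 7 refl refl ∷ []
  where
  small : ∀ p → (1 ≤ᵇ p) ≡ true → (p ≤ᵇ 7) ≡ true → Smooth7 p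
  small p 1≤p p≤7 = ≤7⇒Smooth7 (≤ᵇ-elim 1≤p) (≤ᵇ-elim p≤7)

-- (e , k , q , seed) stands for k steps with the cap e on the exponent of 2, each raising the
-- threshold by the fraction 1 / q.
Run : Set
Run = ℕ × ℕ × ℕ × ℕ

run? : Menu → ℕ → ℕ → ℕ → ℕ → ℕ → Bool
run? m e zero    q seed lo = true
run? m e (suc k) q seed lo = certified? (caps e 2 1 1) (start lo) (next q lo) (decode (next q lo) m seed) ∧ run? m e k q seed (next q lo)

runEnd : ℕ → ℕ → ℕ → ℕ
runEnd zero    q lo = lo
runEnd (suc k) q lo = runEnd k q (next q lo)

run-covers : ∀ m e k q seed lo → run? m e k q seed lo ≡ true → Covers lo (runEnd k q lo)
run-covers m e zero    q seed lo _  = covers-refl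
run-covers m e (suc k) q seed lo eq with ∧-elim {certified? (caps e 2 1 1) (start lo) (next q lo) (decode (next q lo) m seed)} eq
... | c , eq′ = covers-trans {lo} {next q lo}
      (covers-step lo (next q lo) (certified-exchange (start lo) (next q lo) (decode (next q lo) m seed) (good-caps e 2 1 1) (smooth-caps e 2 1 1) c))
      (run-covers m e k q seed (next q lo) eq′)

runs? : Menu → List Run → ℕ → Bool
runs? m []                         lo = true
runs? m ((e , k , q , seed) ∷ xs) lo = run? m e k q seed lo ∧ runs? m xs (runEnd k q lo)

runsEnd : List Run → ℕ → ℕ
runsEnd []                      lo = lo
runsEnd ((_ , k , q , _) ∷ xs) lo = runsEnd xs (runEnd k q lo)

runs-cover : ∀ m xs lo → runs? m xs lo ≡ true → Covers lo (runsEnd xs lo)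
runs-cover m []                         lo _  = covers-refl
runs-cover m ((e , k , q , seed) ∷ xs) lo eq with ∧-elim {run? m e k q seed lo} eq
... | r , eq′ = covers-trans {lo} {runEnd k q lo} (run-covers m e k q seed lo r) (runs-cover m xs (runEnd k q lo) eq′)

-- Separate choices for each n, for small thresholds.

-- Positions are numbered from 1, to match n = 1, ..., N.
nth : List (List ℕ) → ℕ → List ℕ
nth (x ∷ xs) (suc zero)    = x
nth (x ∷ xs) (suc (suc n)) = nth xs (suc n)
nth _        _             = []

total : ℕ → List (List ℕ) → ℕ
total k []       = 0
total k (x ∷ xs) = at k x + total k xs

sumTo-shift : ∀ N (f : ℕ → ℕ) → f 1 + sumTo N (λ n → f (suc n)) ≡ sumTo (suc N) f
sumTo-shift zero    f = +-identityʳ (f 1)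
sumTo-shift (suc N) f = trans (sym (+-assoc (f 1) _ _)) (cong (_+ f (suc (suc N))) (sumTo-shift N f))

sumTo-nth : ∀ k xs → sumTo (length xs) (λ n → at k (nth xs n)) ≡ total k xs
sumTo-nth k []       = refl
sumTo-nth k (x ∷ xs) = trans (sym (sumTo-shift (length xs) (λ n → at k (nth (x ∷ xs) n))))
  (cong (at k x +_) (trans (sumTo-cong (length xs) λ { (suc n) _ _ → refl }) (sumTo-nth k xs)))

fits? : Caps → ℕ → ℕ → List (List ℕ) → Bool
fits? ps t n []       = true
fits? ps t n (x ∷ xs) = (t ≤ᵇ pow 0 ps x * strip ps n) ∧ fits? ps t (suc n) xs

fits : ∀ ps t j xs → fits? ps t j xs ≡ true → ∀ i → i < length xs → t ≤ pow 0 ps (nth xs (suc i)) * strip ps (j + i)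
fits ps t j (x ∷ xs) eq i i< with ∧-elim {t ≤ᵇ pow 0 ps x * strip ps j} eq
fits ps t j (x ∷ xs) eq zero    i<       | h , _   rewrite +-identityʳ j = ≤ᵇ-elim h
fits ps t j (x ∷ xs) eq (suc i) (s≤s i<) | _ , eq′ rewrite +-suc j i = fits ps t (suc j) xs eq′ i i<

dominated? : ℕ → Caps → ℕ → List (List ℕ) → Bool
dominated? k []             N xs = true
dominated? k ((p , e) ∷ ps) N xs = (total k xs ≤ᵇ supply p e N) ∧ dominated? (suc k) ps N xs

dominated : ∀ k ps xs → dominated? k ps (length xs) xs ≡ true → Dominated k ps (length xs) (nth xs)
dominated k []             xs _  = tt
dominated k ((p , e) ∷ ps) xs eq with ∧-elim {total k xs ≤ᵇ supply p e (length xs)} eq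
... | h , eq′ = ≤-trans (≤-reflexive (sumTo-nth k xs)) (≤ᵇ-elim h) , dominated (suc k) ps xs eq′

offers : ℕ → Menu → ℕ → List ℕ × List (List ℕ)
offers t []                 c = [] , []
offers t ((s , o , os) ∷ m) c = if t ≤ᵇ s * c then (o , os) else offers t m c

-- Here the seed has one digit for each of the numbers n, n + 1, … .
walk : Caps → Menu → ℕ → ℕ → ℕ → ℕ → List (List ℕ)
walk′ : Caps → Menu → ℕ → ℕ → ℕ → ℕ → List ℕ × List (List ℕ) → List (List ℕ)
walk ps m t zero    n seed = []
walk ps m t (suc f) n seed = walk′ ps m t f n seed (offers t m (strip ps n))
walk′ ps m t f n seed (o , os) = choose o os (seed % suc (length os)) ∷ walk ps m t f (suc n) (seed / suc (length os))

length-walk : ∀ ps m t f n seed → length (walk ps m t f n seed) ≡ f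
length-walk ps m t zero    n seed = refl
length-walk ps m t (suc f) n seed = cong suc (length-walk ps m t f (suc n) (seed / suc (length (proj₂ (offers t m (strip ps n))))))

direct? : Caps → ℕ → ℕ → List (List ℕ) → Bool
direct? ps N t xs = (t ≤ᵇ N) ∧ (fits? ps t 1 xs ∧ dominated? 0 ps N xs)

directs? : Caps → Menu → List (ℕ × ℕ) → ℕ → Bool
directs? ps m []                lo = true
directs? ps m ((hi , seed) ∷ xs) lo = direct? ps (start lo) hi (walk ps m hi (start lo) 1 seed) ∧ directs? ps m xs hi

directsEnd : List (ℕ × ℕ) → ℕ → ℕ
directsEnd []              lo = lo
directsEnd ((hi , _) ∷ xs) lo = directsEnd xs hi

module _ {ps : Caps} (g : Good ps) (sc : SmoothCaps ps) where

  direct-exchange : ∀ N t xs → length xs ≡ N → direct? ps N t xs ≡ true → t ≤ N × Exchange N t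
  direct-exchange N t xs refl eq with ∧-elim {t ≤ᵇ N} eq
  ... | t≤N , eq₁ with ∧-elim {fits? ps t 1 xs} eq₁
  ...   | ft , dm = ≤ᵇ-elim t≤N , dominated-exchange (nth xs) g sc
            (λ { (suc i) _ i< → fits ps t 1 xs ft i i< }) (dominated 0 ps xs dm)

  directs-covers : ∀ m xs lo → directs? ps m xs lo ≡ true → Covers lo (directsEnd xs lo)
  directs-covers m []                 lo _  = covers-refl
  directs-covers m ((hi , seed) ∷ xs) lo eq with ∧-elim {direct? ps (start lo) hi (walk ps m hi (start lo) 1 seed)} eq
  ... | d , eq′ = covers-trans {lo} {hi}
        (covers-step lo hi (direct-exchange (start lo) hi _ (length-walk ps m hi (start lo) 1 seed) d)) (directs-covers m xs hi eq′)

-- The certificates.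

-- The seeds below were found by simulated annealing, starting from solutions of the linear programme
-- that maximises the least unspent proportion of 2, 3, 5, 7.

-- With each 7-smooth threshold come 7-smooth numbers from it upwards: a number larger than
-- necessary can be the better choice when it uses more plentiful primes.
offers₁ : List (ℕ × List ℕ)
offers₁ =
  (1 , 1 ∷ []) ∷ (2 , 2 ∷ 3 ∷ 4 ∷ 5 ∷ 6 ∷ 7 ∷ 8 ∷ 9 ∷ []) ∷ (3 , 3 ∷ 4 ∷ 5 ∷ 6 ∷ 7 ∷ 8 ∷ 9 ∷ 10 ∷ []) ∷
  (4 , 4 ∷ 5 ∷ 6 ∷ 7 ∷ 8 ∷ 9 ∷ 10 ∷ 12 ∷ []) ∷ (5 , 5 ∷ 6 ∷ 7 ∷ 8 ∷ 9 ∷ 10 ∷ 12 ∷ 14 ∷ []) ∷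
  (6 , 6 ∷ 7 ∷ 8 ∷ 9 ∷ 10 ∷ 12 ∷ 14 ∷ 15 ∷ []) ∷ (7 , 7 ∷ 8 ∷ 9 ∷ 10 ∷ 12 ∷ 14 ∷ 15 ∷ 16 ∷ []) ∷
  (8 , 8 ∷ 9 ∷ 10 ∷ 12 ∷ 14 ∷ 15 ∷ 16 ∷ 18 ∷ []) ∷ (9 , 9 ∷ 10 ∷ 12 ∷ 14 ∷ 15 ∷ 16 ∷ 18 ∷ 20 ∷ []) ∷
  (10 , 10 ∷ 12 ∷ 14 ∷ 15 ∷ 16 ∷ 18 ∷ 20 ∷ 21 ∷ []) ∷ (12 , 12 ∷ 14 ∷ 15 ∷ 16 ∷ 18 ∷ 20 ∷ 21 ∷ 24 ∷ []) ∷
  (14 , 14 ∷ 15 ∷ 16 ∷ 18 ∷ 20 ∷ 21 ∷ 24 ∷ 25 ∷ []) ∷ (15 , 15 ∷ 16 ∷ 18 ∷ 20 ∷ 21 ∷ 24 ∷ 25 ∷ 27 ∷ []) ∷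
  (16 , 16 ∷ 18 ∷ 20 ∷ 21 ∷ 24 ∷ 25 ∷ 27 ∷ 28 ∷ []) ∷ (18 , 18 ∷ 20 ∷ 21 ∷ 24 ∷ 25 ∷ 27 ∷ 28 ∷ 30 ∷ []) ∷
  (20 , 20 ∷ 21 ∷ 24 ∷ 25 ∷ 27 ∷ 28 ∷ 30 ∷ 32 ∷ []) ∷ (21 , 21 ∷ 24 ∷ 25 ∷ 27 ∷ 28 ∷ 30 ∷ 32 ∷ 35 ∷ []) ∷
  (24 , 24 ∷ 25 ∷ 27 ∷ 28 ∷ 30 ∷ 32 ∷ 35 ∷ 36 ∷ []) ∷ (25 , 25 ∷ 27 ∷ 28 ∷ 30 ∷ 32 ∷ 35 ∷ 36 ∷ 40 ∷ []) ∷
  (27 , 27 ∷ 28 ∷ 30 ∷ 32 ∷ 35 ∷ 36 ∷ 40 ∷ 42 ∷ []) ∷ (28 , 28 ∷ 30 ∷ 32 ∷ 35 ∷ 36 ∷ 40 ∷ 42 ∷ 45 ∷ []) ∷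
  (30 , 30 ∷ 32 ∷ 35 ∷ 36 ∷ 40 ∷ 42 ∷ 45 ∷ 48 ∷ []) ∷ (32 , 32 ∷ 35 ∷ 36 ∷ 40 ∷ 42 ∷ 45 ∷ 48 ∷ 49 ∷ []) ∷
  (35 , 35 ∷ 36 ∷ 40 ∷ 42 ∷ 45 ∷ 48 ∷ 49 ∷ 50 ∷ []) ∷ (36 , 36 ∷ 40 ∷ 42 ∷ 45 ∷ 48 ∷ 49 ∷ 50 ∷ 54 ∷ []) ∷
  (40 , 40 ∷ 42 ∷ 45 ∷ 48 ∷ 49 ∷ 50 ∷ 54 ∷ 56 ∷ []) ∷ (42 , 42 ∷ 45 ∷ 48 ∷ 49 ∷ 50 ∷ 54 ∷ 56 ∷ 60 ∷ []) ∷
  (45 , 45 ∷ 48 ∷ 49 ∷ 50 ∷ 54 ∷ 56 ∷ 60 ∷ 63 ∷ []) ∷ (48 , 48 ∷ 49 ∷ 50 ∷ 54 ∷ 56 ∷ 60 ∷ 63 ∷ 64 ∷ []) ∷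
  (49 , 49 ∷ 50 ∷ 54 ∷ 56 ∷ 60 ∷ 63 ∷ 64 ∷ 70 ∷ []) ∷ (50 , 50 ∷ 54 ∷ 56 ∷ 60 ∷ 63 ∷ 64 ∷ 70 ∷ 72 ∷ []) ∷
  (54 , 54 ∷ 56 ∷ 60 ∷ 63 ∷ 64 ∷ 70 ∷ 72 ∷ 75 ∷ []) ∷ (56 , 56 ∷ 60 ∷ 63 ∷ 64 ∷ 70 ∷ 72 ∷ 75 ∷ 80 ∷ []) ∷
  (60 , 60 ∷ 63 ∷ 64 ∷ 70 ∷ 72 ∷ 75 ∷ 80 ∷ 81 ∷ []) ∷ (63 , 63 ∷ 64 ∷ 70 ∷ 72 ∷ 75 ∷ 80 ∷ []) ∷
  (64 , 64 ∷ 70 ∷ 72 ∷ 75 ∷ 80 ∷ 81 ∷ []) ∷ (70 , 70 ∷ 72 ∷ 75 ∷ 80 ∷ 81 ∷ 84 ∷ []) ∷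
  (72 , 72 ∷ 75 ∷ 80 ∷ 81 ∷ 84 ∷ 90 ∷ []) ∷ (75 , 75 ∷ 80 ∷ 81 ∷ 84 ∷ 90 ∷ 96 ∷ []) ∷
  (80 , 80 ∷ 81 ∷ 84 ∷ 90 ∷ 96 ∷ 98 ∷ []) ∷ (81 , 81 ∷ 84 ∷ 90 ∷ 96 ∷ 98 ∷ 100 ∷ []) ∷
  (84 , 84 ∷ 90 ∷ 96 ∷ 98 ∷ 100 ∷ 105 ∷ []) ∷ (90 , 90 ∷ 96 ∷ 98 ∷ 100 ∷ 105 ∷ 108 ∷ []) ∷
  (96 , 96 ∷ 98 ∷ 100 ∷ 105 ∷ 108 ∷ 112 ∷ []) ∷ (98 , 98 ∷ 100 ∷ 105 ∷ 108 ∷ 112 ∷ 120 ∷ []) ∷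
  (100 , 100 ∷ 105 ∷ 108 ∷ 112 ∷ 120 ∷ 125 ∷ []) ∷ (105 , 105 ∷ 108 ∷ 112 ∷ 120 ∷ 125 ∷ 126 ∷ []) ∷ []

directs₁ : List (ℕ × ℕ)
directs₁ =
  (1 , 0x0) ∷
  (2 , 0xA41) ∷
  (3 , 0x14419201) ∷
  (4 , 0x822016AB) ∷
  (5 , 0x512012CA2C8) ∷
  (6 , 0x483E01214304) ∷
  (7 , 0xD83132C205C48B) ∷
  (8 , 0x385584130111A092) ∷
  (9 , 0x924CA480A592D9288) ∷
  (10 , 0x88904B548A8A0CA140) ∷
  (11 , 0x2C000D2258A54088540) ∷
  (12 , 0xB402290800008A2A200252) ∷
  (13 , 0x18201C4A61A0C900A4902C9) ∷
  (14 , 0x64120A2D8016041040610688489) ∷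
  (15 , 0x400124806302006028806180C801) ∷
  (16 , 0x1061D64020D05A0090142D901274D618) ∷
  (17 , 0x50C0824034901020A080680212258641) ∷
  (18 , 0x900402480B000144B0812C829040A208243) ∷
  (19 , 0x24800049000080100410808900800A305528) ∷
  (20 , 0x400B00420202010022000442400508C0214151420) ∷
  (21 , 0x24008D08101224000124214004200A24000B20804A) ∷
  (22 , 0x220000004200A6066032020D864040049841920C6D8) ∷
  (23 , 0x1B0012402C20C20104042032084406C2620C40000019618) ∷
  (24 , 0x208618000CC00C00C062000200B44260120805800259A283) ∷
  (25 , 0x42080600020020405582520090138406014124604005042A1) ∷
  (26 , 0x10124002500014034102E0410011052C822016104A8209081052) ∷
  (27 , 0x1200A0004900040810882D825322204140620201024921049328A) ∷
  (28 , 0xA0001188002890002C14808480090C0009801201000008210888901) ∷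
  (29 , 0x101C01500009000528108022940A018019281043A28140A01001A18) ∷
  (30 , 0x100012085007580012000A9000400040028150010280621010618A03608411) ∷
  (31 , 0x88001A004004080094000510000022C008016804044220162B28840814A401) ∷
  (32 , 0x40A010A4021800900188800224800206A2006800000102C12412084C060505121A) ∷
  (33 , 0xA5B611240008009408268002400000010000240000208200A02022248418488082) ∷
  (34 , 0x200080000200200208209600041011048480A80048501C0920905040864C448) ∷
  (35 , 0x88022082002000084004C0009A0048002C22024000020824A402228608400213201) ∷
  (36 , 0x400000208010480028008408008000410280028A18040C412080C320D008C480414B5271) ∷
  (37 , 0x140100101000864000801920075000083008300A008200042008240002428442C442C8080) ∷
  (38 , 0x2064440002004C041400000040000800000A0C040920918C000B00010201001010530218050600) ∷
  (39 , 0x12000010000002000410002400806004810010000001010C6040241C08052E02600450201071213) ∷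
  (40 , 0x20A002601000040288A8800008000800860002108000008808A400280200410401200008201489983) ∷
  (41 , 0x20200004100010030105400080228002048000110081000A00060000821048220121080080B088C40) ∷
  (42 , 0x9040201420010000000020440021020001040010050002000C88010200901000484001011090408500044) ∷
  (43 , 0x4082C0400008000000008008440000000480041601008000041200010A084C001820864300008921948AA48) ∷
  (44 , 0x4304004001040100000021020A20000000105802A0012880106082430004000880100C000A20062821B209242) ∷
  (45 , 0x40280001601200080208400000200145600411048045011209209008000140200140001448030408442648) ∷
  (46 , 0x220804000000000820000024020061200940000240840B00B4002102000802000402C420064C00000065041A6DB011) ∷
  (47 , 0x40400020C0070000010402008080000001001008083600000001040000C0BA800182002416004882122100008054582D0) ∷
  (48 , 0x50002000000190050004C00000020000192C020200061804201020140000A012400000600200201A0C40849804925120B048) ∷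
  (49 , 0x32114000080104020002580C000001C001900004000C12001088002210002000C030188006C082018240326078841C5015B1) ∷
  (50 , 0x2004010084100000004080000100AA05228000160020800215000140024401264000800088020844241201068022228B044) ∷
  (51 , 0x8001008400000E180020082900000020140100D000A00160900004000421008200920C010200200A38ECA200208001A1224A241) ∷
  (52 , 0x40800000A20021060000100004808000101220008000B00040020204001240804106B20001000028001044A401211140409741251) ∷
  (53 , 0x848000120844124820000940024000000120103840004140043A00200000220800101000500800028021920200522824020C502411) ∷
  (54 , 0x10000020002000C000000821005003B20A00004000A003040403002110000240002000208014800008410400040140203608288A1524A042) ∷
  (55 , 0x50002090010020400402000080C121120004004020908240000804104800824000104025901020200820020041008320920A61000248816A) ∷
  (56 , 0x10810000400000010810C0410400040009012200080210201A0000000500828800002004068800920100860044324820220120848044D041041) ∷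
  (57 , 0x200100004D000481000040200020042009000000082008096600118000040030640218000240004000000400441600600201408208041050042) ∷
  (58 , 0x2488020000090100010400014002180400080000000812000002400000010000000C000000824101840221820008020820A010008208608211419) ∷
  (59 , 0x22432000010080002000094006000000082012010C060A040400040000108200280088040258200003010400001200041408200609019080200) ∷
  (60 , 0x82D94000001400400010000002086010012100000086000C00400010400C840008120004880024000B0012008014002080004082984C842815028A) ∷
  (61 , 0x26E28E124098FE6CA85F2D0D844E29BAF6D20DA4AC57AC716DE709756F95C94EC6B002BA575C1A89AD2CDED1EA0744418732EA1BFDC85DB4E) ∷
  (62 , 0xDBB0BC1B8BD23314BECF3386B5FB6DC884D64DE4AEA30D9F196D3252AD3B7BDFCB1503D2EFA997F808AEE0C0DF0A060871296D41D7AF1BCF830C3980) ∷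
  (63 , 0x6DFCECE4D197440176E7EEE2E7712DE6A1F42140F2C225DDE2F1F0650FB6A791225372745686AB4AB2AD8723FADB62A324E2D34AAE2BDF3A1F11B84B) ∷
  (64 , 0x524DB301F4F17E8727A601967E311F73F075DA88BAD3B87D2D6B198165D049ACB36CB052476619268A65B5530F4388EA7C3F1529FCAFBA27A0DD8ED22EC) ∷
  (65 , 0x17764827D32BDEC7042BA483D0BC2F0C2680FC5C48AAA8CFD16B3A2F2BE1D27DAFD45F04675354D0EC3E9F77D724BE34405855654E4EEC66B737DE7C03B66) ∷
  (66 , 0x2E47D9CCADA0696933D4AA431E0C9679EA246836A2B7D39DB5208E7D4497AFAEC5FA075F6E84842B6563F3809ED7B11E558015DFE90F6B5D322643D95758F5) ∷
  (67 , 0x4A47151713306080BB3A7756F4F10381CB7108007520CFA9B94EC30CD1EF16127BD80D89CF80C666870A3A8F552E2299F657AED4620B8EBC38E7DC) ∷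
  (68 , 0x5CB901E01D7FCDD16F7A077244A40C8EE7580091F390839D4A60DDA14D3B8A7950A387D1E8F6F547C95E70B67BD40583BB8A6965348CCE01D6FFBBFB234822E7) ∷
  (69 , 0x48008F27F1B8CDA15C96DB2A215F32664BAC36ECCF215CBB4B5A578343D8AABB31596A65FBCAB5485B836F2F4025055153EC87883BC4CBC0FA39070200F09E) ∷
  (70 , 0xB91F657BE9EC1D4942B317ED6CD1AFED68EA0AF4306C577016D895E62F3A4B98CDAB86B7162D0D3A8176CB60852D8F14460E15C48D854F9506B673297ED1B08ACF01C) ∷
  (71 , 0x1329D7254A6AF8D4A374B2C34F6084F3DFCFEE47D20633B8D8FCD5A970795AF8E2A373A08AF298C2FBBE0603F42EA5B8F483D378C99BAC54D642922983ACEAD77B30B0) ∷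
  (72 , 0x9FB9536D424CF6871071FD44DB3DB227B0125A8EB9D895DF53A6D3919CCE0FB2B3F7D0BEA9CC8A69835FF7044EA0C1C28C45D176756DD03D16BB0F862E47756E421D60EB91) ∷
  (73 , 0x116D658AE131D44262A5E6C6779E94343F41FAC48AFFA9047D49D8BBBD6B507C62705173F5F36ADCA23D4F205B8514705B7A88D4446D21BDC4F80FD0FBBB16179399845D78D962) ∷
  (74 , 0x17CC1C862B9324B9623857555BE004B66CF9E1BB41F517D28674B69AA07D7D1B600C16D6EC92E01AAA36F8710F611BF6568338798158800E9C55E453737800AA057C8BA63A8A4D3) ∷
  (75 , 0xBAB52AC9C84093BF9B41664AF37693DF783DE143CDCF7B175AE360C28934FC51750EA22E2E39901FA626B99784EB27F454B1BB2C5CDD021E86E845A65979190964DBB00D47385E4) ∷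
  (76 , 0x107953F3ECDD1505A4BBA6AB7E8ABB83F8A2BEA289FD6435B9521E0AF3E4412A7D7A783980EA174C62F31A923C760CE9CF999C398DFCA242FD17BA75A92737D7B14F19B93EFAF9F68F360) ∷
  (77 , 0xC5AFE722F53BD6A63731E12A5E3FF7EAD1CE8018B03FA525FE711255EB2DFBD4702EB67C1E5071C6B7A392A5F4BF4D5F89436E6BF92059BE5731EDBB806DF9C69D6A714A1B6D01074CC7E9) ∷
  (78 , 0x1497A80FFE7CD72A7257BBF807B22AC1F3D461B8CE289127C51DF69E47DC5C4E1292B44FF914F11875584F47317BF0071F7227F961C343B2A26831C0F961DEA2697CAC4294A290AADD15805) ∷
  (79 , 0x3DCB16859756E6743E7F5F3BEF1C1428C2889973B30F7D952411932985726B83E2BE034C87116B8057FFC1DC3C2F78BC610BD2A4E42C6822B8DC478F93F2F1A99DF9EFA8E49FAA46672E56162) ∷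
  (80 , 0x319D65FB712B06D318CBB409901DF9B47A37AF6C11DC0EF314DA7CE5732EAD103432516DA6DDF209E2A5420BD180BF44C595BFD555BE3AD3EC261AD999613649444EB2BEF4A85B4E558657569C8B3) ∷
  (81 , 0x7B8E00D9D8F350EA4A8F52E7080302B0E3E448B6513ABAD663CD08BCB2A8432C18F705B9F1C201C5A6FCA3CAC6830D5EE0028CCC3AACC59A0A59CC2C3749EC2F6FF5DDD6F497A4921B36A70FBC9AC) ∷
  (82 , 0x18B9139F8206610DFE15D5E09D5B831333C60042E48696800AD0F7346EAF72F2A1F67B9F434548BA83111F5CDB69BAD87FAC2232D79501A24C35EDB56367994F1E2722EF4C445346EFC98422C27F1) ∷
  (83 , 0x18B7909D504FDB05A7F2D8F7E2A143DF3BC47BDC9D2E2E9348E1116746E28376FA380BFA5CE73D3F331A5983EE06E07CD439EE46269E3F4D54F8946433ED3513A5C5A81D6F5239195BB8F1B9B9D9C) ∷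
  (84 , 0x1BDF4505E8D85DF164DA44114FE994B6FB0E42C7AE7CF699E2DF2395FB8E9FAC1C9BA77FDA016583D024AEE4993C6F18B9B13B9750F76D9DF53B57E4B29D1513BDB249084A57ED668559DBA6F16208E528440) ∷
  (85 , 0x3799792F5F054923AAC68B0FEFB644B49A0D21674009C004C1EB33D987DEA1E33D9DBE794EEE1E4AF66BFF2F28373C4F1675E1DE31F28961D422D5FE8D9C992CD7F13FB1665220A504BC2C11D9E1FF561EC9B) ∷
  (86 , 0x536886898C60CFD793A1D03E19F0273F169EA88C14BF50DC79D9652C36A18CB0DB3FE7C6564C5BDA9148F98BC865690EDCA3800A86EFE61A5A129EC920992B977EADE2B8100D7329E8969AF0CC079FACF7D960) ∷
  (87 , 0x948E0F3603DF456D7E8A563A5402186FEC74573D9DDCC0D48D808E02E03AD494ABF2E4B0107B548D0BD91082E48D2A2876D023C3BCDA3DDB5DE40D2B4B1EF65016D8FFB6932928BB4FA4CA5E4F3B52905DA8DAA4) ∷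
  (88 , 0x1F700AA7CC3FBA558CE9149BF1B99E8A4E4FBAF6015DAD105A5A79A5226E772A888B5ACDFCD83DEA1DD23C5036301D433DB8E545CB3606A57CFEE333614DA37C86338F3DA1ADED6B465EC6D532A056119B6D14D0EC) ∷
  (89 , 0x2040894A68D4ACA49E42D812B4473E851F8079A619D7433E423477A88C32F32A92EE7F3CAC639BEB3FE05919D3E65C0943CC84C8F62E1FC3ABE0886E2B2682A3C2FB8FA9E3F17B124B068E7850FA4F9F7DD408CCDD70) ∷
  (90 , 0x7D195080E63AF9B9897AEF4A709AA0DE7C2750222416E43253FD528B584E099E93611707744199ADC70B4D7398ACB8AC5BBF415EFAFCCD3F735C9E64A36C67850AA9C9EB51F34DF949D5BE6A709A826533250E0E5324E5A8) ∷
  (91 , 0x1F46545EC8E0818D091902A9D73F226110CF6093FD7DAE1BF08E95E26B03319AE62EFFEA4017F34C68B9F69996EFE0EA57D7B68CDB60BB91D9420B450FB2BAB8FAEA09ED669AD0A208C46F17FF42DB43D0DFF0A638F8B62E) ∷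
  (92 , 0x3E9C533C27EA41A28FE382FE8123D98676B3007A06D6B5B4BE1D4DA1126FE6515BAF73D676B48C318D2D1251232631F16FD0612B859370AA01A421BDE8EFCD1E02E91C895904363511F666173D9CAC3698884DC7E6CD0C70) ∷
  (93 , 0x46BC4EA4549EF9ADBB3EB8881B0A569EC52CE46D496044E7ADA831E1CCC8C7E399715457AF7476B64E43C5619A264DE462048A7DD3832F27C5C24DC99A6F75CE56B7988DB524722D99A032CFE52F1B1B0A38CF19807999712F84) ∷
  (94 , 0xD7809F45B317BA5435049519BE91DE04E6CC618FE21F2D156E0A6ABC44BE66D2E1978F48703C1A56A26EC20E70FFB5B4E78DFD8CF53312B4370970E4BB94140B7560494B1D8FA96820D8D3342460E60EA5771CD74791A00DA2219) ∷
  (95 , 0x62390322D54A9F0868C013977B6966D1F74ECDD1DC931A54211BBE1D767D19892E38D8CD227B22E43ECE6968FD3E8430C27CF44CAF484E5E2CB1F4768A7591115D99B27CDD4CEC6A55FF7277966C07F11B90999696EAB585633A) ∷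
  (97 , 0x698D5BB21D5C4C14D78339FBDA2F9DC58C5FF475198714CF10315DF49B1FD707514BF6DD3EB4554311ED8CCABD1FEAF088CA310D9C17EA8047CDDFA5611485D59A40F6531C15016A4953119E3A5C796CD2C29B5DED3FFAEA135694AB1) ∷
  (98 , 0x3B871893BFD54D85F0766FD5EEBE6851FEECA8F380071AF79982C4A69C3A4946978EEB3FD4EF9ADD71A14665BC77AF5034C07D6F1B935D0A7EBD67929D6C9480C085051A7B4D1503C7AD31E1331EDECDCC99BBEE7ACF813A76BF1DF045E371) ∷
  (99 , 0x3DE60562619F1807B26A0801B57B5395FDC9781176CE6D3AE3AA4FAE2051370F7403AE2B563E982253634D08D5D517ECA74A4B7361797520415D324D7343A5DBB0D8818CB4FB140CB21FAA0817628B9F1AD299DF3E6CADA939037C034D0B19) ∷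
  (101 , 0x1DB2637F0E4F1ED5035B2261E929F3A9B4D0FA6B4E542CA24CA7A8E27F223C5E58AFB450FEEA96F865F39AEDA7E19C5E899C4F354463FD1FF84A565C657F9282C937C4538A13E442F72CD5598B7773BF2F4AFB6B0EA5FE7A0ABB73380B0BA3492) ∷
  []

offers₂ : List (ℕ × List ℕ)
offers₂ =
  (1 , 1 ∷ []) ∷ (2 , 2 ∷ []) ∷ (3 , 3 ∷ []) ∷ (4 , 4 ∷ []) ∷ (5 , 5 ∷ 6 ∷ []) ∷ (6 , 6 ∷ 7 ∷ []) ∷
  (7 , 7 ∷ 8 ∷ []) ∷ (8 , 8 ∷ 9 ∷ []) ∷ (9 , 9 ∷ 10 ∷ []) ∷ (10 , 10 ∷ 12 ∷ []) ∷ (12 , 12 ∷ 14 ∷ []) ∷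
  (14 , 14 ∷ 15 ∷ 16 ∷ []) ∷ (15 , 15 ∷ 16 ∷ 18 ∷ []) ∷ (16 , 16 ∷ 18 ∷ []) ∷ (18 , 18 ∷ 20 ∷ 21 ∷ []) ∷
  (20 , 20 ∷ 21 ∷ 24 ∷ []) ∷ (21 , 21 ∷ 24 ∷ 25 ∷ []) ∷ (24 , 24 ∷ 25 ∷ 27 ∷ 28 ∷ []) ∷
  (25 , 25 ∷ 27 ∷ 28 ∷ 30 ∷ []) ∷ (27 , 27 ∷ 28 ∷ 30 ∷ 32 ∷ []) ∷ (28 , 28 ∷ 30 ∷ 32 ∷ []) ∷
  (30 , 30 ∷ 32 ∷ 35 ∷ 36 ∷ []) ∷ (32 , 32 ∷ 35 ∷ 36 ∷ []) ∷ (35 , 35 ∷ 36 ∷ 40 ∷ 42 ∷ []) ∷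
  (36 , 36 ∷ 40 ∷ 42 ∷ []) ∷ (40 , 40 ∷ 42 ∷ 45 ∷ 48 ∷ []) ∷ (42 , 42 ∷ 45 ∷ 48 ∷ 49 ∷ []) ∷
  (45 , 45 ∷ 48 ∷ 49 ∷ 50 ∷ []) ∷ (48 , 48 ∷ 49 ∷ 50 ∷ 54 ∷ []) ∷ (49 , 49 ∷ 50 ∷ 54 ∷ 56 ∷ []) ∷
  (50 , 50 ∷ 54 ∷ 56 ∷ 60 ∷ []) ∷ (54 , 54 ∷ 56 ∷ 60 ∷ 63 ∷ []) ∷ (56 , 56 ∷ 60 ∷ 63 ∷ 64 ∷ []) ∷
  (60 , 60 ∷ 63 ∷ 64 ∷ 70 ∷ []) ∷ (63 , 63 ∷ 64 ∷ 70 ∷ 72 ∷ []) ∷ (64 , 64 ∷ 70 ∷ 72 ∷ 75 ∷ []) ∷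
  (70 , 70 ∷ 72 ∷ 75 ∷ 80 ∷ []) ∷ (72 , 72 ∷ 75 ∷ 80 ∷ 81 ∷ []) ∷ (75 , 75 ∷ 80 ∷ 81 ∷ 84 ∷ []) ∷
  (80 , 80 ∷ 81 ∷ 84 ∷ 90 ∷ []) ∷ (81 , 81 ∷ 84 ∷ 90 ∷ 96 ∷ []) ∷ (84 , 84 ∷ 90 ∷ 96 ∷ 98 ∷ []) ∷
  (90 , 90 ∷ 96 ∷ 98 ∷ 100 ∷ []) ∷ (96 , 96 ∷ 98 ∷ 100 ∷ 105 ∷ []) ∷ (98 , 98 ∷ 100 ∷ 105 ∷ 108 ∷ []) ∷
  (100 , 100 ∷ 105 ∷ 108 ∷ 112 ∷ []) ∷ (105 , 105 ∷ 108 ∷ 112 ∷ 120 ∷ []) ∷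
  (108 , 108 ∷ 112 ∷ 120 ∷ 125 ∷ []) ∷ (112 , 112 ∷ 120 ∷ 125 ∷ 126 ∷ []) ∷
  (120 , 120 ∷ 125 ∷ 126 ∷ 128 ∷ []) ∷ (125 , 125 ∷ 126 ∷ 128 ∷ 135 ∷ []) ∷
  (126 , 126 ∷ 128 ∷ 135 ∷ 140 ∷ []) ∷ (128 , 128 ∷ 135 ∷ 140 ∷ 144 ∷ []) ∷
  (135 , 135 ∷ 140 ∷ 144 ∷ 147 ∷ []) ∷ (140 , 140 ∷ 144 ∷ 147 ∷ 150 ∷ []) ∷
  (144 , 144 ∷ 147 ∷ 150 ∷ 160 ∷ []) ∷ (147 , 147 ∷ 150 ∷ 160 ∷ 162 ∷ []) ∷
  (150 , 150 ∷ 160 ∷ 162 ∷ 168 ∷ []) ∷ (160 , 160 ∷ 162 ∷ 168 ∷ 175 ∷ []) ∷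
  (162 , 162 ∷ 168 ∷ 175 ∷ 180 ∷ []) ∷ (168 , 168 ∷ 175 ∷ 180 ∷ 189 ∷ []) ∷
  (175 , 175 ∷ 180 ∷ 189 ∷ 192 ∷ []) ∷ (180 , 180 ∷ 189 ∷ 192 ∷ 196 ∷ []) ∷
  (189 , 189 ∷ 192 ∷ 196 ∷ 200 ∷ []) ∷ (192 , 192 ∷ 196 ∷ 200 ∷ 210 ∷ []) ∷
  (196 , 196 ∷ 200 ∷ 210 ∷ 216 ∷ []) ∷ (200 , 200 ∷ 210 ∷ 216 ∷ 224 ∷ []) ∷
  (210 , 210 ∷ 216 ∷ 224 ∷ 225 ∷ []) ∷ (216 , 216 ∷ 224 ∷ 225 ∷ 240 ∷ []) ∷
  (224 , 224 ∷ 225 ∷ 240 ∷ 243 ∷ []) ∷ (225 , 225 ∷ 240 ∷ 243 ∷ 245 ∷ []) ∷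
  (240 , 240 ∷ 243 ∷ 245 ∷ 250 ∷ []) ∷ (243 , 243 ∷ 245 ∷ 250 ∷ 252 ∷ []) ∷
  (245 , 245 ∷ 250 ∷ 252 ∷ 256 ∷ []) ∷ (250 , 250 ∷ 252 ∷ 256 ∷ 270 ∷ []) ∷
  (252 , 252 ∷ 256 ∷ 270 ∷ 280 ∷ []) ∷ (256 , 256 ∷ 270 ∷ 280 ∷ 288 ∷ []) ∷
  (270 , 270 ∷ 280 ∷ 288 ∷ 294 ∷ []) ∷ (280 , 280 ∷ 288 ∷ 294 ∷ 300 ∷ []) ∷
  (288 , 288 ∷ 294 ∷ 300 ∷ 315 ∷ []) ∷ (294 , 294 ∷ 300 ∷ 315 ∷ 320 ∷ []) ∷
  (300 , 300 ∷ 315 ∷ 320 ∷ 324 ∷ []) ∷ (315 , 315 ∷ 320 ∷ 324 ∷ 336 ∷ []) ∷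
  (320 , 320 ∷ 324 ∷ 336 ∷ 343 ∷ []) ∷ (324 , 324 ∷ 336 ∷ 343 ∷ 350 ∷ []) ∷
  (336 , 336 ∷ 343 ∷ 350 ∷ 360 ∷ []) ∷ (343 , 343 ∷ 350 ∷ 360 ∷ 375 ∷ []) ∷
  (350 , 350 ∷ 360 ∷ 375 ∷ 378 ∷ []) ∷ (360 , 360 ∷ 375 ∷ 378 ∷ 384 ∷ []) ∷
  (375 , 375 ∷ 378 ∷ 384 ∷ 392 ∷ []) ∷ (378 , 378 ∷ 384 ∷ 392 ∷ 400 ∷ []) ∷
  (384 , 384 ∷ 392 ∷ 400 ∷ 405 ∷ []) ∷ (392 , 392 ∷ 400 ∷ 405 ∷ 420 ∷ []) ∷
  (400 , 400 ∷ 405 ∷ 420 ∷ 432 ∷ []) ∷ (405 , 405 ∷ 420 ∷ 432 ∷ 441 ∷ []) ∷ []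

directs₂ : List (ℕ × ℕ)
directs₂ =
  (102 , 0x28026F40054BE08798200313589F0C7304FA0E012A0BE0267BB038030F6EEB11F7) ∷
  (104 , 0x3B9404A04604C1EBCD82000073DA92BB04001351000E2EB0BF99647CC1DF59FA100) ∷
  (106 , 0xD399B4A15E1DCE215AC1CA1FBAC0122219A1026499A817421A360208D58A3C05C51) ∷
  (108 , 0xA1F9CE8B7E6A09E2D2A0A7E59890E06199CC88EE952976D1224578E01FF8425D045) ∷
  (110 , 0xD10B13082D048CB8A0CE13CAB12C14CCAF82D970CF46E08130A5A39AB33185A34075) ∷
  (112 , 0x6520331002F4181F2A29E160B106A07444C0250394BC382BB3625F01C29108F2DE727) ∷
  (114 , 0x56D230264C4B41953522553509814831C4CD066A314A82A2507549C4950F3509CBA87A) ∷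
  (116 , 0x464720002480941097501C63001302825C43706B2300A42A03165A4E08A4A0C344FA552) ∷
  (117 , 0x821098CCC1C014020CD2002909920409852846401313821E0980C4C78A0B212E2D8F01B258) ∷
  (119 , 0x80341000088000820000010300A048090020040020088400140404088A800182210B420022) ∷
  (121 , 0x10412280044480A40104AA80C20404044C029C4008228906050D82A20551481D492517055235) ∷
  (123 , 0x105114884CC5009241082A812504862805811402A82111801A0300E007880600A014A5241562) ∷
  (125 , 0x484980801221101058105694011C12884841030847240181200442A0C808E948421A13895255549) ∷
  (126 , 0x16C153F6C227F159CA32B2368C0B58102A7B691925C6E83381E5DEFD456C31DB5B6CF6FA75758C04B) ∷
  (127 , 0x117B488891B20134921024CA54AADF528BB3681AC292A91456D8E93484C84D4E90ECB5A2B3217AF9A) ∷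
  (129 , 0x8485189061220401010108AD00214024088490304C624020D208980A1441163490058A14A744A60A) ∷
  (131 , 0x88402808023211482040104A240208120818410294010811408084008024410938225011510245541) ∷
  (133 , 0x12975FC4E942DA92602D4078E465408A4F6A258A0F80F2B81034EFCE749F3AC5312FC2D97336A58E4197564) ∷
  (135 , 0x47010838140030A8B28D041FB86DC19F81D98F4972583147F2A3A6FDBB267702B4ACED04A0604C0790283) ∷
  (137 , 0x1292C0284A58D8D8FF2AC292467C2A686AE915F009F5D4F4534C6954AC559A67D49FAB4760B18044F903731) ∷
  (139 , 0x6F08236DA8FC996D48C2C3BFEA9E63E075831A2D61848D9C37A479CC1BA3DE0976A72858097ABB7858134D4C) ∷
  (141 , 0x153DDB4296568E488DD064896F0C49203066F8502CCD0E4944A1BCD4F408007999F5D78E9464A28A2BB9F9B137) ∷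
  (143 , 0x19789F54454B37DCD98C00B3F177F8F8E68C5A2FB000393C7B14A856516591171652CB791DE8E297C4D0168C16) ∷
  (145 , 0x12748DD444E438B7B008038E2D614EB0356FA6FFCD044AECDCDE6052BBD87C75E67039574B65F2E1DCC7E0F6AB3F) ∷
  (147 , 0x6B5B8275ED5693D9EE897D9C6E3517F9F012E3A84B1DE1422E9E71CAE1E5DFDFB6F7C2AB283833ACB33E74ABD29) ∷
  (149 , 0x4B81B911F0288E7C14EA5D649F436636AAFE4054AFD3012CE36048D9B9FFE63915E976F9BF58C89CD38004AF889E2A3) ∷
  (151 , 0xA695CE95DC2DB0FC383810EA32AA47A6FE5D471910C146384912DE22D179D95B712B6CB28379D80DEAED8F706A703384) ∷
  (153 , 0x14D4F9778177162A79EADB80D05B4088283B786B79E2DA3FEC6A69A4A98A613DA61DEF251A9D3A9BA7F59C6DA306650B0) ∷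
  (155 , 0x96F3F37C8BA8AE20771AC7E701C17AD04BDF76078062FB88235A330BCA2C96D0798BF55AEFD5BFAC384EAD0A47C76FBCA) ∷
  (157 , 0xEA96C7C09EE43CC043985ADDCB339A9CB68F3AF7207883772420F3FE8616390E54CE4881C1EB2C5AF38B2BCD2ACD6DED83D87) ∷
  (160 , 0x1C3E9D6F2FF82034ECAA0549AF6DAE72400971736621D182D750DEADA87129949703A036E51A86990A4595573D5E0466DCE3513) ∷
  (163 , 0x69408C82B5DA9E0B2C0A93F3C3DC45D42F0F7AA0145B9A7769343111295435838400605DA9359B9F5D608D80AFCA64C81082) ∷
  (166 , 0x538743B4D47ED80A96CD92767773B57B61EA76FE398C024EF546F7FD666461CC215D188743F13E1BDE618C08EB948630FE5EC1B) ∷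
  (169 , 0x679935DDB339D0E9CB5E30A715944BE299C4C772FEF9BA311AEC69558500F30835087A55BB1F7629777EB6E9FF9360453DA0AA01) ∷
  (172 , 0x1CEF82FE468CE3B914000AD645842FB4FBCC82867B6C44F0A5BF817164F8811C602A37E07124CB64D5941D07C04D0009078C6000AF) ∷
  (175 , 0x3E7233283C262775B6B68F2FCCE8E1B0074BBCC4C5535C6644C5FE91A3E48EA2768BB59179DB94DE853FDC20120C69F429A3C0E8B3FB) ∷
  (178 , 0x3ECB65EAB6004A4344CE66CB363C04B99800F82B6E9D04CB397241809E622C63A070BCA5E0733561177E1D2A3659A5C509CD051B100D13C40) ∷
  (181 , 0x13430B5B30D69FF392F15E3DA764E46F3A119BFB996676B76DACB22F3A904CB36B438DDC04C1842AA9617EBD33A4ACFE2DE83112EFC2A648AF112) ∷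
  (184 , 0x120ED97F2D11B48C50CC1410F0A54B4C1334DA73EA1DC702807D7B3FC2231D1357DA418BE8663B3DCDF81C7DB3EB41FADCECC1C7594BD5C9CCA288) ∷
  (187 , 0xB4C16B2781A9C4E0FFE72E2A24CC11A4584890F4854107D2F6C78B26FCEB2ED3439245ACCCCB08DB62287D54810E7498705511B73D559C7879F63FF) ∷
  (190 , 0x5ADAB1E6E2350F9A533CF651B8FBF05C59208B41699F85A771DF46E4A0E14464A7B225F2EB11FEDA24839ADD57BA21CB130BBEE3EC5D0481077983CFC2) ∷
  (193 , 0xBA11F9B80F070CECA167F826CFDBEA10087A126E047CF1EBA6E77BBB897A38226A8D805B18E9AC5C68CA2B850D3FBD41B36558BDC273B8370608BBF1377) ∷
  (196 , 0x1DB4CD304D47BD0CE569803F034ACA061A543AF869C3E3D67773A9F67AED666527D06C06077B3A45DAC25949D2513893457975BB642BCE0C6266E664) ∷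
  (199 , 0x3DE4092056596733B7AD7538FA799560F75CDEE1DF09C1BE7207FC9A127CFF57ABA7F4CCE12B91EBB102B373AE1AB8C3D4D3FC6B40B3CBB006773685) ∷
  (202 , 0x59CCDDC6E4A115224DC99AC34517D27D46CC5FEF0C50E50CA2CFE2F6D509E815971FBF4E57D2129F755739C2C360C465E664CA73EF32014A7879290CB6C) ∷
  (205 , 0xE7FECAE36AA41733D9025B56CE6B062C16CBCDBEFC3092989AFCCF7CCC17A37049A3529365B3DB6D87E5B586DC25CAED3B4BAB0999A22B8E6130E98801F3C83) ∷
  (208 , 0x5EB4FA22AA5BFBAE46501EE6D72300AF9756BCB4C6918FB2C2DB553C9C520C3369C69417AA1D805DBA08010BBDBF364852194B540B4FFB6C372389358DE384DF) ∷
  (211 , 0x1235120F4B5A626DBCD036B9ED4FDEE5EB38C16213E1FC06662F3B31D3A9069B121D4EC507D320EB653898437065FC5560D000E923CFCC50ACD6F91E6B764CCEDC6A551) ∷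
  (214 , 0x2CF683EC6385F15EFB67A9C3E7CCEB5DD585542D68817F4F2D9AD9561D3237F7FC8894E162777F4648A2D9595E0FAC6E2741DAD9CC4C2E7DAE27586D16BACCC0A411496954) ∷
  (217 , 0x1ADA434EED44D5A232956A02F1EDBC5B98C62F867A5030E704D96D194BE1A61CF0C4CEF714050350803BA94E1775090E865ECD220FF7ED74FF253F0E125D710D2CE77831109C) ∷
  (220 , 0x4BCAC37DA431C0D721DB86EB948FE9D56E582EC377CD2236C68DBABE734B16FE7950334906BDEDDB83E2CCE30C1405F7EAC2565D7EE370BAAF2FFE5A0C6DD848BD29D4111014) ∷
  (224 , 0x93AC39815E77E09E7155A99CC0584CFDCB3DA974B0CA9C4019AE0E39CDE268095D0B399A95F6BE410212FEDA7F09408FDB4311A805B49AEFA33CD393B859EE9B500DF56441051) ∷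
  (228 , 0x2D263A8164D8EEF03C70E029E0310419B1ACA2A7B4E19E2EF5AC94A9953C3168F819474735EC77F114FED684AB2ADCE3BCD4D3B50F982D805211953349868654484129A651000909) ∷
  (231 , 0xD9654FD0FDF7B6841C63F7F5F8FA414813C1286AA000B9E77552E0F8D61B02D57E2C98EC267CFFC32131E5DE7FCA3B1616A1E5D2745AA62F15649E4C1CC0F5984AF736655B345444E2CD) ∷
  (234 , 0xBD4446FB5C4171516BABF2ACB369E6897B005EC7FA46B21886F0E0AE192EDCC93F31D12159BC8B0A00F08AF8DEF8CEB41B30A76F13295BF60A89EB5A3A372E829ACCF9A96E4B500D890EA242) ∷
  (237 , 0xE17438A1C1841E5280927A18269B3F6D87B51ED3307B041C38388B76665BE6643C39BB803D7F7DBE245FD32E996F0637C2913792BEB527430741AFCD1D25BC7C00A45AA325D5AAC00D8D83144013A) ∷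
  (240 , 0x12CEF6D5555A30A331C035019C0386459F17084CD9CF109AFD8B7864C99BC462EEB56BC7C07B022199A74BB48D1F5E9225F7B76C275FC736033D831331792A236B2E3D9E98AE16E5DA3387EF6685592A) ∷
  (244 , 0x5949F4F535A56D1DD696C9A245BCF3454AFBA7E84368FE83B1485023EDED377EF83C0CA0FBE03BD5F18B7ED0D93A05D5C1D4D690D440F91085A19B4F6B4BC8F6C9E600051FFE6B065083B0132C4651A5) ∷
  (248 , 0x81301B0407C3BF9297256D5FE86613C9578D174525AB01B1C057EDB710D042240D8A7B580EA18C9C39B3D44A44FDF17EAD949DFB660B21932667B265CF758BAF1634DC47A5C022E91C0958022A128554755) ∷
  (251 , 0x8ED272DBA8CEF374525F685F1C509CF2B5ED1FBA77BBB13A893A8FC8C0809F21883E7E982594EE97A79933AB7BAEBDF8CF28B35334664C770AF4AB2F31CD7387DFD6673CFCA46F73B943773C1E0DA5AA2B3B8E) ∷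
  (255 , 0x195AE2F2525962207A26F1BA170072F649A7CC3E2D4DDA9A5CED1BEB0E93E497790AF2D6327C4A12D4DDF74C9B07B49E2A05A52CF29CE521FB2EB35D2F7F7944F35A24517FD8A3A52AA0556B7D45A1BEF19A1966) ∷
  (259 , 0xB5A9E1929C19655B998CF2597180AE5DF1118806CD55D1BBA21AF2BB8B31492B410E770E2D71344645340FEDA113612F6021CF2B3EBE918A5E750D288895CF4D9735AF8CC5DF0C8D073ABD0705443743E92A) ∷
  (263 , 0x18BCF3C3481F448B758F1091612915C2AB0F22658ABE649CF4137F26641635E4B261A259EE299F9793EB04C4FE3168016C89F2685E7AC695F3DF7AD034E7DD60BECCB2481ABBA9677DBB262CA5F4B6C1B3612) ∷
  (267 , 0x41AFC8673E966597CDB3A222447A46E66C35EF67C311DA69F2E9D6895A6567A7078EEB807DF271B07772EA065AF4682B1D0385162ADCD8769E24ECCAC255816DB1563D4E84834DF342DBABA2F960633643F6B2) ∷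
  (271 , 0x279170E2DB4628C03150CBA893FAA33255575F0FAACF82FBE37C62F6A75674CB9BE8C7C43A40DB01DD6A0DCE3B7546E6AC44C276838F6562ADC6C235108DB360B393E66C471A02B432B1F322058BA65B378FCBD8) ∷
  (275 , 0x43844F379BE2A07E924B83C8994D40FDC161E6A06549A37D76D35C6C5D3A304C064913DAC183B72C3D74B1012C5C6DED97E1092C9355E9E592A13DBC2D3AA5FBC4C74600C6CCBD3E7631995A3D7A2C05B3703FEB1C4748591791FD) ∷
  (279 , 0x7D3E70EE2364C6723272CB04DD61C25B7AECC7ECFF5B5ABA5E7E9AB6889AC8C7265A5C02BEA853CC9E7AC1A957B320A3F4C2B40B87AF930D413948203F48F776F18484B0C830411382010ED92E65706138E487F955207AC4AE030437B79) ∷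
  (283 , 0x86C948063DA4610EC7E228DD44D1D1ABF27594798395EA7E5958A8C31FEFA2A2816091DDFA02382CB37A489FE400E5189773ED72E8ADE6E6EC9B296D9F5CF78CA043914378C5325C002EA728190FCEEE3BE617781F8761A95B26C0000383) ∷
  (288 , 0x4D9AE2303BFBB35DD86E0CEFD3FF7A60159F14CF1D539716A79B5FBB90E55F484C177ADDAA13BD7F1ECFEC7C1D641D2C2ACE31E6CEBB035814E3E9311058FC893A8F86CCEA992A80BE9649153114E0E7CA67BB03AD03E8B0838090CECA10) ∷
  (290 , 0xEC14A0A2A196B532F9114EEEA2907ADE2E314AEDC878B1243A870C88038695E34EA60F74524F5A5A400756B8024DBC8E80FA07BF9AD7518A7B6DE96B224950A609B9A7B115A89630434B80D87F5EBF17CF816FB5FBB4A92E55C2D9E2132F3C) ∷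
  (295 , 0x26AA8724FE52901E366642769B69698B3D639F4E7C6BB60A623C1EE49525F3387B21BF12D101990EC982A65A06C66E65BA4C4BA04C162C0538919B8D47AAA4F3CFE86B01B58EE6C8C0E0157E004AF8D36A242BE997C96E31D2F96FFA19CC37752) ∷
  (300 , 0x104B035EC98D29153C23C5C113F3B16F58906EF436116E2CAD562D31BC06ECF411E9D1E694E1916EA47058C4AC584C477C6297C401535CAB279C2D4898BCA42539E5607C7DEBDA4BBD424F71C4A9EC3D7423B74EEED2B78A76BA133473351B6A) ∷
  (305 , 0x48B806A6A5B40016B7CD55279A90A55EA34BE3DB8646854AAA707D75017A3C78E93199CFBB5C726E85E9E7E46C28AB2962B45F3A7FD8AD541158F96E478165D8E5AD535F58B24525ABCF121999B9E7EBD05F2F7E09BF85A72DC709E88F676E6E651D71) ∷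
  (309 , 0x17D315BFE894118086CFB54E8A8DCD0129C16D35DABD0F54D65C682B12CEA604F8218E18893755240A4619F4D7541B804E548908889A1BBBC6A1DCF3DB1423799226A35D631E935C9CDE676780D9ACB01753BE143C68BF2EC9270EA0A091AADDCB45CF1CD4130) ∷
  (314 , 0xD7787435FEF5D28807B0C769288D010DCB611F3709FB42155C3D02C0F6EE328C1548F058C4C5DB8ACD8B4ED8B8775AE209C030E2B82E52D6FB92F020D99B2D5D309FBEB094F7E807EF452AAF51FE97F7251C985CCDBF7CFCA885C60088B5B64EC8BFFEEC140DF7) ∷
  (319 , 0x1884E108F135D303AB0C7664CC465EC4936C563A8AF75D549C50C4301AD187E1FF8CDAF737A4C89135D3A0E3A0587EA6B5935313B6DD94225DA808F557BEEB177484738324A3EB3880407A8A7EF3FF233E355F54E68278BC0C04E1ABD770D39FB3B7FDD1BAEC0D013F) ∷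
  (324 , 0xF0F4D4F900C53BBEF9972FC306BC7C296F914F20912E7AF7B70AF2363E0274D71162EE60D862AC7406EDAFD4843C2D224D2BED1E85C70F3867A3364B34CE1647BA8AB9FCC1955BD618DA445FF3BE31DBB9DF732A9DB945533C4DA67A1C3A5A6ACD1900EBE7227C495DDFD) ∷
  (329 , 0x3F522B2CFAF31C3E97F5916C7DFBFB6FB3B1CE59874BC1C57BD7ACB06124286E7122CEB6C61DADFCF5961E38382979948FF69110C596438B72F9705AAA13A8493DBC21A7224E30361774D49DD6000C8038A03DD3B0B72D0B4188F6DF84A429188D0DD45D57F35AEF8DF883E) ∷
  (334 , 0x5F8A2B5E02FF2E77F16E11D048519D286CB12B49532EDBF1405EC614193B9179A80393FB9BAD6418D266EB825BD548A66D9386941A07FBD7FAC73EA1DDE9DD79F0B0AD9A8A2ADD3442CDEF219BD1B53060BE8CD6EFFC57F6DB9FDDE838E40487E692DEC19BA756809ABEE33) ∷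
  (339 , 0x1FE60EF440754CBB8D29C1B99813BAF474625F4E1908E3D9A26149520BB1DD0844B66997D0929E9B41FE87A2B4409A6F25EB1CC1FF0C46C08C0DE88173428529BB7D3BABA26C0036F86E0A5E9747383659D96101944F6CC3FAEA25A72C21D76E499AB7E43E6F107FE094AAA) ∷
  (344 , 0xC5E6F3C873AD6F02284EDFA58FF8CBA80986448EF3486FDC81C11B1AE55986FA6016BA1241F79156F068391B7982609EC162E39E3C5258F1433709E6E7182339958986DD45F20DAF137FB77ABF247AA8D554FF6942F94CBDD040A38D97102F2734D0C1502278B81FB794CE49) ∷
  (350 , 0x7F13AF5F0F3139DEE587AD1427CBD420D9BE46BE56D1B5F27C4A27D84DFD7E6C7BF7D54FD4A2A3055E37912049546D29E0540E953A8A61395CF4B27CCA341CB9FCF5986AA5F44BBBF821A2772A8480C0BD236D7D818C657EC7835E5B1BBBBDD30805B18B786C6BBAFCE30577F57) ∷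
  (356 , 0xA29604470F02C28E517B1244B32524C7A6EC9F87A6C3E3492E8ADFA917327AC2F1B7FC39B8C54A95A0CDFBC312794ABC37D948DE3E85F2697934D2CDFDBDC455128E1D9183D398F86039F931083F0FBB34EC59B0125E509AB11CD565720AF48F47D0344619702AB1955999FB1F2D57) ∷
  (362 , 0x70A0426702DA0418ECE6A78576D0A5E9D62B1CC7BA1B036A7B47414A78E00BDE0B862E4931343FD9C51842EBD60943DA119D3BD149F5A3103312CA1DDC4F5BF2742F3A0964D6A158CBE8A67F67D28B236E058229507A4B8F6E348CB074C3534C3851DA0139F39EEED98E14D88D4FBF1EC3577B46) ∷
  (368 , 0x7395266D05491843D0B624B04FA01E518C59A169D988560344F9226E8819D452A9FEB837ADD7A96E172FA5D3536EA21E0C15586FC352A4C21F04F841ABB8A97F1663052EA84AB9D21F003C081C61E7EF51DFC7CF7F5A7FC592A0C813921FF557A840840B375871E6D72954CC825305961843544C154D5) ∷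
  (372 , 0x3121A99A0DF616F1BA2742169EB55274B925187970B26D5E1519D232CCCE536BDF21A940507BB53AEE9F6E1226A0651BED9E748425ACA14BA6B05279AFA70EA8830E4755D2490AC00BFD482E2BCA00A5CD2C2BD860831704FB07F7C9AF802F0B5FCF38ABAFBA16F71ED4A2F75C14BDE2ED4EAC868814C0F2303) ∷
  (377 , 0x45917748509EFE58CF03474C88CB68E2394DFC5114798D84E8A6EC7C5475577D7DF31E1BBC49077D601FE7FDF7B5099A1180E5C19FFE5F74C6D1C9099834205684BD222302587D892B21190F73E4A3B9E15938CE0AB56E161F2E64E66B970B34DF6907E5081FB8968096FDBB5F28FB4993983C1B9522E22AC9C011E9FD3) ∷
  (383 , 0x4B72F096CF8EF56CF74E6DED16E2BDF8DF3EDDB05F9FBE9BFBE8ECD425C9C08DB818C366964AC75A0208F5E3FF84BC8CC2AF2ED32A691CB6CEB7144FDF1E984A0B152A3D7C62781777BE5FD40941CF29D0CDA7EF15907C011B99B894BB06348ED14ABA7F66D41798BBA6D6569ED865C872485CF1417692056B4B1A4C17FE4) ∷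
  (389 , 0x1F097F52D8D0E972751B13BDD6E8FA20A67B3044F9DA05B929487668D11715EA7E05F2E39650A4E0AA7CEAD991158C91498C6C3D1B627986990E59AC835380A1956CADC07D476FB5F24D2AB0C71B6DC017D44458A1B670A09BB0E59CB389F429462E7A097083B0761928CB0638FA4F8796B668C61B7DF325E669393F7902B) ∷
  (395 , 0x9D7EDC3B90E82FA1A81E8698C8506B128162192EE6FA1A399EABE61F96FFD8472E77EA51074A0DBB2A7DA526A73641BEFCE30ECF75E178B3C159B444B86383BE500AEC81B1DBBB8F75E0B04238236B9A2F9966C4D21B8262A7A5D076132FC942A5CCECF6BFC238276478029A2EF57DA25D12D1F2F7001FBA06B282AC2) ∷
  (401 , 0xA0219E40DA5FBBD387ABC9F7139D3EA50B1A3C82178CB5876FC8BCD4D857A3F994479C264B63E6A2522481DDB1DA0A14382133BD5A72FA9275CD47C0FFBCE28C84C8E3B2072E1C3274BF7EA02A2B1FED469B35CFCA4A201D3ED0C631797551DA38A103AA40356F50C957392F08ECCC734B35F2282D313A3B3CA7963F5BF3F4E56B6) ∷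
  []

-- Beyond 300 the thresholds grow by roughly a sixth at a time, and beyond 19440 they double. High
-- thresholds concern only the few n with very small cofactor, so coarse steps waste little there.
offers₃ : List (ℕ × List ℕ)
offers₃ =
  (1 , 1 ∷ []) ∷ (2 , 2 ∷ []) ∷ (3 , 3 ∷ []) ∷ (4 , 4 ∷ []) ∷ (5 , 5 ∷ []) ∷ (6 , 6 ∷ 7 ∷ []) ∷
  (7 , 7 ∷ 8 ∷ []) ∷ (8 , 8 ∷ 9 ∷ []) ∷ (9 , 9 ∷ 10 ∷ []) ∷ (10 , 10 ∷ []) ∷ (12 , 12 ∷ 14 ∷ []) ∷
  (14 , 14 ∷ 15 ∷ 16 ∷ []) ∷ (15 , 15 ∷ 16 ∷ []) ∷ (16 , 16 ∷ 18 ∷ []) ∷ (18 , 18 ∷ 20 ∷ 21 ∷ []) ∷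
  (20 , 20 ∷ 21 ∷ []) ∷ (21 , 21 ∷ 24 ∷ []) ∷ (24 , 24 ∷ 25 ∷ 27 ∷ 28 ∷ []) ∷ (25 , 25 ∷ 27 ∷ 28 ∷ []) ∷
  (27 , 27 ∷ 28 ∷ 30 ∷ []) ∷ (28 , 28 ∷ 30 ∷ 32 ∷ []) ∷ (30 , 30 ∷ 32 ∷ 35 ∷ []) ∷ (32 , 32 ∷ 35 ∷ 36 ∷ []) ∷
  (35 , 35 ∷ 36 ∷ 40 ∷ []) ∷ (36 , 36 ∷ 40 ∷ 42 ∷ []) ∷ (40 , 40 ∷ 42 ∷ 45 ∷ []) ∷
  (42 , 42 ∷ 45 ∷ 48 ∷ 49 ∷ []) ∷ (45 , 45 ∷ 48 ∷ 49 ∷ 50 ∷ []) ∷ (48 , 48 ∷ 49 ∷ 50 ∷ 54 ∷ []) ∷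
  (49 , 49 ∷ 50 ∷ 54 ∷ 56 ∷ []) ∷ (50 , 50 ∷ 54 ∷ 56 ∷ []) ∷ (54 , 54 ∷ 56 ∷ 60 ∷ 63 ∷ []) ∷
  (56 , 56 ∷ 60 ∷ 63 ∷ 64 ∷ []) ∷ (60 , 60 ∷ 63 ∷ 64 ∷ 70 ∷ []) ∷ (63 , 63 ∷ 64 ∷ 70 ∷ 72 ∷ []) ∷
  (64 , 64 ∷ 70 ∷ 72 ∷ 75 ∷ []) ∷ (70 , 70 ∷ 72 ∷ 75 ∷ 80 ∷ []) ∷ (72 , 72 ∷ 75 ∷ 80 ∷ 81 ∷ []) ∷
  (75 , 75 ∷ 80 ∷ 81 ∷ 84 ∷ []) ∷ (80 , 80 ∷ 81 ∷ 84 ∷ 90 ∷ []) ∷ (81 , 81 ∷ 84 ∷ 90 ∷ []) ∷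
  (84 , 84 ∷ 90 ∷ 96 ∷ 98 ∷ []) ∷ (90 , 90 ∷ 96 ∷ 98 ∷ 100 ∷ []) ∷ (96 , 96 ∷ 98 ∷ 100 ∷ 105 ∷ []) ∷
  (98 , 98 ∷ 100 ∷ 105 ∷ 108 ∷ []) ∷ (100 , 100 ∷ 105 ∷ 108 ∷ 112 ∷ []) ∷
  (105 , 105 ∷ 108 ∷ 112 ∷ 120 ∷ []) ∷ (108 , 108 ∷ 112 ∷ 120 ∷ 125 ∷ []) ∷
  (112 , 112 ∷ 120 ∷ 125 ∷ 126 ∷ []) ∷ (120 , 120 ∷ 125 ∷ 126 ∷ 128 ∷ []) ∷
  (125 , 125 ∷ 126 ∷ 128 ∷ 135 ∷ []) ∷ (126 , 126 ∷ 128 ∷ 135 ∷ 140 ∷ []) ∷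
  (128 , 128 ∷ 135 ∷ 140 ∷ 144 ∷ []) ∷ (135 , 135 ∷ 140 ∷ 144 ∷ 147 ∷ []) ∷
  (140 , 140 ∷ 144 ∷ 147 ∷ 150 ∷ []) ∷ (144 , 144 ∷ 147 ∷ 150 ∷ 160 ∷ []) ∷
  (147 , 147 ∷ 150 ∷ 160 ∷ 162 ∷ []) ∷ (150 , 150 ∷ 160 ∷ 162 ∷ 168 ∷ []) ∷
  (160 , 160 ∷ 162 ∷ 168 ∷ 175 ∷ []) ∷ (162 , 162 ∷ 168 ∷ 175 ∷ 180 ∷ []) ∷
  (168 , 168 ∷ 175 ∷ 180 ∷ 189 ∷ []) ∷ (175 , 175 ∷ 180 ∷ 189 ∷ 192 ∷ []) ∷
  (180 , 180 ∷ 189 ∷ 192 ∷ 196 ∷ []) ∷ (189 , 189 ∷ 192 ∷ 196 ∷ 200 ∷ []) ∷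
  (192 , 192 ∷ 196 ∷ 200 ∷ 210 ∷ []) ∷ (196 , 196 ∷ 200 ∷ 210 ∷ 216 ∷ []) ∷
  (200 , 200 ∷ 210 ∷ 216 ∷ 224 ∷ []) ∷ (210 , 210 ∷ 216 ∷ 224 ∷ 225 ∷ []) ∷
  (216 , 216 ∷ 224 ∷ 225 ∷ 240 ∷ []) ∷ (224 , 224 ∷ 225 ∷ 240 ∷ 243 ∷ []) ∷
  (225 , 225 ∷ 240 ∷ 243 ∷ 245 ∷ []) ∷ (240 , 240 ∷ 243 ∷ 245 ∷ 250 ∷ []) ∷
  (243 , 243 ∷ 245 ∷ 250 ∷ 252 ∷ []) ∷ (245 , 245 ∷ 250 ∷ 252 ∷ 256 ∷ []) ∷
  (250 , 250 ∷ 252 ∷ 256 ∷ 270 ∷ []) ∷ (252 , 252 ∷ 256 ∷ 270 ∷ 280 ∷ []) ∷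
  (256 , 256 ∷ 270 ∷ 280 ∷ 288 ∷ []) ∷ (270 , 270 ∷ 280 ∷ 288 ∷ 294 ∷ []) ∷
  (280 , 280 ∷ 288 ∷ 294 ∷ 300 ∷ []) ∷ (288 , 288 ∷ 294 ∷ 300 ∷ 315 ∷ []) ∷
  (294 , 294 ∷ 300 ∷ 315 ∷ 320 ∷ []) ∷ (300 , 300 ∷ 315 ∷ 320 ∷ 324 ∷ []) ∷
  (350 , 350 ∷ 360 ∷ 375 ∷ 378 ∷ []) ∷ (405 , 405 ∷ 420 ∷ 432 ∷ 441 ∷ []) ∷
  (480 , 480 ∷ 486 ∷ 490 ∷ 500 ∷ []) ∷ (560 , 560 ∷ 567 ∷ 576 ∷ 588 ∷ []) ∷
  (648 , 648 ∷ 672 ∷ 675 ∷ 686 ∷ []) ∷ (750 , 750 ∷ 756 ∷ 768 ∷ 784 ∷ []) ∷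
  (864 , 864 ∷ 875 ∷ 882 ∷ 896 ∷ []) ∷ (1000 , 1000 ∷ 1008 ∷ 1029 ∷ 1024 ∷ []) ∷
  (1152 , 1152 ∷ 1176 ∷ 1200 ∷ 1215 ∷ []) ∷ (1344 , 1344 ∷ 1350 ∷ 1372 ∷ 1400 ∷ []) ∷
  (1568 , 1568 ∷ 1575 ∷ 1600 ∷ 1620 ∷ []) ∷ (1875 , 1875 ∷ 1890 ∷ 1920 ∷ 1944 ∷ []) ∷
  (2160 , 2160 ∷ 2187 ∷ 2205 ∷ 2240 ∷ []) ∷ (2500 , 2500 ∷ 2520 ∷ 2560 ∷ 2592 ∷ []) ∷
  (2880 , 2880 ∷ 2916 ∷ 2940 ∷ 3000 ∷ []) ∷ (3360 , 3360 ∷ 3375 ∷ 3402 ∷ 3430 ∷ []) ∷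
  (3888 , 3888 ∷ 3920 ∷ 3969 ∷ 4000 ∷ []) ∷ (4480 , 4480 ∷ 4500 ∷ 4536 ∷ 4608 ∷ []) ∷
  (5184 , 5184 ∷ 5250 ∷ 5292 ∷ 5376 ∷ []) ∷ (6000 , 6000 ∷ 6048 ∷ 6075 ∷ 6125 ∷ []) ∷
  (6912 , 6912 ∷ 7000 ∷ 7056 ∷ 7203 ∷ []) ∷ (8000 , 8000 ∷ 8064 ∷ 8100 ∷ 8232 ∷ []) ∷
  (9216 , 9261 ∷ 9216 ∷ 9375 ∷ 9408 ∷ []) ∷ (10752 , 10752 ∷ 10800 ∷ 10935 ∷ 10976 ∷ []) ∷
  (12500 , 12500 ∷ 12544 ∷ 12600 ∷ 12800 ∷ []) ∷ (14400 , 14406 ∷ 14400 ∷ 14580 ∷ 14700 ∷ []) ∷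
  (16800 , 16807 ∷ 16800 ∷ 16875 ∷ 17010 ∷ []) ∷ (19440 , 19440 ∷ 19600 ∷ 19683 ∷ 19845 ∷ []) ∷
  (38880 , 38880 ∷ 39200 ∷ 39366 ∷ 39375 ∷ []) ∷ (77760 , 77760 ∷ 78125 ∷ 78400 ∷ 78732 ∷ []) ∷
  (155520 , 155520 ∷ []) ∷ (311040 , 311040 ∷ []) ∷ (622080 , 622080 ∷ []) ∷ (1244160 , 1244160 ∷ []) ∷
  (2488320 , 2488320 ∷ []) ∷ (4976640 , 4976640 ∷ []) ∷ (9953280 , 9953280 ∷ []) ∷
  (19906560 , 19906560 ∷ []) ∷ (39813120 , 39813120 ∷ []) ∷ (79626240 , 79626240 ∷ []) ∷
  (159252480 , 159252480 ∷ []) ∷ []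

runs₁ : List Run
runs₁ =
  (3 , 1 , 105 , 0x105851C401037E20567F75B5D30168) ∷ (3 , 1 , 210 , 0x105851C401037E20567F75B5D30168) ∷
  (4 , 1 , 240 , 0x1037E2106889A60206FC40AD02E3F60CAC84) ∷ (4 , 1 , 240 , 0xC29E98104819E2040DF88000016F9FC42C84) ∷
  (4 , 1 , 105 , 0x1037E200081BF50EFCAC7948DED480) ∷ (3 , 1 , 150 , 0x81BF10104819E2040DFC8EFC55FA4BB1DE40) ∷
  (4 , 1 , 150 , 0x1037E200081BF1010482F8933FD480) ∷ (4 , 1 , 240 , 0x1037E200081BF1030AD0DFE1DC0800) ∷
  (4 , 1 , 240 , 0x1037E200081BF101042CBB0F10AD40) ∷ (4 , 1 , 150 , 0x106889A60000000000AD14DD132480) ∷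
  (4 , 1 , 150 , 0x105851C4040DFC8EFC560EFFC1A480) ∷ (4 , 1 , 150 , 0x1037E20000001037E60E0E22486480) ∷
  (4 , 1 , 240 , 0x1037E20000001037E60E0E22486480) ∷ (3 , 1 , 115 , 0x10B9A1101037E2081D4B13D04F38C0) ∷
  (3 , 1 , 115 , 0x10B9A1101037E2081FFEF9BDF57700) ∷ (4 , 1 , 150 , 0x1078C1881037F237E35A3E7ECBD240) ∷
  (4 , 1 , 115 , 0x123EDE4040E04AA6C429E787886800) ∷ (3 , 1 , 115 , 0x81BF1013425C6040DFC8DF8D6DB866A9A480) ∷
  (4 , 1 , 105 , 0x81BF10113B6020000040DF92D557CA929800) ∷ (3 , 1 , 105 , 0x40DF881037E201037E20081BF1AD554AFA20) ∷
  (4 , 1 , 105 , 0x113B6021037E60DF92E58BD8079C80) ∷ (4 , 1 , 105 , 0x30A7A6040DFB8A9B10A63C6E821600) ∷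
  (4 , 1 , 105 , 0x1038E6DDC7BDF17EA80) ∷ (4 , 1 , 105 , 0x1037E2040DFA871CDB5E52F8D93000) ∷
  (4 , 1 , 180 , 0x1037E2040DFA871CDB5E52F8D93000) ∷ (4 , 1 , 105 , 0x81BF3072D12E8A54E20DCE0) ∷
  (4 , 1 , 105 , 0x1037E20C29E980104DD9B246DC0860) ∷ (4 , 1 , 105 , 0x30A7A60C29EC8A8A9839DABA6D6C60) ∷
  (4 , 1 , 105 , 0x1037E20C29EA837E200185B3752480) ∷ (4 , 1 , 105 , 0x91F6F21037EA1C736C6555008EF8E0) ∷
  (4 , 1 , 170 , 0x51176A1037E60E39B617C6BEE8A860) ∷ (4 , 1 , 125 , 0x1037E281BF1C29E980010719367C80) ∷
  (4 , 1 , 125 , 0x1037E20000081BF2042C240B9F9480) ∷ (4 , 1 , 105 , 0x82C28E240DF8C0EFE0521B660A75C80) ∷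
  (3 , 1 , 125 , 0x82C28E240DF9429E980000F553F3C80) ∷ (4 , 1 , 105 , 0x1037E240DF8800030BD45D88A1C800) ∷
  (4 , 1 , 135 , 0x207FFBE2C29EB873D5030B5B76BDCD40) ∷ (4 , 1 , 105 , 0xC2AECFE406FC4000082C3E81D816DE80) ∷
  (4 , 1 , 105 , 0x30A7AA0EFBFE2000040EBB1E995B65F09B480) ∷ (4 , 1 , 105 , 0x103812A8A97E3037F23864004607720DE4260) ∷
  (4 , 1 , 105 , 0x1037E50A7A60041A2D915C3D2BE740) ∷ (3 , 1 , 135 , 0x1037E201037E50A7B637E2821B240384CAAC0) ∷
  (3 , 1 , 135 , 0x103812A8A97E2000103AEC7A6AE9ADC9F1900) ∷ (3 , 1 , 105 , 0x1037E201037E200030A8A9BEFFB3623E40300) ∷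
  (4 , 1 , 105 , 0x1037E2000000000C403A921CCF9580) ∷ (4 , 1 , 105 , 0xC29F9B7E200040E395F9E4D2E2691BE40) ∷
  (4 , 1 , 105 , 0xC29F9B8026FC80E39800DC5D5A7704000) ∷ (4 , 1 , 105 , 0xC29F9B7F237E2000020707713B98E3E40) ∷
  (4 , 1 , 105 , 0x1037F237E20000104D8844CE2399E0) ∷ (4 , 1 , 115 , 0x1038A49F9B8026FC40000206FC97E81997060) ∷
  (4 , 1 , 150 , 0x1037F238026FE471CAFC9A958A9364F060) ∷ (4 , 1 , 105 , 0x103822DFA871CB0C793D6D32F8B000) ∷
  (4 , 1 , 105 , 0x1038A49E9802072CE7BE698549B260) ∷ (4 , 1 , 105 , 0x1037E200C29F9B7F33B617ABDED800) ∷
  (4 , 1 , 105 , 0x40DF9839E8FCC1C0137F2E50D937F83300) ∷ (4 , 1 , 105 , 0x81BF2037E20040E292FC1F117425EC1500) ∷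
  (4 , 1 , 125 , 0x30A7A7037E20206FE4A06CB49057B134380) ∷ (4 , 1 , 105 , 0x206FC503BEFFB8A7B63864C28E2E9161200) ∷
  (4 , 1 , 105 , 0x1037E200000000081BF6692E6018C0) ∷ (4 , 1 , 105 , 0xC29E9905851D029E988243887460D02BE00) ∷
  (3 , 1 , 105 , 0x1037E20C29ED8E009C47C03F981A00) ∷ (4 , 1 , 125 , 0x81BF1106889B229ED96187EF896D608B480) ∷
  (4 , 1 , 105 , 0x81BF11037E20C29E98C3230C0FD9069F000) ∷ (4 , 1 , 105 , 0x1037E2000000041640BF2B4B77D000) ∷
  (4 , 1 , 105 , 0x1037E2081BF1000001853DA3564680) ∷ (4 , 1 , 105 , 0x81BF11078C188000030C8429EA2E1ED7A00) ∷
  (4 , 1 , 105 , 0xC29E99078C18801038E5890AF3D19D11000) ∷ (4 , 1 , 105 , 0x1037E2001037E200010440EF3FFD83AF6E1060) ∷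
  (4 , 1 , 115 , 0xC29E99037E200010440CEDAB258954F0900) ∷ (4 , 1 , 115 , 0x1037E2001037E281BF1000207582E2F6228C80) ∷
  (4 , 1 , 135 , 0x103FFDF1113B60E29F9BBF31332A4AB8A26800) ∷ (4 , 1 , 105 , 0x103FFDF1123EDE80E08BFFFF863036BF219100) ∷
  (4 , 1 , 115 , 0x1853D300010688A69A8016AAFCE580) ∷ (4 , 1 , 105 , 0x1037E20030A7A7037E200040DF89704ACA6100) ∷
  (4 , 1 , 105 , 0x40DF88000000000030A7E9A4118E9D6BD80) ∷ (4 , 1 , 105 , 0x103822EFE11726CC57055BC80) ∷
  (4 , 1 , 105 , 0x1037E2000000030A7A62070487888997705E80) ∷ (4 , 1 , 105 , 0x106889A6000000002071CF0A651B08BD9F03C0) ∷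
  (4 , 1 , 105 , 0x105851C41037E2002071CF126B6EFA1D7CEA60) ∷ (4 , 1 , 105 , 0x1037E2000000081BF1010BA6534048C466EB60) ∷
  (4 , 1 , 105 , 0x1037E20051178A6FC400081CA3BD7880B74200) ∷ (4 , 1 , 105 , 0x206FC41037E20000081FFF08C8323661A5E0) ∷
  (4 , 1 , 105 , 0x1037E21037E2000000043EA08764EE4C9800) ∷ (4 , 1 , 105 , 0x106889A61037E20000082C3A1DBC4F6C6D7060) ∷
  (4 , 1 , 105 , 0x105851CC2C28E20000082C28ECE0654460F200) ∷ (4 , 1 , 115 , 0x1037F24819F23FFE116FC415A5407AFE3A00) ∷
  (4 , 1 , 115 , 0x81CF4863C72C31DF8C4F041FEE70DD40) ∷ (4 , 1 , 115 , 0x1037E2103863BF1081BF4CD1BAD5C856BE80) ∷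
  (4 , 1 , 105 , 0x1038E57E21037E20010441E30BDA80) ∷ (4 , 1 , 105 , 0x40EFC1E90C77E2000206FC443A3BC99DD61800) ∷
  (4 , 1 , 105 , 0x1038E5FFDF10207FFC67CD4A54E9ED000) ∷ (4 , 1 , 115 , 0x411031AD0C77E2040DFA87FFD4726A50571000) ∷
  (4 , 1 , 115 , 0x81BF11038E57E2000206FF56A5513FCAEC5960) ∷ (4 , 1 , 105 , 0x2072CE8AA819E200030E9121C7AF06F54A00) ∷
  (4 , 1 , 105 , 0x81BF181C0137E240E7A500AB145A555114B100) ∷ (4 , 1 , 105 , 0x105851C4000000020801F14E9DF260) ∷
  (4 , 1 , 105 , 0x41A22AA608D851C40C29F5AAED5754C3D9FC80) ∷ (4 , 1 , 105 , 0x1037E240E7A3F92F335F9634C7E800) ∷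
  (4 , 1 , 105 , 0x81BF101037E200081DFC2AA844568DF86C80) ∷ (4 , 1 , 105 , 0x81FFFFBFF278C28B7E243EB46C4137BCCFD000) ∷
  (4 , 1 , 105 , 0x30A7B6B9A110103C1088B3D5929B459000) ∷ (4 , 1 , 105 , 0x412077BFF278C28BAECFF2B0FE3A2C3B1C9800) ∷
  (4 , 1 , 150 , 0x103FFDF10123EDF43FFE76D1187FE4BCEBA2800) ∷ (4 , 1 , 115 , 0x4161472037E60EBB2F9284B0DBAF09A82C80) ∷
  (4 , 1 , 135 , 0x81BF223EE24E3970014B635C50881490C0) ∷ (4 , 1 , 115 , 0x43EA027037E2030A7A600827586169B8B800) ∷
  (4 , 1 , 105 , 0x10440BE981C61CB830D87E6E98868E96F3BBA00) ∷
  (4 , 1 , 115 , 0x10444CC909037E2081EFB7A6040EE66EF344000) ∷ (4 , 1 , 105 , 0x4D097180002077E2FB7E8EA9D1E16392E000) ∷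
  (4 , 1 , 105 , 0x4D09719037E20C29E980209C0CD7E47A3480) ∷ (4 , 1 , 105 , 0xC29E98000000081BF1041E306B7645027CE0) ∷
  (4 , 1 , 105 , 0x40DF8A06FC40C2CF70908F3DA5AF8994CE0) ∷ (4 , 1 , 105 , 0x103C71B79000010440CF0089A8C50B329BFB000) ∷
  (4 , 1 , 105 , 0x103822E7A7FF08E89F5CD230502000) ∷ (4 , 1 , 105 , 0x104819E20D2D77D7E20042EEA03669BC2A06800) ∷
  (4 , 1 , 105 , 0x106889A6051176A000C3205B2371B2ECBD65000) ∷
  (4 , 1 , 105 , 0x1037E200113B602C2AAC1EA43A2CE618F932800) ∷
  (4 , 1 , 105 , 0x209074A3C9E3062C29EA4ED8B97D6997D64F000) ∷
  (4 , 1 , 105 , 0x10694C4499037E2C29E98020A2068F3A124F000) ∷ (4 , 1 , 115 , 0x1078C28C819E281CF47EE3B2A027CE2BFD000) ∷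
  (4 , 1 , 135 , 0x40EFBFE60EFD019E240E08F9852CDFD82109000) ∷
  (4 , 1 , 105 , 0x4100798311037E20041216B0E4CD7417F82B000) ∷ (4 , 1 , 105 , 0x81BF11037E406FC410FC47164BCD649B100) ∷
  (4 , 1 , 105 , 0x4110B165110481BE8FC410BA63BF137945AB100) ∷
  (4 , 1 , 105 , 0x40E009BF1104819E2020803D02678C855C72800) ∷ (4 , 1 , 105 , 0x32AEA241037E60DFB8BAE92203AD588BEA200) ∷
  (4 , 1 , 105 , 0x30A7C670CF9A522088183408ED837CF686800) ∷ (4 , 1 , 125 , 0x31AB24210B9A92FFFFD01A6813687D1301000) ∷
  (4 , 1 , 105 , 0x4100FB422113B90C7B22AAC3F0D31FC93FA3800) ∷ (4 , 1 , 105 , 0x13431EFF9B8026FC80E7A3F4B78C8B5B69800) ∷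
  (4 , 1 , 105 , 0x40E18FBEDF9B7E2000C2E38581DA5433A29F800) ∷
  (4 , 1 , 105 , 0x41103027C023B90C7A60041103A771DA6F39900) ∷
  (4 , 1 , 105 , 0x4122718EBB63812A7B63AECAB6C06B6C1B63000) ∷ (4 , 1 , 105 , 0xC29F9B8027004DFA8F18330B509B111140800) ∷
  (4 , 1 , 105 , 0x41624B919E200000020F1831018AA7DE9AAD000) ∷ (4 , 1 , 105 , 0x81C72BF1001037E63EB0622504A3A2F6BA800) ∷
  (4 , 1 , 105 , 0x2077E031DF8802073D616B06A30E46083E7FE900) ∷
  (4 , 1 , 125 , 0x81C72BF40A9AD3D229481AF89ACB4A95968C0) ∷
  (4 , 1 , 105 , 0x10441C2162206FC5037E2208081590AF12212000) ∷
  (4 , 1 , 105 , 0x103FFDF100000C29E9820A09D93638F437A9D800) ∷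
  (4 , 1 , 105 , 0x1040060CF151176A00031296557A78047CA73800) ∷
  (4 , 1 , 115 , 0x103C7DE17A93C63AE99842719EFB8B5A82603000) ∷ (4 , 1 , 105 , 0x4D0971905851CC1BFD2DF78E35376CB36800) ∷
  (4 , 1 , 105 , 0x89DB051E6109A6000C2A04F3FABBE7CD0800) ∷ (4 , 1 , 105 , 0x1037E60E08C84A89AE1FFEF88B51B342042D1000) ∷
  (4 , 1 , 105 , 0x104418136990B9B1500EAAA11001A04A65F64800) ∷
  (4 , 1 , 105 , 0x10441813699078D1BFF278E21C4227470A391800) ∷
  (4 , 1 , 105 , 0xC72E4F910B9A12039E91CD91511183FB9D800) ∷
  (4 , 1 , 105 , 0x20A06FB3F89037E28200F3C8C8E0C50CEBDD0000) ∷ (4 , 1 , 105 , 0xCEC8819037E281FFEFC8FBFF6C1CE9201000) ∷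
  (4 , 1 , 105 , 0xCEC88193427D5205D69C2FE5FB3913F80000) ∷ (4 , 1 , 105 , 0x10BDB00C0F5BE21FF29688872BB62EBFF49800) ∷
  (4 , 1 , 115 , 0x30F4AF719853D4058620C1A64169352E81E800) ∷
  (4 , 1 , 115 , 0x410038A388206FC4040DFC8E8A774DEAF8A9B000) ∷
  (4 , 1 , 105 , 0x20BCCD71800105914E4674C323261A83595800) ∷ (4 , 1 , 105 , 0x2077E3FF08B7E50A868CF605ABC58231431800) ∷
  (4 , 1 , 105 , 0x411037C1F130ABB7070C69830AADB3EF44255000) ∷
  (4 , 1 , 115 , 0x410038B3C0028004062D63DAAC687B7C84B7B800) ∷ (4 , 1 , 105 , 0x40DF8800103BEFF8820B3AF77A0D409B2100) ∷
  (4 , 1 , 115 , 0xE30E5C206FC81614720FB858B87FE8BC1000) ∷ (4 , 1 , 105 , 0x238AB7225AD68A58D38F3EDAACB47CA5CE2000) ∷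
  (4 , 1 , 105 , 0x4103127642D2D68A48DC80A42A4B8F37178AA000) ∷
  (4 , 1 , 105 , 0x40F0D3980210483A936626A05CE0C3597957A800) ∷
  (4 , 1 , 105 , 0x217342E3AA3211103864C392E38BF9A6A4000) ∷ (4 , 1 , 105 , 0x206FC401078D242A48E3272ACD368909F6800) ∷
  (4 , 1 , 105 , 0x247DCCC819F23BF008D8848AF784C156F000) ∷ (4 , 1 , 105 , 0xC4CA123D70C3A207145963C6A593CAFC0ED800) ∷
  (4 , 1 , 105 , 0x41A53523630A97E516A449C907E93306E667B900) ∷
  (4 , 1 , 105 , 0x412077C1E90C78E58A49E9C958D8186DD7E39800) ∷
  (4 , 1 , 105 , 0x416471FA24113B60281BF5D0973DDD3963F99000) ∷
  (4 , 1 , 135 , 0x1037E447DBC800C2DFB99BBF016035F7B15DD5800) ∷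
  (4 , 1 , 125 , 0x103BEFF8B0A7A6C320D8CF2038A4F599D34462000) ∷
  (4 , 1 , 115 , 0x10380476C0400207C1E943299B049165DF3879800) ∷
  (4 , 1 , 115 , 0x10440CED1E92D1855E262CF2AA9220E791B3D6800) ∷
  (3 , 1 , 125 , 0x104444AD98BF10021326EC2328EF6D95A7EF45800) ∷
  (4 , 1 , 105 , 0x104444ADD9A0A105474A798449D7879EF33340000) ∷
  (4 , 1 , 105 , 0x104036B4D7DF88010FA84A5FCB19EAC6E98CB5800) ∷
  (4 , 1 , 125 , 0x104444AD170002080BE88B703988342C0EE7ED000) ∷
  (4 , 1 , 105 , 0x1040C8AC8C833177D427CDF18D45258DA8F0F2800) ∷
  (4 , 1 , 105 , 0x1038ACBD937B6FA83A28A9FFE12A03D37F0A3B000) ∷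
  (4 , 1 , 105 , 0x103826EF87FF06A0572129DF7132A9E318BF52000) ∷
  (4 , 1 , 105 , 0x1068CAC667C9F33E02081CB7B5B09D24451C91000) ∷
  (4 , 1 , 115 , 0x1048DCCDA1B3839653D029E988FF564E486119000) ∷
  (4 , 1 , 105 , 0x1037EB3FDEE5037EA1CF47E63EA28D59A70E76800) ∷
  (4 , 1 , 105 , 0x1048E5C076E5037E2000041614F2CE55FCF4F0800) ∷
  (4 , 1 , 105 , 0x1048671C295FA89E7730802C9B533E29DEC1B8800) ∷
  (4 , 1 , 105 , 0x1068D2E258890588273C505A98B74C809AA9E9000) ∷
  (4 , 1 , 105 , 0x10386C9DAFD2EE815C41246FA3E30C8C5E72E3000) ∷
  (4 , 1 , 105 , 0x1068D7F3CF28030C815C5089BD4FDA5EF39066800) ∷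
  (4 , 1 , 105 , 0x1058D5085D6AEF85DEA0DF48A54F771D26076F000) ∷
  (4 , 1 , 105 , 0x313755163B0A7D6A7A6010BCAC37F1317BF9800) ∷
  (4 , 1 , 105 , 0x30ED1580729694832CE139A2BEF70DDA1371000) ∷
  (4 , 1 , 105 , 0x41003E779D39079026B9A0688D44EA3ECDAF0D800) ∷
  (4 , 1 , 135 , 0x310A3A2B7441759B8ACBFB31D2DEA33D8E48000) ∷
  (4 , 1 , 115 , 0x81F2F40CE598BB24200020F18C2FC5DC169482800) ∷
  (4 , 1 , 105 , 0x81DFB16F2461E3C8BE99342DE1F21EABC95610800) ∷
  (4 , 1 , 105 , 0x20A16F24A2C28E2C2C00FD2EB57963F3DE12000) ∷
  (4 , 1 , 105 , 0x81C1386F852BA1586A89FBC6FC7028FB3180D4800) ∷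
  (4 , 1 , 105 , 0x1253241A9476842D7EC1B6B478550FBE2C8000) ∷
  (4 , 1 , 105 , 0x43F25F3CB1EA837E28240CF50EA8A03BDE1C800) ∷
  (4 , 1 , 105 , 0x850310A5D2EE818CF82F6AF12EAD5547223D800) ∷
  (4 , 1 , 105 , 0x82031AB33432B2817CE15EFCC6FA17657F5DF1000) ∷
  (4 , 1 , 115 , 0x43F21E6137E406FC71194E1056C877B74200000) ∷
  (4 , 1 , 105 , 0x441DB4A0D0CF9A9343EA14E2B6827F053D30000) ∷
  (4 , 1 , 105 , 0xC3BF7B8A10CF9A9384D983EB40A5E401CD52000) ∷
  (4 , 1 , 105 , 0x411E608BC10B9A9342033712CEC27BA620A8000) ∷
  (4 , 1 , 105 , 0x103C125F0C6C09BB602C6EE3F231E2A91911EE8000) ∷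
  (4 , 1 , 105 , 0x103C23DF5E1A823B90D088A6732DC8C9139CB21800) ∷
  (4 , 1 , 105 , 0x10381441312A91376E8204F633061A979032341000) ∷
  (4 , 1 , 115 , 0x10380600138C9D28E209238544C9520D0FC7AA2000) ∷
  (4 , 1 , 115 , 0x103867ED78646FC40028BC5CAE34F32E73491F5000) ∷
  (4 , 1 , 105 , 0x1038B14E4E8890386440DF47EE404C145AFE480000) ∷
  (4 , 1 , 105 , 0x1038A8CD00440000C3616745C328040B9DD8E48000) ∷
  (3 , 1 , 135 , 0x10585E702D59AAD0C840BFA111ADE136DFCF111000) ∷
  (4 , 1 , 105 , 0x1037E2B268BD2CEAB14191603028C40B80C27E8000) ∷
  (4 , 1 , 105 , 0x85DF4A68EB13D1F99CB9B9B5B95EDA8B480000) ∷ (4 , 1 , 105 , 0x445B898E004110A14DC272A5059E132C80000) ∷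
  (4 , 1 , 105 , 0x84C9BB08A9BF1042B4DE56561B6BE24900000) ∷
  (4 , 1 , 105 , 0x105899BBFBE4112AAA45CED58F1FD0CE2B889E0000) ∷
  (4 , 1 , 105 , 0x10591870908010481B674964927B302A6082E58800) ∷
  (4 , 1 , 105 , 0x105920A4D96924D9CB0747110FA81327A4740C0000) ∷
  (4 , 1 , 105 , 0xD0E3CBB6916FC8D09F36FB8AA81AE57E200000) ∷
  (4 , 1 , 115 , 0x3129F2FD382056B3CFF1BF738AFE0EF9F1748000) ∷
  (4 , 1 , 105 , 0x81E00599247100C2C21E99B7DB8F91094C37F00000) ∷
  (4 , 1 , 105 , 0x207D7B52D902B0D5335511A5076DB28019548000) ∷
  (4 , 1 , 105 , 0xAF9E3F17EF0D5436F4471A98BFD09E299C800) ∷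
  (4 , 1 , 115 , 0x81C0480726D99CAFD53BA10C382A3CD9E8FD5A8800) ∷
  (4 , 1 , 105 , 0x2299F9A1E29BD376D9AF83D20741C66866D48000) ∷
  (4 , 1 , 105 , 0x219651EFA53422294F89880DEE39CBAC00000000) ∷
  (4 , 1 , 115 , 0x23AAE9117DF05F23308BC1EC9461A007AA369000) ∷
  (4 , 1 , 105 , 0x30ACB7F8A1F6A4BFFD9866D704C33F300000000) ∷
  (4 , 1 , 105 , 0x84EA0A5BE63EA343C0DFA1E10DB8222369599000) ∷
  (4 , 1 , 105 , 0x81E0529E87F8843EA027142FB6B399EC50378800) ∷
  (4 , 1 , 105 , 0x411033B3F8A073E54303FB849DF7AAEE66A68000) ∷
  (4 , 1 , 105 , 0x8282DF8AD023029044083FDCB0902541D19AC00000) ∷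
  (4 , 1 , 105 , 0x41144E0709B658723FF0F98DA5F157F7829A0000) ∷
  (4 , 1 , 105 , 0x32AFA8C89D7DBCBC6227ADA7AC41805A2FC8000) ∷
  (4 , 1 , 115 , 0x30DC8C46260081BF2B601BABF66E8CBB950800) ∷
  (4 , 1 , 125 , 0x206FF800F3FC3DBFC7F2926A406FF6C1405C0AC8000) ∷
  (4 , 1 , 105 , 0xC3A39C1FCFABB622704AD494A0AC2A5284010000) ∷
  (4 , 1 , 105 , 0x33E623984DCE6910A870A70E5C002B3FB000000) ∷
  (4 , 1 , 105 , 0x30B1A87D7C0CACB43A4925EA841F10073548000) ∷
  (4 , 1 , 105 , 0x30A7AE7D812E937FE72F666E1C695993D9A36A68000) ∷ []

runs₂ : List Run
runs₂ =
  (4 , 1 , 105 , 0x4989AF03B4403BECD07E76D71BC20487CE000000) ∷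
  (4 , 1 , 105 , 0x30A8344433DF5E0A3F5CED1754A128FA53C1B3E0000) ∷
  (4 , 1 , 115 , 0x30B04884335172278C7491C54C614D159F9DEB00000) ∷
  (4 , 1 , 115 , 0x89E35ED406438A876D48E690F74F55722150800) ∷
  (4 , 1 , 105 , 0x30D84DFF335B055560A2A111845E31A91C410A40000) ∷
  (4 , 1 , 105 , 0x10C6C0060B5FAE9DF17376D8E4D05B18076028800) ∷
  (4 , 1 , 105 , 0x20FE1B35545AF3718ABAD75295E5A70239AA40000) ∷
  (4 , 1 , 105 , 0x1038790868E0EEBD280C01A9FA945AB2418A90800) ∷
  (4 , 1 , 105 , 0x30C81F141747C034F36E1F66CFB930ACFFCAB368000) ∷
  (4 , 1 , 105 , 0x20B0AFB1E980020708EBF1CD0DF98B031C626C800) ∷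
  (4 , 1 , 105 , 0x53B05D32114BB8BED2C7E461CC28FAAAA40000) ∷
  (4 , 1 , 105 , 0x30EED340570237A5ECFCC200724CEB9BD9AA40000) ∷
  (4 , 1 , 125 , 0x81DF8FF4CB9429AE4A55F7A99D407B1C172133E0000) ∷
  (4 , 1 , 125 , 0x40EFCB5B89C64C2DF77A8841629C2304A6CAB480000) ∷
  (4 , 1 , 115 , 0x40FFF92AD66F7D23A22B49918A272F81505C1548000) ∷
  (4 , 1 , 115 , 0x40EFE440585692BF20688A482EDC1EA4FB000000000) ∷
  (4 , 1 , 125 , 0x41001B68DD3BEE25B4D44A3A06CFFBC481B74200000) ∷
  (4 , 1 , 125 , 0x81EFB991AA1D8E01AEE1C93CB45268B678874EE9000) ∷
  (4 , 1 , 115 , 0x2096FB1F76020B115A28A458B28E869EFD520000) ∷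
  (4 , 1 , 115 , 0x41010E152CD9F3F8C11C6BA24C7CD247CD3309C8000) ∷
  (4 , 1 , 105 , 0x41002AB381D8451071435172D8BD394804554B20000) ∷
  (4 , 1 , 115 , 0x23B4D84EA51C8ED606FD548DEAC8DE75DB4A8000) ∷
  (4 , 1 , 105 , 0x40FFF98A1DBBAEC7A844134EFB831347F824D6C0000) ∷
  (4 , 1 , 105 , 0x81E1AA6A23ABCFFE52720B22B566701F50188000000) ∷
  (4 , 1 , 105 , 0x33D2AC86DFB9CA149136E9B6B2472D6F5FBCD0800) ∷
  (4 , 1 , 115 , 0x41627F5F1CFE09B007BE238FCBC42E74FC61A040000) ∷
  (4 , 1 , 105 , 0x8284C212631AFF8D20DC30E22BA5E46F7C042B20000) ∷
  (4 , 1 , 105 , 0x3CDCB69DC8BCFD55BEC4C0135B51D5718720000) ∷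
  (4 , 1 , 105 , 0x41635EAA01A5C2E22928BABB4A707AB66FD5DF60000) ∷
  (4 , 1 , 135 , 0x2078017702BE55A58D38F0C579E4F878683AB0000000) ∷
  (4 , 1 , 135 , 0x2073F664C0740E409B6DBE3EF3B14CA55517CE000000) ∷
  (4 , 1 , 125 , 0x81FEE7FCEBC1D312B3CC9B75EFB38598879368000) ∷
  (4 , 1 , 125 , 0x207C1057E3A027D4758E6A3F740CFBEAF9FF4D520000) ∷
  (4 , 1 , 125 , 0xC4E8C3C0BD84CB1741F0A22B008CADFF2EA900000) ∷
  (4 , 1 , 135 , 0xCB9D15DE92269822F9470226E8EEAE46BD620000) ∷
  (4 , 1 , 150 , 0x41AFE702F2CABE080FD13E119B30322EED39F0800) ∷
  (4 , 1 , 125 , 0xC6FB91BA3F306441C227DB451F800C56257600000) ∷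
  (4 , 1 , 125 , 0x30B45A0522BF1C49ACBA6743300815CACEBD0CB88000) ∷
  (4 , 1 , 115 , 0x820D65EB19030B4B43259E48C44545C0B7E000000) ∷
  (4 , 1 , 105 , 0x8E6DF4B89F54175DC67A45F263E5C851CDEB48000) ∷
  (4 , 1 , 115 , 0xC73591D3F72CADAE6C47DB24D681A2F2583728000) ∷
  (4 , 1 , 105 , 0x85DC86225FF40402177597B37346BB34096A90000) ∷
  (4 , 1 , 115 , 0x20A0ED718B45D780944767DCFA57FB0AD8B571548000) ∷
  (4 , 1 , 115 , 0x30B5E324711A9599B603BF3A287E10BC01CEEC1000) ∷
  (4 , 1 , 115 , 0x2080063D823B73E23F916FD6DAC283DDD1BF6DA40000) ∷
  (4 , 1 , 115 , 0x30C8978E07CAB66297584EDFE4F3E9A71D580D588000) ∷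
  (4 , 1 , 115 , 0x40F04ED28599837E303826F2991017CDC2D43BDA8000) ∷
  (4 , 1 , 125 , 0x81CFCAA633EE97EA4BEEF1B9B3AD3BDB60BCF3800000) ∷
  (4 , 1 , 135 , 0xC2BF0A43A83CB584AB7E2870D58A310F3DBA1D3E0000) ∷
  (4 , 1 , 135 , 0xC2AED3A9962BDDF8FE31C64D2F1AFAE2A8288D480000) ∷
  (4 , 1 , 135 , 0xC2BFDD91304FB873E2AF9481FB1A3C6A6582AB480000) ∷
  (4 , 1 , 135 , 0xC2BFDB946B82B134210B1B8FF130E4B46C1DB4080000) ∷
  (4 , 1 , 135 , 0x81E013F7320B6BC088FACA242AF5AD1472DB69500000) ∷
  (4 , 1 , 135 , 0x32B89589182008E0259087B79E381C653F1548000) ∷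
  (4 , 1 , 125 , 0xC2B108B853ED703EDB3CBFC93C7A77B9A7A5EA218800) ∷
  (4 , 1 , 125 , 0x104C0D982502E678D575AFB219CCDF4AA53F668000) ∷
  (4 , 1 , 135 , 0x41001B510F48B5EE9FE4BED8EFEE7BF84E6FFE000000) ∷
  (4 , 1 , 125 , 0x1345C3308A39AA5FDD821C3F8EA060C7A0009C8000) ∷
  (4 , 1 , 125 , 0x30C84A9609732EB3DA519B7431EC03C11536A68000) ∷
  (4 , 1 , 115 , 0xC2AED254F0825315D6B9E77CD98D6B1D7137FB548000) ∷
  (4 , 1 , 115 , 0xC2D065391755FAC46FF6C09CCA287A16FCA236A68000) ∷
  (4 , 1 , 125 , 0x820228295857ECF02CBCA663F8EE948EE038F2B48000) ∷
  (4 , 1 , 115 , 0xC3216F1261A6C893B2C435FCE3CF33C6995F3FF60000) ∷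
  (4 , 1 , 125 , 0xC2E1A38E1F5E5047D38DECEC19EC19796F6DD14A8000) ∷
  (4 , 1 , 115 , 0x4121A8CF03C9CA78C29B8D5D7FB7A98281F633E48000) ∷
  (4 , 1 , 125 , 0x14520797CE1AC6F3FB44636EF99BA8ED8726E5BE48000) ∷
  (4 , 1 , 125 , 0x4163648642EC523EE37A43340BD394B5A3B073548000) ∷
  (4 , 1 , 150 , 0x40E1901BD32A16B61DB3BF67972A00EC23AD80000000) ∷
  (4 , 1 , 150 , 0x144E09139E041E5983598D3FE138A84F7507536A68000) ∷
  (4 , 1 , 135 , 0x2485F901249FFCBE74C332DAD01D2F1040DFAC0A68000) ∷
  (4 , 1 , 135 , 0x34B9DD22119E13D53532DBAD79A2EEE8492C2B6A68000) ∷
  (4 , 1 , 135 , 0x2485F9520B53CCB8B4DBEA2918559A1BE4F15E9548000) ∷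
  (4 , 1 , 135 , 0x144A1184474C6FB586D83388F2ACD0134D16576CD0800) ∷
  (4 , 1 , 135 , 0x34B5D7A23F283A5B222829E2ED64E631C9BC1261C8000) ∷
  (4 , 1 , 135 , 0x14460362D16BD3A089E2264900D5C4EECEB9D66A68000) ∷
  (4 , 1 , 125 , 0x144A015854AA8DF3BA1186E82E2CF82089EC266D48000) ∷
  (4 , 1 , 135 , 0x14520488A8B01FF73FB851A926BA9634FDCCE66D48000) ∷
  (4 , 1 , 125 , 0x34B5AAFA41AA45670A64A0BA5580DD76A3B5D80CD0800) ∷
  (4 , 1 , 125 , 0x41294682376AE630F8EE00561F4B21DC456F2B480000) ∷
  (4 , 1 , 125 , 0x1445DDC3450FA38EDAD6E845A650FDC9382D2F1500000) ∷
  (4 , 1 , 125 , 0x43F262423B91B47E4908DF9CE675C97F1F3A40A68000) ∷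
  (4 , 1 , 125 , 0x43F313C9F0E740F6955D011AFC587304C49E65E48000) ∷
  (4 , 1 , 115 , 0x34C62688B1A11638F1C09947B98F85E101A1610928800) ∷
  (4 , 1 , 125 , 0x146719303E0600C92028D0D226D40FC90A9D97B548000) ∷
  (4 , 1 , 135 , 0x43EEB745B06120FDDDF1EA8DDD19A3F0D822B6A68000) ∷
  (4 , 1 , 135 , 0x85ED7CA04794097A4B85DA1EA0ABCE38B3D12B6A68000) ∷
  (4 , 1 , 125 , 0x85CD16D05212675DB722C1CAB0D16922BCC9D3FE20000) ∷
  (4 , 1 , 125 , 0xC6DE01760D00C5C077C31F5765904C1CAB2C9EBEE8000) ∷
  (4 , 1 , 125 , 0x85DE073E9A27ABFC1CD3BC1357407DBDFDDAE42900000) ∷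
  (4 , 1 , 135 , 0xC6CD029768A6D3089E24C4BD193A345AF82EFA94A8000) ∷
  (4 , 1 , 150 , 0x44ED9425DC3AB04F585977666099593AA86D99AA40000) ∷
  (4 , 1 , 135 , 0x41E93DA0173A0808924669F87CA7B472975BE9548000) ∷
  (4 , 1 , 125 , 0x42E9AF69BFAF25B8D198291FA20E00223EBC83480000) ∷
  (4 , 1 , 115 , 0x450E92E3988F78FB8C6DF3982AF29EDEE0A0567F60000) ∷
  (4 , 1 , 125 , 0x43072F6FC1A57495E04727831A5625F7899D18A68000) ∷
  (4 , 1 , 125 , 0x85CE1F1272D055898D3F8D3477C4E33DEEED6C2120000) ∷
  (4 , 1 , 115 , 0x85DF477839B20083B97D7FF17CD10AFFC6F8218A68000) ∷
  (4 , 1 , 115 , 0xC6ADB4D24A359C60F481AF9EB34A20B11EFE30E100000) ∷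
  (4 , 1 , 115 , 0x41020B98823D802174212075C903343DAF9F98A68000) ∷
  (4 , 1 , 125 , 0xC6EF9C5CDEB73F49266DEEFDE4A32EA405B5676000000) ∷
  (4 , 1 , 125 , 0x44ED98D45184800334F29EDEDB0D9AB941EC576000000) ∷
  (4 , 1 , 125 , 0xC77252BE1B040F39FAD3DF26A49BA2145317CA8C80000) ∷
  (4 , 1 , 135 , 0x1080DFA39A397DF429F3BF6444DD8FA0664181B4268000) ∷
  (4 , 1 , 135 , 0x20BCEE97347B448977815B7A564740E7366CC59E9C8000) ∷
  (4 , 1 , 150 , 0x30ECC6364E8B425F2A0DEF71379D6D713049A23EA68000) ∷
  (4 , 1 , 135 , 0x10850C06EB1012917B7B6EFBBFAD25C3865AB7CE000000) ∷
  (4 , 1 , 135 , 0x1084FBD1E1A17763EA339108562D78EE618D11F0A68000) ∷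
  (4 , 1 , 150 , 0x30ECA5C46C707F9CD4C4FC1736AF32B734F57580000000) ∷
  (4 , 1 , 135 , 0x30E8B748CF08D5AEFD91B3FBAA72A9194F2B0841548000) ∷
  (4 , 1 , 135 , 0x44EFC79C33EB904C0B6795CD0E2DDD5C34A818100000) ∷
  (4 , 1 , 150 , 0x410120AF65F744D096DA2478FCC1707B16F9CB800000) ∷
  (4 , 1 , 150 , 0x4D1C15DBF57215030B0D9EE81E70695AF3B766A68000) ∷
  (4 , 1 , 135 , 0x107CE1D1F8DA7CD4CD49D6AB167B0DC12B07A7F1548000) ∷
  (4 , 1 , 125 , 0x30F0A24F43CE0FF4EC88CB3026CED3CE6D3ED7B6A68000) ∷
  (4 , 1 , 135 , 0x10816BB5C03F1965B5B4915CC0A29B1B0ECF7D71548000) ∷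
  (4 , 1 , 135 , 0x10811E85B1EF5A6E69093F10B722A1D6EC8C3755520000) ∷
  (4 , 1 , 135 , 0x30F12B67E721A536D6B99A9E80264D01392BF203620000) ∷
  (4 , 1 , 125 , 0x49082B4E9DCA681716581843D285EED0D4039AA40000) ∷
  (4 , 1 , 135 , 0x412CB445A621746260CB8F2FAE67998FE327809C8000) ∷
  (4 , 1 , 150 , 0x30E8CEDC36441F94D98CF5950F38AE9ADECF78AB480000) ∷
  (4 , 1 , 135 , 0x3108FF747FA71A35521E0FFCE615538C19D239D5520000) ∷
  (4 , 1 , 125 , 0x30F8C28BAA8492C5A89DEFAB985BF44F6837A77E000000) ∷
  (4 , 1 , 115 , 0x31193B5F8CA003ECA6E2D8127EAE9821C2B43D3FF60000) ∷
  (4 , 1 , 150 , 0x61A06FBA5DB3FF51FA9A2A561EC53021086701A5520000) ∷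
  (4 , 1 , 150 , 0x61B0EAD6E9DB33D0873180AC7A33ACDF565DE1A0A68000) ∷
  (4 , 1 , 150 , 0xE3802A43ED51337EF33B610D7435D1F554AE3610900000) ∷
  (4 , 1 , 150 , 0xE380728A0C9D74C2D5BDAFC2DD46627C21356869548000) ∷
  (4 , 1 , 170 , 0xE36FAB6DB94B8BFB9B45F50E51789EF35473048D480000) ∷
  (4 , 1 , 150 , 0x61B0DE918F0BE751E51EF8ECB3D50AE00D9672B6A68000) ∷
  (4 , 1 , 135 , 0x61A0EEE17AD40871AF1E443758FA765E7E9C3FCE000000) ∷
  (4 , 1 , 150 , 0x61B1605FCE1D849395A255FF7C846A550FF3A5009C8000) ∷
  (4 , 1 , 150 , 0x61A12F2AE7CA8D389C767952665873D2C1D96EEBEE8000) ∷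
  (4 , 1 , 150 , 0xE34F4791E682D9F1758FA9DF005F7B064895C71B520000) ∷
  (4 , 1 , 135 , 0x61C0E19CE5F25934AFDD1676D63494223FFADD7B548000) ∷
  (4 , 1 , 135 , 0xE350712B94E597AE8AD4518812C1A1D8FDDC9C60900000) ∷
  (4 , 1 , 135 , 0xE3830EA6809CB8D64924E6E4A952DC8C8AA8B44DEE8000) ∷
  (4 , 1 , 150 , 0x61B0AF8BAA2DD3D83973D5387059894CB8C316F5EE8000) ∷
  (4 , 1 , 125 , 0x20C0FD44074EDE46C48BB92C29EDBBC9C2C4B7CE000000) ∷
  (4 , 1 , 125 , 0x20B2DEDFA9BF6365441A0A06D6B7A0C6AA3DC78EA68000) ∷
  (4 , 1 , 135 , 0xE39242F17F64EBC22CE5A7CA70321E7C18A97EBD480000) ∷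
  (4 , 1 , 125 , 0xE393563B2DE0E4DFBB91CEF2D7C0520FA903C23ED48000) ∷
  (4 , 1 , 150 , 0x6151759F1F8DF4410DB592A0405AE9D06089C740D20000) ∷
  (4 , 1 , 125 , 0xE350524D0042D244B3305B1257332ABD33E4FFD8000000) ∷
  (4 , 1 , 135 , 0x32AEB3B4AF1F5FD5DAA15FCFC5DCC457502836735480000) ∷
  (4 , 1 , 150 , 0x32B6BF4878D7A06F48AEB10B6C6870E0840D728C16E8000) ∷
  (4 , 1 , 135 , 0x32BADD24F76E8A41BEF5E0B0F87FC5715498D6869548000) ∷
  (4 , 1 , 135 , 0x227EFD87BFAE420FB979F63B2E44991ED4C859FD8000000) ∷
  (4 , 1 , 150 , 0x124B3A5EDCAB8942D8B232F116969B08C72AF0BE9548000) ∷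
  (4 , 1 , 150 , 0x2276F2C0FC00288700FFF3CC0514F71B58B99167F600000) ∷
  (4 , 1 , 150 , 0x32B2B15DC39B7B3BE21549BFC71CC992D3BF96CAB480000) ∷
  (4 , 1 , 150 , 0x32BACF67A59386A6E3E4810335F4FBFB1FFBAFDD7FC8000) ∷
  (4 , 1 , 150 , 0x32AEA4A88388096925F2241D5CF5B86FB0199E0C0A40000) ∷
  (4 , 1 , 150 , 0x32B6C1280E757108701518B231CFB8F7563310B26000000) ∷
  (4 , 1 , 150 , 0x32B6D0186E3B72893B38FE52F9264296E7B722983F88000) ∷
  (4 , 1 , 150 , 0x32B2E2310EBD600F9D1E3C3BB3B930685CB3423B8900000) ∷
  (4 , 1 , 150 , 0x20721B18134D0DB3DA95B7453BA28704708C6F4D520000) ∷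
  (4 , 1 , 135 , 0x123F6C4B990E4B84D5B6DC13A3224E01FF4A6CA36A68000) ∷
  (4 , 1 , 150 , 0x32BB19D6978209A907FEE83918FD40D56F140A175EE8000) ∷
  (4 , 1 , 150 , 0x32B33E9D63D18539A675D5D9D1F041A336A0C0E73EE8000) ∷
  (4 , 1 , 125 , 0x32AEA2EFE10A3D4BAE32B31A258D2DF04CDEAA099548000) ∷
  (4 , 1 , 135 , 0x21B46636AD872377AD5B65205F2010879418C369548000) ∷
  (4 , 1 , 135 , 0x32D3653ADC4DC6E3CD40CB150815B2A1C96C5B2C1408000) ∷
  (4 , 1 , 150 , 0x32B2BD1EF270E6066450EC4EE2943EDAB14F4FA6E888000) ∷
  (4 , 1 , 135 , 0x227B5867336C9BDAE5CE39E94017AF3AFE166D6D3E48000) ∷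
  (4 , 1 , 135 , 0x32E35BEC8429945F7DEC1AA96F207FF2B61DA1F03480000) ∷
  (4 , 1 , 135 , 0xC4BA689D6B11672D9A8DD695E437DE757B70A0E2B368000) ∷
  (4 , 1 , 150 , 0x83FACC3E3A1B8EEF23B1257B2A33630CED885640DF88000) ∷
  (4 , 1 , 150 , 0x42EA9360B27DBF2C6453AA2FAB026FA94F8813F03F88000) ∷
  (4 , 1 , 150 , 0x21B474CF39BDDF4384F0B2D5EC3B460F54C41FF6000000) ∷
  (4 , 1 , 170 , 0x431B861F88E60D2F585FAAB050CBE1C330FF33FD8000000) ∷
  (4 , 1 , 150 , 0x42FACC359C79E166BEE5786E874A55BED07AB370D668000) ∷
  (4 , 1 , 150 , 0x21C0800902904E3A5FF357D57AF3F38B7C0E2E98B48000) ∷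
  (4 , 1 , 150 , 0x83FB0C78B8795E18F4EC8F0172557FF7098D45441548000) ∷
  (4 , 1 , 150 , 0x83FAC472C5D8870E67040D231CD0E074231F4D660900000) ∷
  (4 , 1 , 150 , 0x42EAA12E8ABC4DA7F6FE20A0CF788CBE888361636A68000) ∷
  (4 , 1 , 150 , 0xC4DAD3F5704BFFFE8C127BF8EF0027345EB590F10A40000) ∷
  (4 , 1 , 150 , 0xC4BA4EE5A0A5A340BFA7FAD207EA470F1416599F8D48000) ∷
  (4 , 1 , 150 , 0x431E55988D31FE15BD616E78FBA3C3FCA0555B441548000) ∷
  (4 , 1 , 150 , 0x83DB87A5963A04226DD36D7BA60AEC22409DEC869548000) ∷
  (4 , 1 , 150 , 0xC4AAD68B3EC7688E111DAAA04F2D25B2DB557C283588000) ∷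
  (4 , 1 , 135 , 0x42EC9994FB592D582F5917CEB50765B7618B587F6000000) ∷
  (4 , 1 , 135 , 0xC56D77B73647DF0FAE3D101337FB6EE13347675589C8000) ∷
  (4 , 1 , 135 , 0xC56C6162136CE6C602714EC9CDF55412FC00A4E38900000) ∷
  (4 , 1 , 135 , 0x20D238A473958766CEB85342C4B12DD267DE27A89C8000) ∷
  (4 , 1 , 135 , 0x43AF6940230C3B7B84DEB6502382ED7ED94DD1143EE8000) ∷
  (4 , 1 , 135 , 0x20B3CF67C2E4A800EB450A99B2697CFE51111EDB480000) ∷
  (4 , 1 , 135 , 0xC56E6A2E2A001AD9C1BEBC4F4C18FA8F266DA3FCE000000) ∷
  (4 , 1 , 125 , 0x209CD2D0616A3D78ADD3140B5C82FC2865D0876869548000) ∷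
  (4 , 1 , 135 , 0x20B43E3A660FA91C0383EAAE02ABC565FAF80240A68000) ∷
  (4 , 1 , 150 , 0x30D0A647B4ABC7A9705F823DE1F353ED4BA2B71869548000) ∷
  (4 , 1 , 150 , 0x30D0A489698C0CB09E904AF31F316FF5E610A0CE41548000) ∷
  (4 , 1 , 150 , 0x24CF1A0749CF9726410C255CED229CFFCF9B41E5480000) ∷
  (4 , 1 , 170 , 0x30CC977D0B452247D8B78EC72F532F260394A67073548000) ∷
  (4 , 1 , 150 , 0x1060E25721C91EFA61A1AA32E3DE61D234D6FE67F1548000) ∷
  (4 , 1 , 150 , 0x24BEA6F1EB6B620D922E2DEAE7F474A851CF61CD520000) ∷
  (4 , 1 , 150 , 0x1060E184B8FA7BC6446CD773BFE19B0D6FB2667073548000) ∷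
  (4 , 1 , 150 , 0x30C8882916812E142879075A33A1744FCC4FF7B073548000) ∷
  (4 , 1 , 135 , 0x24F26ED8E245EC15C8AD0A9B021147CF92BF6000000000) ∷
  (4 , 1 , 150 , 0x105CEE017D8B44CA12AA083E81843C29924CE73369548000) ∷
  (4 , 1 , 150 , 0x1064C96AD50EDD6A738F4ECA8F77A08E025320337E000000) ∷
  (4 , 1 , 150 , 0x2D69521B40743017FDFA85CFF5F079E8197E5D1B520000) ∷
  (4 , 1 , 150 , 0x30CCE6A72192E312854619088B1BCBFEF700222369548000) ∷
  (4 , 1 , 135 , 0x10485AED2A6E115D4263E9DCED5ABFE8B78AE7716BEE8000) ∷
  (4 , 1 , 135 , 0x1079166F7DCE9AA0C8AE11E3F27AB4161D500975EE8000) ∷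
  (4 , 1 , 135 , 0x30AFC70355B349CF641080547B38F92806E0C9029A0000) ∷
  (4 , 1 , 150 , 0xC6B9587E33F93B0888168DDF052F8C77A54069548000) ∷
  (4 , 1 , 135 , 0x30B827DC0CDE9E3308A63AE505C766796AC1F4678EA68000) ∷
  (4 , 1 , 135 , 0x862072CC5958F2A3999F64CC720BA79FBC97F6000000) ∷
  (4 , 1 , 150 , 0x4100C38D6C43CE9E0285EC261CE6F0B648C60C4869548000) ∷
  (4 , 1 , 150 , 0xC29F65FD37DC7B71FA490ABF5D6A74C529043A17CE000000) ∷
  (4 , 1 , 150 , 0x312A7BD98C2A11B99C76E6FDB7EED7A171DCD506928000) ∷
  (4 , 1 , 135 , 0x104748FD4C3C8D090CAB8D8626F3D73A5D70BFC0A68000) ∷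
  (4 , 1 , 135 , 0x411101A1BC0E11A585E5D78A0978A6E84ABA47F3E9548000) ∷
  (4 , 1 , 150 , 0x81D016C4E11DE4F196E1174247BF84FC857C7D0218A68000) ∷
  (4 , 1 , 150 , 0x11012080CF7103B73B5904BCC291216810957E19548000) ∷
  (4 , 1 , 150 , 0x40EFCAD9CF4894521C7EFE4EAEECA7E25C471BFD9E9C8000) ∷
  (4 , 1 , 150 , 0x4110FAE1C7FBB1590EAC08ADB5E1C88055BD08C073548000) ∷
  (4 , 1 , 150 , 0x81EFC7B314383A7E08E68DD0BD48354B833CCCC369548000) ∷
  (4 , 1 , 150 , 0xC2AF95696981AC5EE43F6582CDFD325FD8A860C6F5EE8000) ∷
  (4 , 1 , 150 , 0xC2B027DC68858AE477EFBC56003D8E3391455F65E9548000) ∷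
  (4 , 1 , 150 , 0x41014DD2D8A9216FABB90A4F5D6217B2E2B02BC743EE8000) ∷
  (4 , 1 , 150 , 0x34036DC9FD698F945D302A91810F019F373A8173520000) ∷
  (4 , 1 , 150 , 0x41013E9549A05B2152CC45D3C12BEDCC5E493A5935480000) ∷
  (4 , 1 , 150 , 0x22D9C5275DEA26F8D916642B63437C2757F14F25520000) ∷
  (4 , 1 , 150 , 0x41003BCF1BE0AC4CC429E37A353BE49F2D8FD5479E9C8000) ∷
  (4 , 1 , 150 , 0xC2C07E15AD13F222F53B77FE2BE87E036C943BFDF3548000) ∷
  (4 , 1 , 150 , 0x21D6E240CA4C98EBB9B292126B8D7546F273C54E000000) ∷
  (4 , 1 , 150 , 0x41015CEDABBBBFA300B37987260C4418C5256F20F89A0000) ∷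
  (4 , 1 , 150 , 0x41421D14DE8F25861EEEF995976E2283ED8E5CEDB3368000) ∷
  (4 , 1 , 150 , 0x41413BED217248C7410AC5FC17256D38E52E16C240A68000) ∷
  (4 , 1 , 135 , 0x649E14DCFD0DB142BFA960749E061EDD96A7054E000000) ∷
  (4 , 1 , 150 , 0x30ADF06F791A72223CDB597CD1F49EF2025B9564FB0000000) ∷
  (4 , 1 , 150 , 0x1046293A3B7060AC29A87709790D8FFE14C5CF65BA2D20000) ∷
  (4 , 1 , 150 , 0x30B60BDCFAD1A92296120105F13A24D56E4C97CB7CE000000) ∷
  (4 , 1 , 150 , 0x30B2013DCD0424ED0F4430EC1020261CFBD8AD69D76000000) ∷
  (4 , 1 , 150 , 0x30ADE18BAFC37489D35A9249619FED23B0CEE0957F1548000) ∷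
  (4 , 1 , 150 , 0x2075FE76E850D0C6DE7B70D6B94C759A11858E0CA9E9C8000) ∷
  (4 , 1 , 170 , 0x23D1D1D16BB7AF11674D8D5241C8494DF89A76ABE48000) ∷
  (4 , 1 , 150 , 0xE56C8A7698D1213EC0DB04E49E38FAD0BD67FDE9548000) ∷
  (4 , 1 , 170 , 0x1046278B9ABFDD15725005DBD2E64370FD58A6C38E8A40000) ∷
  (4 , 1 , 170 , 0x10423B4A3FD130B5100B26032358F5085F858221F769C8000) ∷
  (4 , 1 , 150 , 0x30B6651DB64F8261CFC4841B232C0B4DB13A85DF77E000000) ∷
  (4 , 1 , 150 , 0x207218DA8E6A2C967DF7CEEDA1B9B4DFD68F10C9FB0000000) ∷
  (4 , 1 , 170 , 0x30AE0494BB6A5C2FB8E51BAF7F338D48244ACDD004B548000) ∷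
  (4 , 1 , 150 , 0x2D63A525A021306B69C30C0F698ABF1473F19DCB548000) ∷
  (4 , 1 , 150 , 0x227F871F4B335391C25FC9875AE555A1F989C5FD8000000) ∷
  (4 , 1 , 135 , 0x30BA6727278F3310BEB83FE12239C77A062B8076869548000) ∷
  (4 , 1 , 150 , 0x20828CE6478655E994CA156F1BF0D604BF9F5C51A2B480000) ∷
  (4 , 1 , 135 , 0x130DE1FFA4C1D1E33E70C14F12E469D0351720073548000) ∷
  (4 , 1 , 150 , 0x20720CD9CE6689FA3F762CF5B46C4BCB5C7DB622879368000) ∷
  (4 , 1 , 150 , 0x105A5D9AC59EE8BDF5912C06F3B15A5E59A4EBA111BEE8000) ∷
  (4 , 1 , 150 , 0x30DA59A94BE9A2C82DCD0296A71CC8BCF76D961B240A68000) ∷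
  (4 , 1 , 150 , 0x30DA5CD5A65261C3467B819DDF64E1C62EE8515D9E6A68000) ∷
  (4 , 1 , 150 , 0x4112FC5F82A917807A953B693985F93A9089ACD1869548000) ∷
  (4 , 1 , 150 , 0xC2A120E6C00637E4AF5F218645BACFD6A25DDE627F6000000) ∷
  (4 , 1 , 170 , 0x233F8246D2DD3E980ADC3BAB83AB1824B75558073548000) ∷
  (4 , 1 , 170 , 0xC2A0A6285F64814DAB5E6438CDC2662602E3ADF8D1E9C8000) ∷
  (4 , 1 , 170 , 0x32F7CF17221276154C779D7938EF06940BFE47869548000) ∷
  (4 , 1 , 150 , 0x40E21A0BA5435274E061D7739165356FCFB99E769C3520000) ∷
  (4 , 1 , 170 , 0xC2B167DF7EC543267ACB7EBEEAA54E19E7386436735480000) ∷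
  (4 , 1 , 170 , 0x4112C205A1659458DD10E47D2552DB6C1F7259FB1CD520000) ∷
  (4 , 1 , 170 , 0x81C1E4751EA18ED6808F6DA462CB7E00405CBE95BF3EE8000) ∷
  (4 , 1 , 170 , 0x81C1A39F5A049C4985319EFC110FD597138F61146789A0000) ∷
  (4 , 1 , 170 , 0x4112429931F2475F90937C6B9B6D51407F61C71E4CE9C8000) ∷
  (4 , 1 , 170 , 0x81E2918040F40D2C7DB1E15FEA2E155374BDC9C2F9E9C8000) ∷
  (4 , 1 , 170 , 0x330AC39EEDEA7764185184482D7154F69CB80073548000) ∷
  (4 , 1 , 170 , 0xC29ED00027E3C6C1AD182348C662D15A6A1028FC176000000) ∷
  (4 , 1 , 150 , 0xC29EAE4245728FBB44C8EC3459C034DC5707CE25819548000) ∷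
  (4 , 1 , 170 , 0x30CE5D4D985111B30D81DF39F8DBEC111F3F10FB5480000) ∷
  (4 , 1 , 170 , 0x411046D1EA18BAB19C4F9BC32B8AFD45EFA20EDFFB0000000) ∷
  (4 , 1 , 170 , 0x41614EE4340575B8C1D1A65C9566F29FE739B091A36A68000) ∷
  (4 , 1 , 170 , 0xC4BCEF296E882C38D55B747B1DD7CE9779F8F9ACE000000) ∷
  (4 , 1 , 170 , 0x83FE39C516C24B674AAB2EA71360204D1DCF80FD8000000) ∷
  (4 , 1 , 170 , 0x440F54A3AFD9ADCD329F63D22507CAE05771A4233480000) ∷
  (4 , 1 , 170 , 0x416386029EFF7595058B8A44C7F6D4F3F18F07CED10928000) ∷
  (4 , 1 , 170 , 0x40E298800EA68AFCFA1724A922A8006BD993AE9B6829A0000) ∷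
  (4 , 1 , 170 , 0x41239A5B29ED750DFA1812F2969EDB081F15C7507F1548000) ∷
  (4 , 1 , 170 , 0x4163671CB7A42D132308090AF9DD9FBE071F5C51143EE8000) ∷
  (4 , 1 , 170 , 0x41A531E56E1095D722580E0D8DB678CFC19E462A819548000) ∷
  (4 , 1 , 150 , 0x41A24788D26C7DB3AB9051F4C9976C9DAAA87EE25E9548000) ∷
  (4 , 1 , 170 , 0x41634EE0E77650B0BA6CE46CCB267E28E7A8EFE5023548000) ∷
  (4 , 1 , 170 , 0xC3217791FE6332512ED8631702470CEC969C72EC6EA900000) ∷
  (4 , 1 , 150 , 0x40E1C8AD4291DBBB9E162534E2D08A040A0BDC7077E000000) ∷
  (4 , 1 , 170 , 0x238E7CDCF6675C0021B665BC2359B63999A154FE000000) ∷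
  (4 , 1 , 170 , 0xC3615940BCE1E2A820CC5E7ADE00E171AA38D705973520000) ∷
  (4 , 1 , 170 , 0x2AE832C7E286BC55A9AC9ED68237D7D8608C5E9548000) ∷
  (4 , 1 , 170 , 0x4162776344A7C4B94F6A54D3CB7B55A6E753D21048D480000) ∷
  (4 , 1 , 170 , 0x8283E86C8E1CECA26BCF96D47D5A0264DA6FA3C17CE000000) ∷
  (4 , 1 , 170 , 0xC363C96BAC45F739EB8B830E767A2EAEF42AA1E2735480000) ∷
  (4 , 1 , 170 , 0xC2E24C90BEE40B5EDF9F6E9C1C8A58342EA51A2C069548000) ∷
  (4 , 1 , 170 , 0x41A8C37A36D62564979C71803EA7086ACDE24C71743520000) ∷
  (4 , 1 , 170 , 0xC32B0420F1EA9FC18E0FBE2566F82BAE635E113BC5B480000) ∷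
  (4 , 1 , 170 , 0x4122BB4A87821A153BA60CF072130DB870CD77EEA36A68000) ∷
  (4 , 1 , 150 , 0x4127072040BE0862775138247BE61AF4CD771C6C576000000) ∷
  (4 , 1 , 170 , 0x81C5B3BC8EB8E47ECA900C54F38DEB3B331B65B2841548000) ∷
  (4 , 1 , 170 , 0x42F4BCCEB180763806FE95AAB3D0A2EC145618800F3EE8000) ∷
  (4 , 1 , 170 , 0x81CD4D4D1F40913484BA2C5B39E5D5B341C66BC7A36A68000) ∷
  (4 , 1 , 150 , 0xC4B3CFA3EFDB955BE7BFC7190D34C584204FFD87743520000) ∷
  (4 , 1 , 150 , 0x41E54F73051FB134599534B2F7C7E904032722EC869548000) ∷
  (4 , 1 , 150 , 0x28BF26B2F6CABE43C78485C8D873F923A4A02CAB480000) ∷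
  (4 , 1 , 170 , 0x43F87529C46FB5CA437DE8F363D252E237ECECFAF269C8000) ∷
  (4 , 1 , 150 , 0x82C4FAB8B6940CD66EF27029216F8CB4D662DB1020D480000) ∷
  (4 , 1 , 150 , 0x84CC294F44B1318B6157DD9DE585F9B0B938060DF88000000) ∷
  (4 , 1 , 150 , 0x42ED20DDC93CE0D4C4E1FE6A5EAED2F159E7701B023548000) ∷
  (4 , 1 , 150 , 0x42E8E13340E475AD0A7A43FB55F739F38912897D576000000) ∷
  (4 , 1 , 170 , 0x40EA82881338C6CFE45C30765F044124BFAF336AE83E48000) ∷
  (4 , 1 , 150 , 0x43F0F6E92899EEA4B453550C86241C81A4F3BAC2A36A68000) ∷
  (4 , 1 , 170 , 0x40E229D57DCF189CB340B789645683055B2BF382576000000) ∷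
  (4 , 1 , 170 , 0x318E8695FEE2830D3BA6956AC9DFA1E49127FB9A0EA68000) ∷
  (4 , 1 , 150 , 0x10E8AAED40EB8A09DCFC070D065FCE60322B5A7FA6000000) ∷
  (4 , 1 , 150 , 0xC2A1928F154F24624051BA562606E1EFC94832161CD520000) ∷
  (4 , 1 , 170 , 0x420396FB6ED8A000CAB0F63F7FAFBE94D35FE2467F1548000) ∷
  (4 , 1 , 150 , 0x31CCD2E1F201185E9E66DE7D1D692379889D806D80000000) ∷
  (4 , 1 , 170 , 0x4204B34BD336B086E69FF1F69A58EA4E2D471D6CF9E9C8000) ∷
  (4 , 1 , 150 , 0xC3C3A69BF76B5D53F644E0C844E991E5C00CA205033368000) ∷
  (4 , 1 , 170 , 0x41E427649C327733FF541149F9E0291C530371363CE000000) ∷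
  (4 , 1 , 170 , 0xC4A5A71EEF433EF5BC36CB1AC61F7F0DB4CF0EBAF4D520000) ∷
  (4 , 1 , 170 , 0x42E6A0C357D5D336D227AFCAA1C8CCBAD0A34DD4236A68000) ∷
  (4 , 1 , 170 , 0x31DD6FA0159DCEB5A85B1CE4317020630AE939DC1548000) ∷
  (4 , 1 , 150 , 0x81E187EF7D5BD8C5866D8CE4BD45258E61C4E4FE019548000) ∷
  (4 , 1 , 150 , 0x40E0B8B79D6B9461D8D8FB2D09529E47A61EC57DCAB480000) ∷
  (4 , 1 , 150 , 0x81D1826AA06CEB20584E0BA7A7F88E5D4E691776240A68000) ∷
  (4 , 1 , 170 , 0xC6AFC045837CDA24AD9B51DAEF4C9E95EDFB1E68683E48000) ∷
  (4 , 1 , 150 , 0x89EC44F06C6D030DE5C0A0C1C61A22DFB9D344EFDCB548000) ∷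
  (4 , 1 , 170 , 0x85F08ECADC6E60552B1EF2AC574769BE23C4ED20819548000) ∷
  (4 , 1 , 170 , 0x1285918BB671466173D52632CC882108077EFDEDB480000) ∷
  (4 , 1 , 150 , 0x451F73239A840A73A6C2FF6B4D9F0AD9CE2ADEECF2B480000) ∷
  (4 , 1 , 150 , 0x10BDB988D157891D93176D760EC06B15AA74F1F9E9C8000) ∷
  (4 , 1 , 150 , 0x40F187953B7DAFCE762F3C0A7FD31902B69D1B615C3520000) ∷
  (4 , 1 , 150 , 0xC6E0CC3FBF57348A7BC680F06A16B23EF3D9B296869548000) ∷
  (4 , 1 , 150 , 0x81C0C9F3391559611B6E89037FDC5E4CA2AD1567A36A68000) ∷
  (4 , 1 , 150 , 0x4D0C041E8D47B909829001C012BFB52287D731D278EA68000) ∷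
  (4 , 1 , 150 , 0x40E2A88D078730BF116A42AD0174B65DBF9F469F1C8A68000) ∷
  (4 , 1 , 150 , 0x8A0CA8000764FC345CAA3F176B4EB1B800D2E0165E9548000) ∷
  (4 , 1 , 150 , 0x40F20D7CEF4E4D9EE536B220EFB1AEC9FBB75947869548000) ∷
  (4 , 1 , 150 , 0x40E5F9B8F8DB464B972DD9A33DD6891CA435209E4CE9C8000) ∷
  (4 , 1 , 150 , 0x40E2625DC1776862EF0E0BE7FD21A1E182C4A6467CE000000) ∷
  (4 , 1 , 150 , 0x49840F4EC8C961F27489BCFBFCE6A1D2327FD08B11BEE8000) ∷
  (4 , 1 , 150 , 0x4D0BEAF561C17D9D35FFC6DD98DA511CC9928E4A069548000) ∷
  (4 , 1 , 150 , 0x40EA584C4F61D5DE41D32690519388902E88894A023548000) ∷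
  (4 , 1 , 150 , 0x4DD71614717DCED960B85FA5F9C1D7CF854F1DD1869548000) ∷
  (4 , 1 , 150 , 0x1083496F26FFFA3EB911111FF2F85384580C5F02576000000) ∷
  (4 , 1 , 150 , 0x82023EF5F919C5D132D8399CC7240CE9AF7F2207975EE8000) ∷
  (4 , 1 , 150 , 0x41A8B4F290A2E867F1AF358177CC2679F75456DBFD8000000) ∷
  (4 , 1 , 150 , 0x51A77E6B853B5D643910EC69F178D27BDA9DE44816BEE8000) ∷
  (4 , 1 , 150 , 0x824F4A08A742EB2B9D0E416FFD943707BDEC7D16000000000) ∷
  (4 , 1 , 150 , 0x718E59D0B155CA92A12B12251FCCFD586D09BFD0F03480000) ∷
  (4 , 1 , 150 , 0x213EC66357F3E9B9294694364A2D98C61F857446CF69C8000) ∷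
  (4 , 1 , 150 , 0x923E133F44C8B1C0BAC1AD56986DC83EB9DBA05254E000000) ∷
  (4 , 1 , 150 , 0x824AFBD344B3984898A41B1D9CE9F5AFB6D26A114B5480000) ∷
  (4 , 1 , 150 , 0xB330994F0B305391086E705714CB37770902E7DD7B6A68000) ∷
  (4 , 1 , 240 , 0xB330994F0B305391086E705714CB37770902E7DD7B6A68000) ∷
  (4 , 1 , 150 , 0xC2ADCD081EC1FECA9B0EBE417D0247E4D202D803FFB548000) ∷
  (4 , 1 , 150 , 0x213C9DA54CC7A39FE2C66F3F1725760991839154069548000) ∷
  (4 , 1 , 150 , 0xD3A7085DCF004D8AB7213EC4D75D108882D77CE1FF1548000) ∷
  (4 , 1 , 170 , 0x615103536569353B868D010BAD9C5377CBEAE0164B5480000) ∷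
  (4 , 1 , 150 , 0xF42B73427707D613980986B907F2BD46814EEF2A023548000) ∷
  (4 , 1 , 170 , 0x724AACA6EA812055400694A9F9D0EC6D9820D6AEFB0000000) ∷
  (4 , 1 , 170 , 0xA291CBEAE0A4C9E3CDC44F8F58930BE4CDB7C656F9E9C8000) ∷
  (4 , 1 , 170 , 0x1038AE96D0BD0197891D28919E7F3FF41FB31221CFE000000) ∷
  (4 , 1 , 150 , 0x310B729AD9B10BEAED26DBEFCC1BE31FB3ED93800000000) ∷
  (4 , 1 , 170 , 0x2277678895D7FC583543DA05CA5DE2E96293B59F8D480000) ∷
  (4 , 1 , 150 , 0xD3FB97014DD770E739DF612402C22ADBC998AE7AEB3480000) ∷
  (4 , 1 , 150 , 0xD4DEC89A1144543D0879C1DF27AE69AF28209AE25E9548000) ∷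
  (4 , 1 , 170 , 0x30DB918D59C99AA902539F0D8D22E3598EA91D94C869548000) ∷
  (4 , 1 , 150 , 0x24B087183BB376AD8805F8CE6200932E25DC1FC80073548000) ∷
  (4 , 1 , 170 , 0x2480012BB3A63126B62241B13CE9BBE30AA03354670D480000) ∷
  (4 , 1 , 170 , 0x30DA9013A3436605030B35B4109EDCFE759C3E844F2B480000) ∷
  (4 , 1 , 170 , 0x38E73637B2949E6B180039F16F9B4E123DE3AA54CF9E9C8000) ∷
  (4 , 1 , 170 , 0x3CD3BF73B6BCD9AA10FD9CA652D3BBED4245865F3B88000000) ∷ []

-- For large t a good choice hardly depends on t any more, so the runs can share these 38 seeds.
seeds : List ℕ
seeds =
  0x25860CC408BA13F68A5076B2C8DF984C27EB0E616000000000 ∷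
  0x3017ED6D82218FB2EA60D617F0FDCA067DBCD67F6000000000 ∷
  0x6547DB2D536C98DB08DA62124F48067DCD0E66C869548000 ∷
  0x33D367B43783611F0373F1596A4D63C80E08B7E20000000000 ∷
  0x36BA7588CB267307BA14E9AECE20EFCC1C0137E20000000000 ∷
  0x2A082FAB82D06D3A671695B3E9F6F2288BB500000073548000 ∷
  0x11468908703D2B11046E2947BD75F01E004099E20000000000 ∷
  0x381CE38E42D77D3950B9076717ECF5BDD7050EFEC240A68000 ∷
  0x1D735AD802AD9CBA1261795024B602081C0137E20073548000 ∷
  0x31FC1128958FFD0EA5C7BF6060BFEA1027EB0E616000000000 ∷
  0xD0958D0EE2FA3E6F72453826508081027DA80000000000000 ∷
  0x3109DAFD682389E09AF9BEF5DA66600A8BC58E616000000000 ∷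
  0x202DDDEAC6BA418587B4469B790E01CC1BF100000073548000 ∷
  0xEBD2A7C70A49DBF4CBD0FFA4FCE4A21FE0137E20000000000 ∷
  0x54C2DB646AFD47F19A288A9BC1E8FE87DCCB7E20000000000 ∷
  0x13AAEADEFF8F24FBF5233085835F7FF8B5AF0E66C7F6000000 ∷
  0x9330400A12260E3EC1364A0D7788034B5AF0E616000000000 ∷
  0x3DEF8B09A32FB72D67926EB84A176B078C28B7E20000000000 ∷
  0x3BEEDBC7E6027C31D08DA96E5F60184819E200000000000000 ∷
  0x21819663A9E3F16A1E3BDF3923CDF82E381262000000000000 ∷
  0x217572D64BE470F5A2A3249D7CC530289BECE2000000000000 ∷
  0x72F155F4FA0397E5397C6D0AF1720205FBC80000000000000 ∷
  0x33BD399427912422A1BD26E2CAD7021027DA80000073548000 ∷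
  0x35C3A3C8F4E92D46AA3F070116961A3BEFF8D67F6000000000 ∷
  0x3472ED3944CB898A9E61E2934156821027DA80000073548000 ∷
  0x250A90F60B3927FD221AE06471B7E9FFF008B7E20000000000 ∷
  0x3EFFDC279C02281F9E14CE685065B42E27DA80000000000000 ∷
  0xC90B9FC4BF1C5C191A1AD36E9862913A5FA80000000000000 ∷
  0x96406EA4797FE92A90DA01F0D1F7A3FFE0137E20000000000 ∷
  0x20EF4AC10CCA055031200EC39C82A3E5FBCD67F6073548000 ∷
  0x3C37E8A6A910BE92EA5A5DD0F12FA1E60DF880000073548000 ∷
  0x12F3880429F7CE4669B52E3F92F81213887EEA29759FD80000 ∷
  0x158F97CF1A4115A714D8C70255F83E60E08B7E20000000000 ∷
  0x1333FC5F8EEED292C90C8100A99F6A247DCCB7E20000000000 ∷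
  0xB0C537A12F1F291580E8C2BE465A91BD2038E616000000000 ∷
  0x370878B74EF100C62786D763A2CF5C606DB5567F6073548000 ∷
  0x3B2166EFBA2013C0F8B1E1AFC6AE79D845DA80000000000000 ∷
  0x1F0D67B05E6483234390E1F1E318EFE88DF462000000000000 ∷
  []

-- Here the last component is an index into seeds.
runs₃ : List Run
runs₃ =
  (4 , 1 , 140 , 1) ∷ (4 , 2 , 180 , 2) ∷ (4 , 1 , 130 , 0) ∷ (4 , 1 , 140 , 3) ∷ (4 , 1 , 200 , 2) ∷
  (4 , 1 , 230 , 3) ∷ (4 , 1 , 200 , 4) ∷ (4 , 1 , 165 , 5) ∷ (4 , 1 , 165 , 6) ∷ (4 , 1 , 180 , 7) ∷
  (4 , 1 , 140 , 8) ∷ (4 , 1 , 165 , 1) ∷ (4 , 1 , 200 , 9) ∷ (4 , 1 , 140 , 10) ∷ (4 , 1 , 180 , 0) ∷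
  (4 , 1 , 150 , 11) ∷ (4 , 1 , 140 , 5) ∷ (4 , 1 , 140 , 12) ∷ (4 , 1 , 140 , 5) ∷ (4 , 1 , 140 , 2) ∷
  (4 , 1 , 130 , 13) ∷ (4 , 1 , 165 , 14) ∷ (4 , 1 , 165 , 15) ∷ (4 , 1 , 180 , 16) ∷ (4 , 1 , 130 , 0) ∷
  (4 , 1 , 180 , 0) ∷ (4 , 1 , 180 , 17) ∷ (4 , 1 , 140 , 10) ∷ (4 , 1 , 165 , 1) ∷ (4 , 1 , 140 , 18) ∷
  (4 , 1 , 150 , 19) ∷ (4 , 1 , 165 , 2) ∷ (4 , 1 , 200 , 19) ∷ (4 , 1 , 130 , 3) ∷ (4 , 1 , 150 , 20) ∷
  (4 , 1 , 180 , 5) ∷ (4 , 1 , 165 , 20) ∷ (4 , 1 , 200 , 5) ∷ (4 , 1 , 130 , 18) ∷ (4 , 1 , 140 , 16) ∷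
  (4 , 1 , 140 , 18) ∷ (4 , 1 , 150 , 18) ∷ (4 , 1 , 200 , 19) ∷ (4 , 1 , 140 , 9) ∷ (4 , 1 , 140 , 13) ∷
  (4 , 1 , 150 , 21) ∷ (4 , 1 , 165 , 12) ∷ (4 , 1 , 130 , 14) ∷ (4 , 1 , 180 , 5) ∷ (4 , 1 , 180 , 16) ∷
  (4 , 1 , 150 , 21) ∷ (4 , 1 , 120 , 22) ∷ (4 , 1 , 165 , 23) ∷ (4 , 1 , 130 , 13) ∷ (4 , 1 , 150 , 3) ∷
  (4 , 1 , 150 , 10) ∷ (4 , 1 , 130 , 19) ∷ (4 , 1 , 165 , 24) ∷ (4 , 1 , 150 , 3) ∷ (4 , 1 , 180 , 19) ∷
  (4 , 1 , 165 , 0) ∷ (4 , 1 , 140 , 25) ∷ (4 , 1 , 180 , 26) ∷ (4 , 1 , 130 , 20) ∷ (4 , 2 , 140 , 10) ∷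
  (4 , 1 , 140 , 27) ∷ (4 , 1 , 165 , 0) ∷ (4 , 1 , 130 , 5) ∷ (4 , 1 , 140 , 16) ∷ (4 , 1 , 140 , 24) ∷
  (4 , 1 , 150 , 28) ∷ (4 , 1 , 140 , 20) ∷ (4 , 1 , 150 , 29) ∷ (4 , 1 , 130 , 25) ∷ (4 , 1 , 130 , 20) ∷
  (4 , 1 , 130 , 30) ∷ (4 , 1 , 140 , 9) ∷ (4 , 1 , 165 , 0) ∷ (4 , 1 , 130 , 0) ∷ (4 , 1 , 140 , 30) ∷
  (4 , 1 , 150 , 18) ∷ (4 , 1 , 165 , 10) ∷ (4 , 1 , 140 , 31) ∷ (4 , 1 , 140 , 0) ∷ (4 , 1 , 130 , 23) ∷
  (4 , 1 , 140 , 12) ∷ (4 , 1 , 130 , 24) ∷ (4 , 1 , 140 , 1) ∷ (4 , 1 , 130 , 19) ∷ (4 , 1 , 150 , 24) ∷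
  (4 , 1 , 130 , 25) ∷ (4 , 1 , 150 , 2) ∷ (4 , 1 , 120 , 25) ∷ (4 , 1 , 130 , 25) ∷ (4 , 1 , 130 , 10) ∷
  (4 , 1 , 165 , 8) ∷ (4 , 1 , 140 , 29) ∷ (4 , 1 , 140 , 19) ∷ (4 , 1 , 140 , 32) ∷ (4 , 2 , 150 , 2) ∷
  (4 , 1 , 140 , 0) ∷ (4 , 1 , 130 , 11) ∷ (4 , 1 , 150 , 10) ∷ (4 , 2 , 150 , 33) ∷ (4 , 1 , 140 , 2) ∷
  (4 , 1 , 140 , 10) ∷ (4 , 1 , 130 , 11) ∷ (4 , 1 , 140 , 24) ∷ (4 , 1 , 130 , 12) ∷ (4 , 1 , 140 , 23) ∷
  (4 , 1 , 140 , 6) ∷ (4 , 1 , 140 , 16) ∷ (4 , 2 , 130 , 28) ∷ (4 , 2 , 130 , 9) ∷ (4 , 1 , 140 , 9) ∷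
  (4 , 1 , 140 , 5) ∷ (4 , 1 , 140 , 23) ∷ (4 , 1 , 140 , 33) ∷ (4 , 1 , 140 , 0) ∷ (4 , 1 , 140 , 11) ∷
  (4 , 2 , 130 , 10) ∷ (4 , 1 , 140 , 19) ∷ (4 , 1 , 130 , 3) ∷ (4 , 1 , 130 , 22) ∷ (4 , 1 , 140 , 17) ∷
  (4 , 1 , 130 , 10) ∷ (4 , 1 , 130 , 17) ∷ (4 , 1 , 140 , 20) ∷ (4 , 1 , 130 , 4) ∷ (4 , 1 , 140 , 32) ∷
  (4 , 1 , 130 , 14) ∷ (4 , 2 , 130 , 24) ∷ (4 , 1 , 130 , 10) ∷ (4 , 1 , 120 , 27) ∷ (4 , 1 , 130 , 1) ∷
  (4 , 1 , 150 , 9) ∷ (4 , 1 , 130 , 24) ∷ (4 , 1 , 130 , 15) ∷ (4 , 1 , 120 , 0) ∷ (4 , 1 , 130 , 34) ∷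
  (4 , 2 , 140 , 35) ∷ (4 , 1 , 130 , 17) ∷ (4 , 2 , 130 , 24) ∷ (4 , 1 , 130 , 26) ∷ (4 , 1 , 140 , 1) ∷
  (4 , 1 , 140 , 10) ∷ (4 , 1 , 130 , 1) ∷ (4 , 2 , 150 , 29) ∷ (4 , 1 , 130 , 10) ∷ (4 , 1 , 140 , 4) ∷
  (4 , 2 , 140 , 6) ∷ (4 , 1 , 130 , 25) ∷ (4 , 1 , 120 , 33) ∷ (4 , 1 , 130 , 22) ∷ (4 , 1 , 120 , 17) ∷
  (4 , 1 , 120 , 3) ∷ (4 , 1 , 130 , 26) ∷ (4 , 1 , 140 , 15) ∷ (4 , 1 , 130 , 30) ∷ (4 , 1 , 140 , 15) ∷
  (4 , 1 , 120 , 22) ∷ (4 , 1 , 130 , 3) ∷ (4 , 1 , 130 , 10) ∷ (4 , 1 , 130 , 36) ∷ (4 , 1 , 120 , 25) ∷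
  (4 , 1 , 120 , 4) ∷ (4 , 1 , 130 , 14) ∷ (4 , 1 , 130 , 23) ∷ (4 , 3 , 130 , 6) ∷ (4 , 1 , 130 , 5) ∷
  (4 , 1 , 130 , 6) ∷ (4 , 1 , 130 , 27) ∷ (4 , 1 , 140 , 20) ∷ (4 , 1 , 130 , 5) ∷ (4 , 1 , 120 , 11) ∷
  (4 , 1 , 120 , 27) ∷ (4 , 1 , 130 , 33) ∷ (4 , 3 , 130 , 1) ∷ (4 , 1 , 130 , 0) ∷ (4 , 1 , 130 , 8) ∷
  (4 , 2 , 140 , 8) ∷ (4 , 1 , 130 , 24) ∷ (4 , 1 , 120 , 10) ∷ (4 , 1 , 120 , 14) ∷ (4 , 2 , 130 , 14) ∷
  (4 , 1 , 130 , 9) ∷ (4 , 1 , 130 , 1) ∷ (4 , 1 , 130 , 16) ∷ (4 , 1 , 130 , 3) ∷ (4 , 2 , 140 , 0) ∷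
  (4 , 1 , 130 , 30) ∷ (4 , 2 , 120 , 3) ∷ (4 , 2 , 130 , 17) ∷ (4 , 1 , 130 , 24) ∷ (4 , 1 , 130 , 2) ∷
  (4 , 1 , 130 , 5) ∷ (4 , 1 , 120 , 0) ∷ (4 , 1 , 120 , 6) ∷ (4 , 2 , 130 , 4) ∷ (4 , 1 , 130 , 19) ∷
  (4 , 1 , 120 , 22) ∷ (4 , 2 , 130 , 13) ∷ (4 , 1 , 130 , 11) ∷ (4 , 2 , 130 , 33) ∷ (4 , 1 , 120 , 30) ∷
  (4 , 1 , 120 , 14) ∷ (4 , 1 , 130 , 2) ∷ (4 , 1 , 130 , 15) ∷ (4 , 1 , 120 , 25) ∷ (4 , 2 , 130 , 27) ∷
  (4 , 1 , 120 , 29) ∷ (4 , 1 , 120 , 33) ∷ (4 , 1 , 130 , 1) ∷ (4 , 1 , 130 , 24) ∷ (4 , 1 , 130 , 1) ∷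
  (4 , 1 , 120 , 22) ∷ (4 , 1 , 120 , 16) ∷ (4 , 2 , 120 , 19) ∷ (4 , 1 , 120 , 34) ∷ (4 , 1 , 120 , 9) ∷
  (4 , 3 , 130 , 10) ∷ (4 , 1 , 120 , 10) ∷ (4 , 4 , 130 , 5) ∷ (4 , 4 , 130 , 9) ∷ (4 , 1 , 120 , 3) ∷
  (4 , 2 , 130 , 11) ∷ (4 , 1 , 120 , 3) ∷ (4 , 5 , 130 , 9) ∷ (4 , 1 , 120 , 4) ∷ (4 , 1 , 130 , 5) ∷
  (4 , 1 , 120 , 30) ∷ (4 , 2 , 130 , 2) ∷ (4 , 2 , 130 , 24) ∷ (4 , 1 , 120 , 20) ∷ (4 , 2 , 130 , 1) ∷
  (4 , 1 , 120 , 11) ∷ (4 , 1 , 120 , 5) ∷ (4 , 1 , 120 , 4) ∷ (4 , 1 , 120 , 1) ∷ (4 , 2 , 120 , 16) ∷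
  (4 , 2 , 120 , 10) ∷ (4 , 1 , 120 , 1) ∷ (4 , 1 , 120 , 10) ∷ (4 , 1 , 120 , 30) ∷ (4 , 1 , 120 , 37) ∷
  (4 , 4 , 130 , 15) ∷ (4 , 1 , 120 , 1) ∷ (4 , 3 , 130 , 10) ∷ (4 , 1 , 120 , 5) ∷ (4 , 2 , 120 , 8) ∷
  (4 , 1 , 120 , 3) ∷ (4 , 1 , 120 , 9) ∷ (4 , 1 , 120 , 19) ∷ (4 , 1 , 120 , 9) ∷ (4 , 1 , 120 , 29) ∷
  (4 , 1 , 120 , 14) ∷ (4 , 1 , 120 , 9) ∷ (4 , 1 , 120 , 34) ∷ (4 , 1 , 130 , 1) ∷ (4 , 1 , 130 , 10) ∷
  (4 , 1 , 120 , 22) ∷ (4 , 1 , 130 , 9) ∷ (4 , 1 , 120 , 26) ∷ (4 , 3 , 130 , 11) ∷ (4 , 1 , 120 , 3) ∷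
  (4 , 1 , 120 , 1) ∷ (4 , 1 , 120 , 9) ∷ (4 , 1 , 120 , 3) ∷ (4 , 1 , 120 , 29) ∷ (4 , 1 , 120 , 36) ∷
  (4 , 3 , 130 , 3) ∷ (4 , 3 , 130 , 1) ∷ (4 , 2 , 120 , 5) ∷ (4 , 1 , 120 , 22) ∷ (4 , 6 , 130 , 33) ∷
  (4 , 3 , 120 , 5) ∷ (4 , 1 , 120 , 9) ∷ (4 , 8 , 130 , 9) ∷ (4 , 2 , 120 , 10) ∷ (4 , 1 , 120 , 8) ∷
  (4 , 1 , 120 , 10) ∷ (4 , 1 , 120 , 8) ∷ (4 , 1 , 120 , 1) ∷ (4 , 1 , 120 , 4) ∷ (4 , 2 , 120 , 9) ∷
  (4 , 4 , 120 , 1) ∷ (4 , 2 , 120 , 15) ∷ (4 , 1 , 120 , 1) ∷ (4 , 2 , 120 , 12) ∷ (4 , 1 , 120 , 1) ∷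
  (4 , 2 , 120 , 21) ∷ (4 , 2 , 120 , 6) ∷ (4 , 2 , 120 , 15) ∷ (4 , 1 , 120 , 16) ∷ (4 , 2 , 120 , 21) ∷
  (4 , 1 , 120 , 13) ∷ (4 , 2 , 120 , 22) ∷ (4 , 1 , 120 , 6) ∷ (4 , 1 , 120 , 5) ∷ (4 , 2 , 120 , 33) ∷
  (4 , 2 , 120 , 5) ∷ (4 , 3 , 120 , 10) ∷ (4 , 2 , 120 , 22) ∷ (4 , 3 , 120 , 14) ∷ (4 , 2 , 120 , 12) ∷
  (4 , 6 , 120 , 6) ∷ (4 , 2 , 120 , 12) ∷ (4 , 1 , 120 , 5) ∷ (4 , 3 , 120 , 9) ∷ (4 , 2 , 120 , 3) ∷
  (4 , 5 , 120 , 26) ∷ (4 , 5 , 120 , 1) ∷ (4 , 5 , 120 , 26) ∷ (4 , 18 , 120 , 5) ∷ (4 , 13 , 120 , 6) ∷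
  (4 , 7 , 120 , 22) ∷ (4 , 12 , 120 , 5) ∷ (4 , 9 , 120 , 14) ∷ (4 , 11 , 120 , 26) ∷ (4 , 37 , 120 , 22) ∷
  (4 , 40 , 120 , 5) ∷ (4 , 40 , 120 , 1) ∷ (4 , 40 , 120 , 1) ∷ (4 , 40 , 120 , 1) ∷ (4 , 40 , 120 , 1) ∷
  (4 , 40 , 120 , 1) ∷ (4 , 40 , 120 , 1) ∷ (4 , 40 , 120 , 1) ∷ (4 , 40 , 120 , 1) ∷ []

-- Assembling the ranges.

menu₃ : Menu
menu₃ = menu (caps 4 2 1 1) offers₃

-- Here and in `covers₂` every tested N is below 1500, so the caps 10, 7, 5, 4 cut no exponent off
-- and n trades its entire smooth part.
covers₁ : Covers 0 101
covers₁ = directs-covers (good-caps 10 7 5 4) (smooth-caps 10 7 5 4) (menu (caps 10 7 5 4) offers₁) directs₁ 0 refl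

covers₂ : Covers 100 401
covers₂ = directs-covers (good-caps 10 7 5 4) (smooth-caps 10 7 5 4) (menu (caps 10 7 5 4) offers₂) directs₂ 100 refl

covers₃ : Covers 400 3013
covers₃ = runs-cover menu₃ runs₁ 400 refl

covers₄ : Covers 3000 40070
covers₄ = runs-cover menu₃ runs₂ 3000 refl

covers₅ : Covers 40000 48483842
covers₅ = runs-cover menu₃ (map (λ { (e , k , q , i) → e , k , q , at i seeds }) runs₃) 40000 refl

small-exchange : Covers 0 48483842
small-exchange =
  -- Each batch of certificates starts at a round threshold slightly below the end of the previous
  -- one; weakening removes the overlaps.
  covers-trans {0} {40070} (covers-trans {0} {3013} (covers-trans {0} {401} (covers-trans {0} {101} covers₁
    (covers-weaken (≤ᵇ-elim {100} refl) covers₂)) (covers-weaken (≤ᵇ-elim {400} refl) covers₃))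
    (covers-weaken (≤ᵇ-elim {3000} refl) covers₄)) (covers-weaken (≤ᵇ-elim {40000} refl) covers₅)

-- As 10 ^ 18 exceeds every threshold of the menu, decoding keeps all of them; `extend` adds the
-- doublings beyond.
reference-cells : Cells
reference-cells = decode 1000000000000000000 menu₃ (at 0 seeds)

-- At 10 ^ 18 the rounding in the reference counts is negligible, and the starting point need only
-- be about the error divided by the unspent proportion, for each prime. The value 40787540 passes
-- this test and lies below the end 48483842 of the certified range.
large-exchange : ∀ t → 1 ≤ t → 40787540 ≤ t → Exchange (ceil7/2 t) t
large-exchange = Limit.scaled-exchange (good-caps 4 2 1 1) (smooth-caps 4 2 1 1) reference-cells
  (sound (caps 4 2 1 1) 1 reference-cells refl) 1000000000000000000 (≤ᵇ-elim {1} refl) 40787540 refl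

trivial-exchange : ∀ N → Exchange N 0
trivial-exchange N = record
  { a = λ _ → 1 ; b = λ _ → 1 ; a-smooth = λ _ → smooth ; b-smooth = λ _ → smooth
  ; b∣n = 1∣_ ; large = λ _ _ _ → z≤n ; balanced = ∣-refl }
  where
  smooth : Smooth7 1
  smooth = ≤7⇒Smooth7 ≤-refl (s≤s z≤n)

exchange : ∀ N → N ≢ 56 → Exchange N (2 * N / 7)
exchange N N≢56 with 2 * N / 7 ≤? 0 | 2 * N / 7 ≤? 48483842
-- The covered ranges contain positive thresholds only, so the threshold 0 is treated apart.
... | yes ≤0 | _       = exchange-mono ≤-refl ≤0 z≤n (trivial-exchange N)
... | no  ≰0 | yes ≤hi = small-exchange N N≢56 (≰⇒> ≰0) ≤hi
... | no  ≰0 | no  ≰hi = exchange-mono (ceil7/2≤ N ≤-refl) ≤-refl (t≤ceil7/2 (2 * N / 7))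
  (large-exchange (2 * N / 7) (≰⇒> ≰0) (≤-trans (≤ᵇ-elim {40787540} {48483842} refl) (<⇒≤ (≰⇒> ≰hi))))

theorem1p3 : (N : ℕ) → ¬ (N ≡ 56) →
    Admissible N ((2 * N) / 7)
    × ((d m : ℕ → ℕ) →
    (∀ n → 1 ≤ n → n ≤ N → (n ≡ d n * m n) × Smooth7 (d n) × Rough7 (m n)) →
    Admissible2357 N d m ((2 * N) / 7))
theorem1p3 N N≢56 = exchange-admissible (exchange N N≢56) , exchange-2357 (exchange N N≢56)
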